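{- Let $p$ be a prime, $q=p^e$, $m,k\ge1$, and let $f\in\mathbb{F}_{q^m}[x_1,\dots,x_k]$ be a homogeneous polynomial of degree $d\ge1$. Put $g=\gcd\big(d,\frac{q^m-1}{q-1}\big)$. Then \[\nu_p\big(N(f=y^q-y)\big)\ge\Big\lceil\frac{em}{g}\Big\lceil\frac{g\,k}{d}\Big\rceil\Big\rceil.\] In particular, when $g=1$, every homogeneous polynomial $f$ of degree $d$ satisfies $\nu_p(N(f=y^q-y))\ge em\lceil k/d\rceil$, and there exists a homogeneous polynomial $f$ of degree $d$ attaining equality.
   Context: $N(f=y^q-y)$ denotes the number of $(x_1,\dots,x_k,y)\in\mathbb{F}_{q^m}^{k+1}$ with $f(x_1,\dots,x_k)=y^q-y$; $\nu_p$ is the $p$-adic valuation. -}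

module Defs where

open import Algebra.Apartness.Bundles using (HeytingField; HeytingCommutativeRing)
open import Algebra.Bundles using (CommutativeRing)
open import Data.Bool.Base using (if_then_else_)
open import Data.Fin.Base using (Fin)
import Data.Fin.Properties as Fin
open import Data.List.Base
  using (List; [_]; foldr; map; filter; length; tabulate; cartesianProduct; cartesianProductWith)
open import Data.Nat.Base as ℕ using (ℕ; zero; suc; NonZero; _≤_)
open import Data.Nat.Divisibility using (_∣?_)
open import Data.Nat.DivMod using (_/_)
open import Data.Nat.GCD using (gcd; gcd[m,n]≢0)
open import Data.Nat.Primality using (Prime; prime⇒nonTrivial)
import Data.Nat.Properties as ℕ
open import Data.Product.Base using (_×_; _,_; proj₁; proj₂)
open import Data.Sum.Base using (inj₁)
open import Data.Vec.Base as Vec using (Vec; []; _∷_)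
import Data.Vec.Properties as Vec
open import Function.Bundles using (Inverse)
open import Function.Properties.Inverse using (Inverse⇒Injection)
open import Level using (_⊔_) renaming (suc to lsuc)
import Relation.Binary.Construct.Add.Supremum.NonStrict _≤_ as NonStrict
open import Relation.Binary.Definitions using (Decidable)
import Relation.Binary.PropositionalEquality as ≡
open ≡ using (_≡_)
open import Relation.Nullary.Construct.Add.Supremum as Sup using (_⁺; ⊤⁺)
open import Relation.Nullary.Decidable using (does; via-injection)
open import Relation.Nullary.Negation using (¬_)

⌈_/_⌉ : (a b : ℕ) .{{_ : NonZero b}} → ℕ
⌈ a / b ⌉ = (a ℕ.+ (b ℕ.∸ 1)) / b

-- The largest v ≤ b with p ^ v ∣ n.
maxExponent≤ : (b p n : ℕ) → ℕ
maxExponent≤ zero    p n = zero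
maxExponent≤ (suc b) p n =
  if does (p ℕ.^ suc b ∣? n) then suc b else maxExponent≤ b p n

-- The p-adic valuation, with ν p 0 = ∞ (written ⊤⁺).  Searching up to n
-- suffices: for p ≥ 2 and n ≥ 1, p ^ v ∣ n forces v < p ^ v ≤ n.
ν : (p n : ℕ) → ℕ ⁺
ν p zero      = ⊤⁺
ν p n@(suc _) = Sup.[ maxExponent≤ n p n ]

infix 4 _≥ν_
_≥ν_ : ℕ ⁺ → ℕ → Set
v ≥ν r = Sup.[ r ] NonStrict.≤⁺ v

primePower∸1≢0 : ∀ {p} → Prime p → ∀ e .{{_ : NonZero e}} → NonZero (p ℕ.^ e ℕ.∸ 1)
primePower∸1≢0 {p} p-prime e@(suc _) = ℕ.>-nonZero (ℕ.m<n⇒0<n∸m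
  (ℕ.^-monoʳ-< p (ℕ.nonTrivial⇒n>1 p {{prime⇒nonTrivial p-prime}}) (ℕ.z<s {n = ℕ.pred e})))

gcd≢0 : ∀ d n .{{_ : NonZero d}} → NonZero (gcd d n)
gcd≢0 d n = ℕ.≢-nonZero (gcd[m,n]≢0 d n (inj₁ (ℕ.≢-nonZero⁻¹ d)))

-- On a finite carrier the apartness of a Heyting field is just ¬ (x ≈ y),
-- so these are exactly the fields with n elements (counted up to _≈_).
record FiniteField c ℓ₁ ℓ₂ (n : ℕ) : Set (lsuc (c ⊔ ℓ₁ ⊔ ℓ₂)) where
  field
    heytingField : HeytingField c ℓ₁ ℓ₂

  commutativeRing : CommutativeRing c ℓ₁
  commutativeRing = HeytingCommutativeRing.commutativeRing
    (HeytingField.heytingCommutativeRing heytingField)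

  open CommutativeRing commutativeRing public

  field
    enumeration : Inverse setoid (≡.setoid (Fin n))

  infix 4 _≟_
  _≟_ : Decidable _≈_
  _≟_ = via-injection (Inverse⇒Injection enumeration) Fin._≟_

  elements : List Carrier
  elements = tabulate (Inverse.from enumeration)

  points : ∀ k → List (Vec Carrier k)
  points zero    = [ [] ]
  points (suc k) = cartesianProductWith _∷_ elements (points k)

module _ {c ℓ₁ ℓ₂ n} (F : FiniteField c ℓ₁ ℓ₂ n) where

  open FiniteField F
  open import Algebra.Properties.Semiring.Exp semiring using (_^_)

  -- A polynomial in k variables is given as a finite formal sum of terms
  -- a · x^α.  Exponent vectors may repeat and coefficients may vanish, so
  -- properties of polynomials are phrased through coeff.
  Polynomial : ℕ → Set c
  Polynomial k = List (Carrier × Vec ℕ k)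

  module _ {k : ℕ} where

    coeff : Polynomial k → Vec ℕ k → Carrier
    coeff f α =
      foldr _+_ 0# (map proj₁ (filter (λ t → Vec.≡-dec ℕ._≟_ (proj₂ t) α) f))

    Homogeneous : ℕ → Polynomial k → Set ℓ₁
    Homogeneous d f = ∀ α → ¬ (coeff f α ≈ 0#) → Vec.sum α ≡ d

    monomial : Vec ℕ k → Vec Carrier k → Carrier
    monomial α x = Vec.foldr′ _*_ 1# (Vec.zipWith _^_ x α)

    eval : Polynomial k → Vec Carrier k → Carrier
    eval f x = foldr _+_ 0# (map (λ (a , α) → a * monomial α x) f)

    -- The number of (x , y) with f x = y ^ q - y; elements (hence points)
    -- meets each ≈-class exactly once, so nothing is counted twice.
    N : (q : ℕ) → Polynomial k → ℕ
    N q f = length (filter (λ (x , y) → eval f x ≟ (y ^ q) - y)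
                           (cartesianProduct (points k) elements))

{-# OPTIONS --safe #-}

-- Lower bound.  Let R = ℤ[F] be the monoid ring of (F , ·) and I the kernel of
-- R → F.  For a lift z~ of z and M = (q ^ m - 1) p ^ V, the power z~ ^ M is
-- 0 or 1 modulo I ^ V according as z is 0 or not.  Hence, modulo I ^ V, N is minus
-- the sum of z~ ^ M over all points, where z = f (x) - y ^ q + y and z~ is the sum of
-- the Teichmüller lifts of the terms of z.  Expanding by the binomial theorem, the
-- valuation of a multinomial coefficient is given by digit sums (Legendre), and the
-- sum of a monomial over all points vanishes unless its exponents are divisible by
-- q ^ m - 1.  Multiplying the exponents by the powers of p modulo q ^ m - 1 and
-- adding up bounds the digit sums below.  Finally an integer in I ^ V is divisible
-- by p ^ V, because (φ x - x ^ p) / p maps I ^ (v + 1) to I ^ v, φ being the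
-- Frobenius lift [ a ] ↦ [ a ^ p ].
--
-- Sharpness.  If d, k ≥ 2, a sum of monomials of degree d in disjoint blocks of
-- variables, each of them linear in one variable, can be counted by summing over the
-- linear variables first.  Otherwise x₁ ^ d works: if g = 1, every a ≠ 0 is c b ^ d
-- with c ^ q = c, so that N (a x ^ d) does not depend on a.

module Submission where

open import Algebra.Apartness.Bundles using (HeytingField)
open import Algebra.Bundles using (AbelianGroup; CommutativeMonoid; CommutativeRing)
import Algebra.Properties.AbelianGroup as AbelianGroupProperties
import Algebra.Properties.CommutativeMonoid.Mult as CMult
import Algebra.Properties.CommutativeMonoid.Sum as CMSum
import Algebra.Properties.CommutativeSemiring.Binomial as Binomial
import Algebra.Properties.CommutativeSemiring.Exp as Exp
import Algebra.Properties.Group as GroupProperties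
import Algebra.Properties.Ring as RingProperties
import Algebra.Properties.Semiring.Mult as Mult
import Algebra.Properties.Semiring.Sum as Sum
open import Data.Bool.Base using (Bool; true; false; if_then_else_)
open import Data.Fin.Base as Fin using (Fin; zero; suc; toℕ; inject₁)
import Data.Fin.Properties as Fin
open import Data.Fin.Permutation using (permutation)
open import Data.Integer.Base as ℤ using (ℤ)
import Data.Integer.Properties as ℤ
import Data.Integer.Tactic.RingSolver as IntSolver
open import Data.List.Base as List using (List; []; _∷_; length; map; filter; replicate)
import Data.List.Properties as List
open import Data.List.Relation.Unary.All as All using (All; []; _∷_)
open import Data.Nat.Base as ℕ using (ℕ; zero; suc; NonZero; z≤n; s≤s)
import Data.Nat.Properties as ℕ
open import Data.Nat.Combinatorics using (_C_; nCk≡n!/k![n-k]!; k![n∸k]!∣n!; nCn≡1)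
open import Data.Nat.Coprimality using (prime⇒coprime; coprime-Bézout; gcd≡1⇒coprime)
open import Data.Nat.Divisibility
open import Data.Nat.DivMod
open import Data.Nat.GCD using (gcd; gcd-greatest; c*gcd[m,n]≡gcd[cm,cn]; module Bézout)
open import Data.Nat.Primality using (Prime; euclidsLemma; prime⇒nonTrivial; ¬prime[0])
open import Data.Nat.Tactic.RingSolver using (solve-∀)
open import Data.Product.Base using (_×_; _,_; proj₁; proj₂; ∃; ∃₂; Σ-syntax)
open import Data.Sum.Base using (_⊎_; inj₁; inj₂; [_,_]′)
open import Data.Vec.Base as Vec using (Vec; []; _∷_; _++_)
import Data.Vec.Properties as Vec
import Data.Vec.Relation.Unary.All as AllV
open import Data.Vec.Functional using (Vector; init; last; tail)
open import Function.Base using (_∘_)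
open import Function.Bundles using (Inverse; mk⇔)
open import Level using (0ℓ; _⊔_) renaming (suc to lsuc)
import Relation.Binary.Construct.Add.Supremum.NonStrict ℕ._≤_ as NonStrict
open import Relation.Binary.PropositionalEquality as ≡ using (_≡_; _≢_; cong; cong₂; subst)
import Relation.Binary.Reasoning.Setoid as SetoidReasoning
import Relation.Nullary.Construct.Add.Supremum as Sup
open import Relation.Nullary.Decidable
  using (Dec; yes; no; does; toSum; ¬?; _×-dec_; dec-true; dec-false; does-⇔; decidable-stable)
open import Relation.Nullary.Negation using (¬_; contradiction)
open import Defs

-- A surviving term of the expansion uses - y ^ q, y and the terms of f with multiplicities u, w and
-- r, where u + w plus the sum of the r is M. The exponent of y gives q u + w ≡ 0 modulo q ^ m - 1.
-- This forces the digit sums of u and w to add up to at least e m (p - 1), exactly the digit sum of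
-- M, so the terms in y settle what M costs. Read modulo q - 1, it also says that q - 1 divides the
-- sum of the r; hence the gcd is taken with (q ^ m - 1) / (q - 1) and not with q ^ m - 1. An
-- exponent 0 escapes these estimates, but summing over its variable contributes q ^ m instead, so
-- such variables are counted separately. ℤ[F] takes the place of the Witt vectors because its
-- Teichmüller map a ↦ [ a ] is multiplicative by construction. The price is that I is not generated
-- by p and that [ 0 ] is not 0: divisibility by p becomes membership in I ^ v, a power sum that
-- would be 0 over the Witt vectors merely lies in every I ^ v, and the return to integers is a step
-- of its own.

module Arithmetic where
  open import Data.Nat.Base
  open ≡ using (refl)

  ∤-* : ∀ {p a b} → Prime p → ¬ p ∣ a → ¬ p ∣ b → ¬ p ∣ a * b
  ∤-* {a = a} {b} pr p∤a p∤b p∣ab = [ p∤a , p∤b ]′ (euclidsLemma a b pr p∣ab)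

  ∤-1 : ∀ {p} → Prime p → ¬ p ∣ 1
  ∤-1 {p} pr p∣1 = ℕ.<⇒≱ (nonTrivial⇒n>1 p {{prime⇒nonTrivial pr}}) (∣⇒≤ p∣1)

  ∤-^ : ∀ {p a} → Prime p → ¬ p ∣ a → ∀ k → ¬ p ∣ a ^ k
  ∤-^ pr p∤a zero    = ∤-1 pr
  ∤-^ pr p∤a (suc k) = ∤-* pr p∤a (∤-^ pr p∤a k)

  ^∣-cancelʳ : ∀ {p c u} → Prime p → ¬ p ∣ u → ∀ t → p ^ t ∣ c * u → p ^ t ∣ c
  ^∣-cancelʳ pr p∤u zero    _ = 1∣ _
  ^∣-cancelʳ {p} {c} {u} pr p∤u (suc t) h
    with [ (λ x → x) , (λ p∣u → contradiction p∣u p∤u) ]′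
         (euclidsLemma c u pr (∣-trans (m∣m*n (p ^ t)) h))
  ... | divides c′ refl = subst (p * p ^ t ∣_) (ℕ.*-comm p c′)
        (*-monoʳ-∣ p (^∣-cancelʳ pr p∤u t (*-cancelˡ-∣ p
          (subst (p * p ^ t ∣_) lem h))))
    where
    instance _ = nonTrivial⇒nonZero p {{prime⇒nonTrivial pr}}
    lem : c′ * p * u ≡ p * (c′ * u)
    lem = solve′ c′ p u
      where solve′ : ∀ a b c → a * b * c ≡ b * (a * c)
            solve′ = solve-∀

  -- Half of the universal property of the ceiling, the other half being `≤-*⌈/⌉`; later facts about
  -- ceilings are drawn from these two and not from the quotient in the definition.
  ⌈/⌉-least : ∀ {a b x} .{{_ : NonZero b}} → a ≤ b * x → ⌈ a / b ⌉ ≤ x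
  ⌈/⌉-least {a} {suc b} {x} h = ℕ.<⇒≤pred (m<n*o⇒m/o<n {m = a + b} {n = suc x} {o = suc b} (begin-strict
    a + b              ≤⟨ ℕ.+-monoˡ-≤ b h ⟩
    suc b * x + b      <⟨ ℕ.n<1+n _ ⟩
    suc (suc b * x + b) ≡⟨ lem b x ⟩
    suc x * suc b      ∎))
    where
    open ℕ.≤-Reasoning
    lem : ∀ b x → suc (suc b * x + b) ≡ suc x * suc b
    lem = solve-∀

  ≤-*⌈/⌉ : ∀ a b .{{_ : NonZero b}} → a ≤ b * ⌈ a / b ⌉
  ≤-*⌈/⌉ a b@(suc b′) = ℕ.+-cancelʳ-≤ b′ a (b * ⌈ a / b ⌉) (begin
    a + b′                              ≡⟨ m≡m%n+[m/n]*n (a + b′) b ⟩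
    (a + b′) % b + (a + b′) / b * b     ≤⟨ ℕ.+-monoˡ-≤ _ (m%n≤n′ (a + b′)) ⟩
    b′ + (a + b′) / b * b               ≡⟨ ℕ.+-comm b′ _ ⟩
    (a + b′) / b * b + b′               ≡⟨ cong (_+ b′) (ℕ.*-comm ((a + b′) / b) b) ⟩
    b * ((a + b′) / b) + b′             ∎)
    where
    open ℕ.≤-Reasoning
    m%n≤n′ : ∀ m → m % b ≤ b′
    m%n≤n′ m = ℕ.<⇒≤pred (m%n<n m b)

  ⌈/⌉-pred : ∀ {a b t} .{{_ : NonZero b}} → ⌈ a / b ⌉ ≡ suc t → b * t < a
  ⌈/⌉-pred {a} {b} {t} eq = ℕ.≰⇒> λ a≤bt →
    ℕ.<⇒≱ (subst (_≤ t) eq (⌈/⌉-least a≤bt)) ℕ.≤-refl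

  -- D divides both R d and R D, hence their gcd. The lower bound sees the gcd only as a nonzero
  -- number with this property, so that it can be instantiated at the literal 1 as well.
  ∣*gcd : ∀ d D R → D ∣ R * d → D ∣ R * gcd d D
  ∣*gcd d D R D∣Rd = subst (D ∣_) (≡.sym (c*gcd[m,n]≡gcd[cm,cn] R d D))
    (gcd-greatest D∣Rd (divides R refl))

  q∸1∣ : ∀ q m → q ∸ 1 ∣ q ^ m ∸ 1
  q∸1∣ zero    zero    = ∣-refl
  q∸1∣ zero    (suc m) = ∣-refl
  q∸1∣ (suc q) m = let B , eq = geometric m in divides B (≡.trans (cong (_∸ 1) eq) (ℕ.*-comm q B))
    where
    geometric : ∀ m → ∃ λ B → suc q ^ m ≡ 1 + q * B
    geometric zero    = 0 , cong suc (≡.sym (ℕ.*-zeroʳ q))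
    geometric (suc m) = let B , eq = geometric m in 1 + q * B + B , ≡.trans (cong (suc q *_) eq) (lem q B)
      where lem : ∀ x B → suc x * (1 + x * B) ≡ 1 + x * (1 + x * B + B)
            lem = solve-∀

  sumTo : (ℕ → ℕ) → ℕ → ℕ
  sumTo f zero    = 0
  sumTo f (suc n) = sumTo f n + f n

  sumTo-cong : ∀ {f g} n → (∀ i → i < n → f i ≡ g i) → sumTo f n ≡ sumTo g n
  sumTo-cong zero    h = refl
  sumTo-cong (suc n) h = cong₂ _+_ (sumTo-cong n λ i i<n → h i (ℕ.m<n⇒m<1+n i<n)) (h n ℕ.≤-refl)

  sumTo-+ : ∀ f g n → sumTo (λ i → f i + g i) n ≡ sumTo f n + sumTo g n
  sumTo-+ f g zero    = refl
  sumTo-+ f g (suc n) = ≡.trans (cong (_+ (f n + g n)) (sumTo-+ f g n))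
    (lem (sumTo f n) (sumTo g n) (f n) (g n))
    where lem : ∀ a b c d → a + b + (c + d) ≡ a + c + (b + d)
          lem = solve-∀

  sumTo-* : ∀ c f n → sumTo (λ i → c * f i) n ≡ c * sumTo f n
  sumTo-* c f zero    = ≡.sym (ℕ.*-zeroʳ c)
  sumTo-* c f (suc n) = ≡.trans (cong (_+ c * f n) (sumTo-* c f n)) (≡.sym (ℕ.*-distribˡ-+ c _ _))

  sumTo-const : ∀ c n → sumTo (λ _ → c) n ≡ n * c
  sumTo-const c zero    = refl
  sumTo-const c (suc n) = ≡.trans (cong (_+ c) (sumTo-const c n)) (ℕ.+-comm (n * c) c)

  sumTo-mono : ∀ {f g} n → (∀ i → f i ≤ g i) → sumTo f n ≤ sumTo g n
  sumTo-mono zero    h = z≤n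
  sumTo-mono (suc n) h = ℕ.+-mono-≤ (sumTo-mono n h) (h n)

  sumTo-shift : ∀ f n → sumTo (λ i → f (suc i)) n + f 0 ≡ sumTo f n + f n
  sumTo-shift f zero    = refl
  sumTo-shift f (suc n) = begin
    sumTo (λ i → f (suc i)) n + f (suc n) + f 0 ≡⟨ lem (sumTo (λ i → f (suc i)) n) (f (suc n)) (f 0) ⟩
    sumTo (λ i → f (suc i)) n + f 0 + f (suc n) ≡⟨ cong (_+ f (suc n)) (sumTo-shift f n) ⟩
    sumTo f n + f n + f (suc n) ∎
    where
    open ≡.≡-Reasoning
    lem : ∀ a b c → a + b + c ≡ a + c + b
    lem = solve-∀

  sumTo-periodic : ∀ f n → (∀ i → f (i + n) ≡ f i) → ∀ j → sumTo (λ i → f (i + j)) n ≡ sumTo f n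
  sumTo-periodic f n per zero    = sumTo-cong n λ i _ → cong f (ℕ.+-identityʳ i)
  sumTo-periodic f n per (suc j) = ≡.trans
    (sumTo-cong n λ i _ → cong f (ℕ.+-suc i j))
    (≡.trans (ℕ.+-cancelʳ-≡ (f j) _ _ (≡.trans (sumTo-shift (λ i → f (i + j)) n)
        (cong (sumTo (λ i → f (i + j)) n +_) (≡.trans (cong f (ℕ.+-comm n j)) (per j)))))
      (sumTo-periodic f n per j))

-- Base-p digit sums: Legendre, Kummer, and rotation modulo p ^ n - 1.

module Digits (p′ : ℕ) (pr : Prime (suc p′)) where
  open import Data.Nat.ListAction using (sum)
  open import Data.Nat.Base
  open ≡ using (refl)
  open Arithmetic

  p : ℕ
  p = suc p′

  0<p′ : 0 < p′
  0<p′ = ℕ.<⇒≤pred (nonTrivial⇒n>1 p {{prime⇒nonTrivial pr}})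

  instance
    p′≢0 : NonZero p′
    p′≢0 = ℕ.>-nonZero 0<p′

  value : List ℕ → ℕ
  value []       = 0
  value (c ∷ cs) = c + p * value cs

  inc : List ℕ → List ℕ
  inc []       = 1 ∷ []
  inc (c ∷ cs) with suc c ℕ.<? p
  ... | yes _ = suc c ∷ cs
  ... | no  _ = 0 ∷ inc cs

  Proper : List ℕ → Set
  Proper = All (_< p)

  inc-proper : ∀ {l} → Proper l → Proper (inc l)
  inc-proper [] = s≤s 0<p′ ∷ []
  inc-proper {c ∷ cs} (c<p ∷ cs<p) with suc c ℕ.<? p
  ... | yes c+1<p = c+1<p ∷ cs<p
  ... | no  _     = s≤s z≤n ∷ inc-proper cs<p

  inc-value : ∀ {l} → Proper l → value (inc l) ≡ suc (value l)
  inc-value [] = cong suc (ℕ.*-zeroʳ p)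
  inc-value {c ∷ cs} (c<p ∷ cs<p) with suc c ℕ.<? p
  ... | yes _     = refl
  ... | no  c+1≮p = begin
    p * value (inc cs)    ≡⟨ cong (p *_) (inc-value cs<p) ⟩
    p * suc (value cs)    ≡⟨ ℕ.*-suc p (value cs) ⟩
    p + p * value cs      ≡⟨ cong (_+ p * value cs) (ℕ.≤-antisym (ℕ.≮⇒≥ c+1≮p) c<p) ⟩
    suc c + p * value cs  ∎
    where open ≡.≡-Reasoning

  -- v is the number of carries.
  carries : ∀ {l} → Proper l → ∃₂ λ v u →
            suc (value l) ≡ p ^ v * u × ¬ p ∣ u × p′ * v + sum (inc l) ≡ suc (sum l)
  carries [] = 0 , 1 , refl , ∤-1 pr , cong (_+ 1) (ℕ.*-zeroʳ p′)
  carries {c ∷ cs} (c<p ∷ cs<p) with suc c ℕ.<? p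
  ... | yes c+1<p = 0 , suc (c + p * value cs) , ≡.sym (ℕ.*-identityˡ _)
      , (λ p∣u → ℕ.<⇒≱ c+1<p (∣⇒≤ (∣m+n∣n⇒∣m {m = suc c} p∣u (m∣m*n (value cs)))))
      , cong (_+ suc (c + sum cs)) (ℕ.*-zeroʳ p′)
    where
    ∣m+n∣n⇒∣m : ∀ {i m n} → i ∣ m + n → i ∣ n → i ∣ m
    ∣m+n∣n⇒∣m {i} {m} {n} h = ∣m+n∣m⇒∣n (subst (i ∣_) (ℕ.+-comm m n) h)
  ... | no c+1≮p with carries cs<p
  ... | v , u , eq , p∤u , sums = suc v , u
      , (begin
          suc c + p * value cs  ≡⟨ cong (_+ p * value cs) c+1≡p ⟩
          p + p * value cs      ≡⟨ ℕ.*-suc p (value cs) ⟨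
          p * suc (value cs)    ≡⟨ cong (p *_) eq ⟩
          p * (p ^ v * u)       ≡⟨ ℕ.*-assoc p (p ^ v) u ⟨
          p * p ^ v * u         ∎)
      , p∤u
      , (begin
          p′ * suc v + sum (inc cs)       ≡⟨ cong (_+ sum (inc cs)) (ℕ.*-suc p′ v) ⟩
          p′ + p′ * v + sum (inc cs)      ≡⟨ ℕ.+-assoc p′ _ _ ⟩
          p′ + (p′ * v + sum (inc cs))    ≡⟨ cong₂ _+_ (≡.sym (ℕ.suc-injective c+1≡p)) sums ⟩
          c + suc (sum cs)                ≡⟨ ℕ.+-suc c (sum cs) ⟩
          suc (c + sum cs)                ∎)
    where
    open ≡.≡-Reasoning
    c+1≡p : suc c ≡ p
    c+1≡p = ℕ.≤-antisym c<p (ℕ.≮⇒≥ c+1≮p)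

  -- Digits are produced by counting up instead of by division, so that Legendre's formula is an
  -- induction with `carries` as its step.
  digits : ℕ → List ℕ
  digits zero    = []
  digits (suc m) = inc (digits m)

  s : ℕ → ℕ
  s m = sum (digits m)

  digits-proper : ∀ m → Proper (digits m)
  digits-proper zero    = []
  digits-proper (suc m) = inc-proper (digits-proper m)

  value-digits : ∀ m → value (digits m) ≡ m
  value-digits zero    = refl
  value-digits (suc m) = ≡.trans (inc-value (digits-proper m)) (cong suc (value-digits m))

  -- Passing from m to `suc m` multiplies the factorial by p ^ v and a number prime to p, v being
  -- the number of carries, while the digit sum falls by (p - 1) v - 1. The last component is (p -
  -- 1) v_p (m !) = m - s m without subtraction.
  legendre : ∀ m → ∃₂ λ a u → m ! ≡ p ^ a * u × ¬ p ∣ u × p′ * a + s m ≡ m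
  legendre zero = 0 , 1 , refl , ∤-1 pr , cong (_+ 0) (ℕ.*-zeroʳ p′)
  legendre (suc m) with legendre m | carries (digits-proper m)
  ... | a , u , m!≡ , p∤u , sums | v , w , 1+m≡ , p∤w , sums′ =
      v + a , w * u
      , (begin
          suc m * m !                       ≡⟨ cong₂ _*_ (≡.trans (cong suc (≡.sym (value-digits m))) 1+m≡) m!≡ ⟩
          p ^ v * w * (p ^ a * u)           ≡⟨ lem (p ^ v) w (p ^ a) u ⟩
          p ^ v * p ^ a * (w * u)           ≡⟨ cong (_* (w * u)) (ℕ.^-distribˡ-+-* p v a) ⟨
          p ^ (v + a) * (w * u)             ∎)
      , ∤-* pr p∤w p∤u
      , (begin
          p′ * (v + a) + s (suc m)          ≡⟨ lem₂ p′ v a (s (suc m)) ⟩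
          p′ * a + (p′ * v + s (suc m))     ≡⟨ cong (p′ * a +_) sums′ ⟩
          p′ * a + suc (s m)                ≡⟨ ℕ.+-suc (p′ * a) (s m) ⟩
          suc (p′ * a + s m)                ≡⟨ cong suc sums ⟩
          suc m                             ∎)
    where
    open ≡.≡-Reasoning
    lem : ∀ a b c d → a * b * (c * d) ≡ a * c * (b * d)
    lem = solve-∀
    lem₂ : ∀ a b c d → a * (b + c) + d ≡ a * c + (a * b + d)
    lem₂ = solve-∀

  C-factorials : ∀ i j → ((i + j) C i) * (i ! * j !) ≡ (i + j) !
  C-factorials i j = begin
    ((i + j) C i) * (i ! * j !)
      ≡⟨ cong (λ x → ((i + j) C i) * (i ! * x !)) (ℕ.m+n∸m≡n i j) ⟨
    ((i + j) C i) * (i ! * (i + j ∸ i) !)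
      ≡⟨ cong (_* (i ! * (i + j ∸ i) !)) (nCk≡n!/k![n-k]! (ℕ.m≤m+n i j)) ⟩
    _ / (i ! * (i + j ∸ i) !) * (i ! * (i + j ∸ i) !)
      ≡⟨ m/n*n≡m (k![n∸k]!∣n! (ℕ.m≤m+n i j)) ⟩
    (i + j) ! ∎
    where
    open ≡.≡-Reasoning
    instance _ = i ℕ.!* (i + j ∸ i) !≢0

  -- Kummer's theorem, by comparing Legendre's formula for i, j and i + j. The equation says that
  -- each factor p of the binomial coefficient is bought with p - 1 units of digit sum.
  C-valuation : ∀ i j → ∃ λ t → p ^ t ∣ ((i + j) C i) × p′ * t + s (i + j) ≡ s i + s j
  C-valuation i j with legendre i | legendre j | legendre (i + j)
  ... | a , u , i! , p∤u , si | b , w , j! , p∤w , sj | c , x , ij! , p∤x , sij =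
    t , ^∣-cancelʳ pr p∤uw t (*-cancelˡ-∣ (p ^ (a + b)) (subst₂ _∣_
        (≡.trans (cong (p ^_) (≡.sym ab+t≡c)) (ℕ.^-distribˡ-+-* p (a + b) t)) (≡.sym C≡) (m∣m*n x)))
    , ℕ.+-cancelˡ-≡ (p′ * (a + b)) _ _ (begin
        p′ * (a + b) + (p′ * t + s (i + j))     ≡⟨ lem₂ p′ a b t (s (i + j)) ⟩
        p′ * (a + b + t) + s (i + j)            ≡⟨ cong (λ y → p′ * y + s (i + j)) ab+t≡c ⟩
        p′ * c + s (i + j)                      ≡⟨ sij ⟩
        i + j                                   ≡⟨ cong₂ _+_ si sj ⟨
        (p′ * a + s i) + (p′ * b + s j)         ≡⟨ lem₃ p′ a b (s i) (s j) ⟩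
        p′ * (a + b) + (s i + s j)              ∎)
    where
    open ≡.≡-Reasoning
    subst₂ = ≡.subst₂
    instance
      _ = ℕ.m^n≢0 p (a + b)
      _ = ℕ.m^n≢0 p c
    p∤uw = ∤-* pr p∤u p∤w
    lem : ∀ a b c d e → a * b * (c * (d * e)) ≡ c * (a * d * (b * e))
    lem = solve-∀
    lem₂ : ∀ a b c d e → a * (b + c) + (a * d + e) ≡ a * (b + c + d) + e
    lem₂ = solve-∀
    lem₃ : ∀ a b c d e → (a * b + d) + (a * c + e) ≡ a * (b + c) + (d + e)
    lem₃ = solve-∀
    C≡ : p ^ (a + b) * (((i + j) C i) * (u * w)) ≡ p ^ c * x
    C≡ = begin
      p ^ (a + b) * (((i + j) C i) * (u * w))
        ≡⟨ cong (_* (((i + j) C i) * (u * w))) (ℕ.^-distribˡ-+-* p a b) ⟩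
      p ^ a * p ^ b * (((i + j) C i) * (u * w))
        ≡⟨ lem (p ^ a) (p ^ b) ((i + j) C i) u w ⟩
      ((i + j) C i) * (p ^ a * u * (p ^ b * w))
        ≡⟨ cong (((i + j) C i) *_) (cong₂ _*_ i! j!) ⟨
      ((i + j) C i) * (i ! * j !) ≡⟨ C-factorials i j ⟩
      (i + j) ! ≡⟨ ij! ⟩
      p ^ c * x ∎
    -- The binomial coefficient is an integer, so p ^ (a + b) divides p ^ c * x with x prime to p;
    -- this makes the truncated difference `t` a genuine one.
    ab≤c : a + b ≤ c
    ab≤c = ℕ.≮⇒≥ λ c<ab → p∤x (*-cancelˡ-∣ (p ^ c) (∣-trans
      (subst₂ _∣_ (ℕ.*-comm p (p ^ c)) (≡.trans (≡.sym (ℕ.^-distribˡ-+-* p (suc c) (a + b ∸ suc c))) (cong (p ^_) (ℕ.m+[n∸m]≡n c<ab)))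
        (m∣m*n (p ^ (a + b ∸ suc c))))
      (subst (p ^ (a + b) ∣_) C≡ (m∣m*n _))))
    t = c ∸ (a + b)
    ab+t≡c : a + b + t ≡ c
    ab+t≡c = ℕ.m+[n∸m]≡n ab≤c

  -- Proper lists of equal value may differ by zeros at the most significant end, so digit sums are
  -- compared and not the lists.
  sum-unique : ∀ {l l′} → Proper l → Proper l′ → value l ≡ value l′ → sum l ≡ sum l′
  sum-zero : ∀ {l} → Proper l → value l ≡ 0 → sum l ≡ 0
  sum-zero [] _ = refl
  sum-zero {c ∷ cs} (_ ∷ cs<p) eq = cong₂ _+_ (ℕ.m+n≡0⇒m≡0 c eq)
    (sum-zero cs<p (ℕ.m*n≡0⇒m≡0 (value cs) p (≡.trans (ℕ.*-comm (value cs) p) (ℕ.m+n≡0⇒n≡0 c eq))))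
  sum-unique [] ps eq = ≡.sym (sum-zero ps (≡.sym eq))
  sum-unique ps@(_ ∷ _) [] eq = sum-zero ps eq
  sum-unique {c ∷ cs} {c′ ∷ cs′} (c<p ∷ ps) (c′<p ∷ ps′) eq =
    cong₂ _+_ c≡c′ (sum-unique ps ps′ (ℕ.*-cancelˡ-≡ _ _ p (ℕ.+-cancelˡ-≡ c _ _
      (≡.trans eq (cong (_+ p * value cs′) (≡.sym c≡c′))))))
    where
    head : ∀ {c v} → c < p → (c + p * v) % p ≡ c
    head {c} {v} c<p = ≡.trans (cong (λ x → (c + x) % p) (ℕ.*-comm p v))
      (≡.trans ([m+kn]%n≡m%n c v p) (m<n⇒m%n≡m c<p))
    c≡c′ : c ≡ c′
    c≡c′ = ≡.trans (≡.sym (head {v = value cs} c<p)) (≡.trans (cong (_% p) eq) (head {v = value cs′} c′<p))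

  -- Least significant digit first, the number consists of V zeros followed by n digits p - 1.
  s-[p^n∸1]p^V : ∀ n V → s ((p ^ n ∸ 1) * p ^ V) ≡ n * p′
  s-[p^n∸1]p^V n V = ≡.trans
    (sum-unique (digits-proper M) (proper V) (≡.trans (value-digits M) (≡.sym (val V))))
    (sum-list V)
    where
    M = (p ^ n ∸ 1) * p ^ V
    list : ℕ → List ℕ
    list V = List.replicate V 0 List.++ List.replicate n p′
    proper₀ : ∀ n → Proper (List.replicate n p′)
    proper₀ zero    = []
    proper₀ (suc n) = ℕ.≤-refl ∷ proper₀ n
    proper : ∀ V → Proper (list V)
    proper zero    = proper₀ n
    proper (suc V) = s≤s z≤n ∷ proper V
    val₀ : ∀ n → suc (value (List.replicate n p′)) ≡ p ^ n
    val₀ zero    = refl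
    val₀ (suc n) = ≡.trans (≡.sym (ℕ.*-suc p (value (List.replicate n p′)))) (cong (p *_) (val₀ n))
    val : ∀ V → value (list V) ≡ (p ^ n ∸ 1) * p ^ V
    val zero    = ≡.trans (cong (_∸ 1) (val₀ n)) (≡.sym (ℕ.*-identityʳ _))
    val (suc V) = ≡.trans (cong (p *_) (val V)) (lem p (p ^ n ∸ 1) (p ^ V))
      where lem : ∀ a b c → a * (b * c) ≡ b * (a * c)
            lem = solve-∀
    sum-list₀ : ∀ n → sum (List.replicate n p′) ≡ n * p′
    sum-list₀ zero    = refl
    sum-list₀ (suc n) = cong (p′ +_) (sum-list₀ n)
    sum-list : ∀ V → sum (list V) ≡ n * p′
    sum-list zero    = sum-list₀ n
    sum-list (suc V) = sum-list V

  -- rot i l is the number with base-p digits l multiplied by p ^ i, where p ^ n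
  -- is identified with 1.
  module Rotation (n : ℕ) .{{_ : NonZero n}} where

    Q′ : ℕ
    Q′ = p ^ n ∸ 1

    1+Q′ : suc Q′ ≡ p ^ n
    1+Q′ = ℕ.suc-pred (p ^ n) {{ℕ.m^n≢0 p n}}

    Q′≢0 : NonZero Q′
    Q′≢0 = primePower∸1≢0 pr n

    ω : ℕ → ℕ
    ω i = p ^ (i % n)

    -- Powers of p ^ n = 1 + Q′ are 1 plus a multiple of Q′. Congruences modulo Q′ are kept as
    -- equations in ℕ, the reduced number never exceeding the original.
    ω-spec : ∀ i → ∃ λ A → p ^ i ≡ ω i + Q′ * A
    ω-spec i with lem (i / n)
      where
      lem : ∀ k → ∃ λ B → suc Q′ ^ k ≡ 1 + Q′ * B
      lem zero    = 0 , cong suc (≡.sym (ℕ.*-zeroʳ Q′))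
      lem (suc k) with lem k
      ... | B , eq = 1 + Q′ * B + B , ≡.trans (cong (suc Q′ *_) eq) (lem′ Q′ B)
        where lem′ : ∀ x B → suc x * (1 + x * B) ≡ 1 + x * (1 + x * B + B)
              lem′ = solve-∀
    ... | B , eq = ω i * B , (begin
      p ^ i                             ≡⟨ cong (p ^_) (m≡m%n+[m/n]*n i n) ⟩
      p ^ (i % n + i / n * n)           ≡⟨ ℕ.^-distribˡ-+-* p (i % n) (i / n * n) ⟩
      ω i * p ^ (i / n * n)             ≡⟨ cong (λ x → ω i * p ^ x) (ℕ.*-comm (i / n) n) ⟩
      ω i * p ^ (n * (i / n))           ≡⟨ cong (ω i *_) (ℕ.^-*-assoc p n (i / n)) ⟨
      ω i * (p ^ n) ^ (i / n)           ≡⟨ cong (λ x → ω i * x ^ (i / n)) 1+Q′ ⟨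
      ω i * suc Q′ ^ (i / n)            ≡⟨ cong (ω i *_) eq ⟩
      ω i * (1 + Q′ * B)                ≡⟨ lem″ (ω i) Q′ B ⟩
      ω i + Q′ * (ω i * B)              ∎)
      where
      open ≡.≡-Reasoning
      lem″ : ∀ a x B → a * (1 + x * B) ≡ a + x * (a * B)
      lem″ = solve-∀

    rot : ℕ → List ℕ → ℕ
    rot i []       = 0
    rot i (c ∷ cs) = c * ω i + rot (suc i) cs

    rot-cong : ∀ i l → ∃ λ A → p ^ i * value l ≡ rot i l + Q′ * A
    rot-cong i []       = 0 , ≡.trans (ℕ.*-zeroʳ (p ^ i)) (≡.sym (ℕ.*-zeroʳ Q′))
    rot-cong i (c ∷ cs) with ω-spec i | rot-cong (suc i) cs
    ... | A , eq | B , eq′ = c * A + B , (begin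
      p ^ i * (c + p * value cs)                   ≡⟨ lem (p ^ i) c p (value cs) ⟩
      c * p ^ i + p * p ^ i * value cs             ≡⟨ cong₂ (λ x y → c * x + y) eq eq′ ⟩
      c * (ω i + Q′ * A) + (rot (suc i) cs + Q′ * B) ≡⟨ lem₂ c (ω i) Q′ A (rot (suc i) cs) B ⟩
      c * ω i + rot (suc i) cs + Q′ * (c * A + B)  ∎)
      where
      open ≡.≡-Reasoning
      lem : ∀ a c p v → a * (c + p * v) ≡ c * a + p * a * v
      lem = solve-∀
      lem₂ : ∀ c w x A r B → c * (w + x * A) + (r + x * B) ≡ c * w + r + x * (c * A + B)
      lem₂ = solve-∀

    -- Every `ω i` is positive. The bounds rest on a positive multiple of Q′ being at least Q′, so
    -- reduction has to keep nonzero numbers nonzero.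
    rot≡0 : ∀ i l → rot i l ≡ 0 → value l ≡ 0
    rot≡0 i []       _  = refl
    rot≡0 i (c ∷ cs) eq = cong₂ _+_
      (ℕ.m*n≡0⇒m≡0 c (ω i) {{ℕ.m^n≢0 p (i % n)}} (ℕ.m+n≡0⇒m≡0 (c * ω i) eq))
      (≡.trans (cong (p *_) (rot≡0 (suc i) cs (ℕ.m+n≡0⇒n≡0 (c * ω i) eq))) (ℕ.*-zeroʳ p))

    -- The number (p ^ n - 1) / (p - 1), see `p′*T`.
    T : ℕ
    T = sumTo ω n

    p′*T : p′ * T ≡ Q′
    p′*T = ℕ.suc-injective (≡.trans (cong (λ x → suc (p′ * x)) (sumTo-cong n λ i i<n → cong (p ^_) (m<n⇒m%n≡m i<n)))
      (≡.trans (geometric n) (≡.sym 1+Q′)))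
      where
      geometric : ∀ n → suc (p′ * sumTo (p ^_) n) ≡ p ^ n
      geometric zero    = cong suc (ℕ.*-zeroʳ p′)
      geometric (suc n) = ≡.trans (lem p′ (sumTo (p ^_) n) (p ^ n)) (cong (_+ p′ * p ^ n) (geometric n))
        where lem : ∀ a x y → suc (a * (x + y)) ≡ suc (a * x) + a * y
              lem = solve-∀

    T≢0 : NonZero T
    T≢0 = ≢-nonZero λ T≡0 → ≢-nonZero⁻¹ Q′ {{Q′≢0}}
      (≡.trans (≡.sym p′*T) (≡.trans (cong (p′ *_) T≡0) (ℕ.*-zeroʳ p′)))

    -- Over a full period each digit meets every power p ^ 0, ..., p ^ (n - 1) once, whatever its
    -- place, so that only the digit sum remains.
    sum-rot : ∀ l j → sumTo (λ i → rot (i + j) l) n ≡ sum l * T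
    sum-rot []       j = ≡.trans (sumTo-const 0 n) (ℕ.*-zeroʳ n)
    sum-rot (c ∷ cs) j = begin
      sumTo (λ i → c * ω (i + j) + rot (suc (i + j)) cs) n
        ≡⟨ sumTo-+ (λ i → c * ω (i + j)) (λ i → rot (suc (i + j)) cs) n ⟩
      sumTo (λ i → c * ω (i + j)) n + sumTo (λ i → rot (suc (i + j)) cs) n
        ≡⟨ cong₂ _+_ (sumTo-* c (λ i → ω (i + j)) n)
             (sumTo-cong n λ i _ → cong (λ x → rot x cs) (≡.sym (ℕ.+-suc i j))) ⟩
      c * sumTo (λ i → ω (i + j)) n + sumTo (λ i → rot (i + suc j) cs) n
        ≡⟨ cong₂ (λ x y → c * x + y) (sumTo-periodic ω n (λ i → cong (p ^_) ([m+n]%n≡m%n i n)) j)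
             (sum-rot cs (suc j)) ⟩
      c * T + sum cs * T
        ≡⟨ ℕ.*-distribʳ-+ T c (sum cs) ⟨
      (c + sum cs) * T ∎
      where open ≡.≡-Reasoning

    r⟨_⟩ : ℕ → ℕ → ℕ
    r⟨ i ⟩ m = rot i (digits m)

    r-spec : ∀ i m → ∃ λ A → p ^ i * m ≡ r⟨ i ⟩ m + Q′ * A
    r-spec i m with rot-cong i (digits m)
    ... | A , eq = A , ≡.trans (cong (p ^ i *_) (≡.sym (value-digits m))) eq

    r≡0 : ∀ i m → r⟨ i ⟩ m ≡ 0 → m ≡ 0
    r≡0 i m eq = ≡.trans (≡.sym (value-digits m)) (rot≡0 i (digits m) eq)

    sum-r : ∀ m j → sumTo (λ i → r⟨ i + j ⟩ m) n ≡ s m * T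
    sum-r m = sum-rot (digits m)

    -- For each i the number r⟨ i + e ⟩ u + r⟨ i ⟩ w is congruent to p ^ i (p ^ e u + w), hence a
    -- positive multiple of Q′. In the sum over a period of i the shift by e disappears, and p′ T =
    -- Q′ is cancelled.
    pair-bound : ∀ e u w → Q′ ∣ p ^ e * u + w → p ^ e * u + w ≢ 0 → n * p′ ≤ s u + s w
    pair-bound e u w Q′∣ ≢0 = ℕ.*-cancelʳ-≤ _ _ T {{T≢0}} (begin
      n * p′ * T          ≡⟨ ℕ.*-assoc n p′ T ⟩
      n * (p′ * T)        ≡⟨ cong (n *_) p′*T ⟩
      n * Q′              ≡⟨ sumTo-const Q′ n ⟨
      sumTo (λ _ → Q′) n  ≤⟨ sumTo-mono n each ⟩
      sumTo (λ i → r⟨ i + e ⟩ u + r⟨ i + 0 ⟩ w) n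
        ≡⟨ sumTo-+ (λ i → r⟨ i + e ⟩ u) (λ i → r⟨ i + 0 ⟩ w) n ⟩
      _                   ≡⟨ cong₂ _+_ (sum-r u e) (sum-r w 0) ⟩
      s u * T + s w * T   ≡⟨ ℕ.*-distribʳ-+ T (s u) (s w) ⟨
      (s u + s w) * T     ∎)
      where
      open ℕ.≤-Reasoning
      each : ∀ i → Q′ ≤ r⟨ i + e ⟩ u + r⟨ i + 0 ⟩ w
      each i with r-spec (i + e) u | r-spec (i + 0) w
      ... | A , eq | B , eq′ = ∣⇒≤ {{≢-nonZero sum≢0}} (∣m+n∣m⇒∣n (subst (Q′ ∣_) (begin-equality
          p ^ i * (p ^ e * u + w)
            ≡⟨ lem (p ^ i) (p ^ e) u w ⟩
          p ^ i * p ^ e * u + p ^ i * w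
            ≡⟨ cong₂ (λ x y → x * u + p ^ y * w) (≡.sym (ℕ.^-distribˡ-+-* p i e)) (≡.sym (ℕ.+-identityʳ i)) ⟩
          p ^ (i + e) * u + p ^ (i + 0) * w
            ≡⟨ cong₂ _+_ eq eq′ ⟩
          r⟨ i + e ⟩ u + Q′ * A + (r⟨ i + 0 ⟩ w + Q′ * B)
            ≡⟨ lem₂ (r⟨ i + e ⟩ u) (r⟨ i + 0 ⟩ w) Q′ A B ⟩
          Q′ * (A + B) + (r⟨ i + e ⟩ u + r⟨ i + 0 ⟩ w) ∎)
          (∣n⇒∣m*n (p ^ i) Q′∣)) (m∣m*n (A + B)))
        where
        lem : ∀ a b u w → a * (b * u + w) ≡ a * b * u + a * w
        lem = solve-∀
        lem₂ : ∀ a b x A B → a + x * A + (b + x * B) ≡ x * (A + B) + (a + b)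
        lem₂ = solve-∀
        sum≢0 : r⟨ i + e ⟩ u + r⟨ i + 0 ⟩ w ≢ 0
        sum≢0 eq₀ = ≢0 (≡.trans (cong₂ (λ x y → p ^ e * x + y)
            (r≡0 (i + e) u (ℕ.m+n≡0⇒m≡0 _ eq₀))
            (r≡0 (i + 0) w (ℕ.m+n≡0⇒n≡0 (r⟨ i + e ⟩ u) eq₀)))
          (≡.trans (ℕ.+-identityʳ _) (ℕ.*-zeroʳ (p ^ e))))

-- Multiplicities of terms and the exponent vectors they produce.

module Weights where
  open import Data.Nat.Base
  open ≡ using (refl)

  origin : ∀ k → Vec ℕ k
  origin k = Vec.replicate k 0

  sum-origin : ∀ k → Vec.sum (origin k) ≡ 0
  sum-origin zero    = refl
  sum-origin (suc k) = sum-origin k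

  -- A pair (r , α) records that the term with exponent α is chosen r times in an expanded power.
  -- The function w makes it possible to replace all multiplicities by their rotations.
  weighted : ∀ {k} → (ℕ → ℕ) → List (ℕ × Vec ℕ k) → Vec ℕ k
  weighted w []             = origin _
  weighted w ((r , α) ∷ ps) = Vec.zipWith _+_ (Vec.map (w r *_) α) (weighted w ps)

  combination : ∀ {k} → List (ℕ × Vec ℕ k) → Vec ℕ k
  combination = weighted (λ r → r)

  weights : ∀ {k} → (ℕ → ℕ) → List (ℕ × Vec ℕ k) → ℕ
  weights w []             = 0
  weights w ((r , α) ∷ ps) = w r + weights w ps

  -- A coordinate 0 is a multiple of Q′ without being at least Q′. Summing over its variable gives
  -- an element of I ^ n instead, so these coordinates are accounted for separately.
  zeros : ∀ {k} → Vec ℕ k → ℕ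
  zeros []            = 0
  zeros (zero  ∷ v)   = suc (zeros v)
  zeros (suc _ ∷ v)   = zeros v

  AllDegree : ∀ {a} {A : Set a} {k} → ℕ → List (A × Vec ℕ k) → Set a
  AllDegree d = All (λ t → Vec.sum (proj₂ t) ≡ d)

  sum-zipWith-+ : ∀ {k} (u v : Vec ℕ k) → Vec.sum (Vec.zipWith _+_ u v) ≡ Vec.sum u + Vec.sum v
  sum-zipWith-+ []      []      = refl
  sum-zipWith-+ (a ∷ u) (b ∷ v) = ≡.trans (cong (a + b +_) (sum-zipWith-+ u v)) (lem a b (Vec.sum u) (Vec.sum v))
    where lem : ∀ a b c d → a + b + (c + d) ≡ a + c + (b + d)
          lem = solve-∀

  sum-map-* : ∀ {k} c (v : Vec ℕ k) → Vec.sum (Vec.map (c *_) v) ≡ c * Vec.sum v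
  sum-map-* c []      = ≡.sym (ℕ.*-zeroʳ c)
  sum-map-* c (a ∷ v) = ≡.trans (cong (c * a +_) (sum-map-* c v)) (≡.sym (ℕ.*-distribˡ-+ c a _))

  sum-weighted : ∀ {k d} w {ps : List (ℕ × Vec ℕ k)} → AllDegree d ps →
                 Vec.sum (weighted w ps) ≡ d * weights w ps
  sum-weighted {k} {d} w [] = ≡.trans (sum-origin k) (≡.sym (ℕ.*-zeroʳ d))
  sum-weighted {k} {d} w {(r , α) ∷ ps} (deg ∷ degs) = begin
    Vec.sum (Vec.zipWith _+_ (Vec.map (w r *_) α) (weighted w ps))
      ≡⟨ sum-zipWith-+ (Vec.map (w r *_) α) (weighted w ps) ⟩
    Vec.sum (Vec.map (w r *_) α) + Vec.sum (weighted w ps)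
      ≡⟨ cong₂ _+_ (≡.trans (sum-map-* (w r) α) (cong (w r *_) deg)) (sum-weighted w degs) ⟩
    w r * d + d * weights w ps  ≡⟨ cong (_+ d * weights w ps) (ℕ.*-comm (w r) d) ⟩
    d * w r + d * weights w ps  ≡⟨ ℕ.*-distribˡ-+ d (w r) _ ⟨
    d * (w r + weights w ps)    ∎
    where open ≡.≡-Reasoning

  coordinate : ∀ {k} → Fin k → (ℕ → ℕ) → List (ℕ × Vec ℕ k) → ℕ
  coordinate i w []             = 0
  coordinate i w ((r , α) ∷ ps) = w r * Vec.lookup α i + coordinate i w ps

  lookup-weighted : ∀ {k} (i : Fin k) w ps → Vec.lookup (weighted w ps) i ≡ coordinate i w ps
  lookup-weighted i w []             = Vec.lookup-replicate i 0
  lookup-weighted i w ((r , α) ∷ ps) = ≡.trans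
    (Vec.lookup-zipWith _+_ i (Vec.map (w r *_) α) (weighted w ps))
    (cong₂ _+_ (Vec.lookup-map i (w r *_) α) (lookup-weighted i w ps))

  zeros-antitone : ∀ {k} (u v : Vec ℕ k) → (∀ i → Vec.lookup u i ≡ 0 → Vec.lookup v i ≡ 0) → zeros u ≤ zeros v
  zeros-antitone []          []          h = z≤n
  zeros-antitone (zero ∷ u)  (zero ∷ v)  h = s≤s (zeros-antitone u v λ i → h (suc i))
  zeros-antitone (zero ∷ u)  (suc _ ∷ v) h with () ← h zero refl
  zeros-antitone (suc _ ∷ u) (zero ∷ v)  h = ℕ.m≤n⇒m≤1+n (zeros-antitone u v λ i → h (suc i))
  zeros-antitone (suc _ ∷ u) (suc _ ∷ v) h = zeros-antitone u v λ i → h (suc i)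

  -- Each coordinate is either 0, and counted by `zeros`, or at least m, and then contributes at
  -- least 1 to B.
  multiples : ∀ {k} m (v : Vec ℕ k) → (∀ i → m ∣ Vec.lookup v i) →
              ∃ λ B → Vec.sum v ≡ m * B × k ≤ B + zeros v
  multiples m []         h = 0 , ≡.sym (ℕ.*-zeroʳ m) , z≤n
  multiples m (a ∷ v)    h with multiples m v (λ i → h (suc i)) | h zero
  multiples {suc k} m (zero ∷ v)  h | B , eq , k≤ | _ = B , eq , subst (suc k ≤_) (≡.sym (ℕ.+-suc B _)) (s≤s k≤)
  multiples m (suc a ∷ v) h | B , eq , k≤ | divides (suc c) refl′ = suc c + B
    , ≡.trans (cong₂ _+_ (≡.trans refl′ (ℕ.*-comm (suc c) m)) eq) (≡.sym (ℕ.*-distribˡ-+ m (suc c) B))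
    , s≤s (ℕ.≤-trans k≤ (ℕ.+-monoˡ-≤ _ (ℕ.m≤n+m B c)))

-- The digit sum bound for terms of degree d.

module Degrees (p′ : ℕ) (pr : Prime (suc p′)) (n : ℕ) .{{_ : NonZero n}} where
  open import Data.Nat.Base
  open ≡ using (refl)
  open Arithmetic
  open Weights
  open Digits p′ pr
  open Rotation n

  coordinate-rot : ∀ {k} i (t : Fin k) ps →
    ∃ λ A → p ^ i * coordinate t (λ r → r) ps ≡ coordinate t r⟨ i ⟩ ps + Q′ * A
  coordinate-rot i t []             = 0 , ≡.trans (ℕ.*-zeroʳ (p ^ i)) (≡.sym (ℕ.*-zeroʳ Q′))
  coordinate-rot i t ((r , α) ∷ ps) with r-spec i r | coordinate-rot i t ps
  ... | A , eq | B , eq′ = A * a + B , (begin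
    p ^ i * (r * a + coordinate t (λ r → r) ps)             ≡⟨ lem (p ^ i) r a _ ⟩
    p ^ i * r * a + p ^ i * coordinate t (λ r → r) ps       ≡⟨ cong₂ (λ x y → x * a + y) eq eq′ ⟩
    (r⟨ i ⟩ r + Q′ * A) * a + (coordinate t r⟨ i ⟩ ps + Q′ * B) ≡⟨ lem₂ (r⟨ i ⟩ r) Q′ A a _ B ⟩
    r⟨ i ⟩ r * a + coordinate t r⟨ i ⟩ ps + Q′ * (A * a + B)  ∎)
    where
    open ≡.≡-Reasoning
    a = Vec.lookup α t
    lem : ∀ x r a y → x * (r * a + y) ≡ x * r * a + x * y
    lem = solve-∀
    lem₂ : ∀ r x A a c B → (r + x * A) * a + (c + x * B) ≡ r * a + c + x * (A * a + B)
    lem₂ = solve-∀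

  coordinate-rot≡0 : ∀ {k} i (t : Fin k) ps → coordinate t r⟨ i ⟩ ps ≡ 0 → coordinate t (λ r → r) ps ≡ 0
  coordinate-rot≡0 i t []             _  = refl
  coordinate-rot≡0 i t ((r , α) ∷ ps) eq = cong₂ _+_
    ([ (λ r≡0′ → cong (_* Vec.lookup α t) (r≡0 i r r≡0′))
     , (λ a≡0 → ≡.trans (cong (r *_) a≡0) (ℕ.*-zeroʳ r)) ]′
       (ℕ.m*n≡0⇒m≡0∨n≡0 (r⟨ i ⟩ r) (ℕ.m+n≡0⇒m≡0 _ eq)))
    (coordinate-rot≡0 i t ps (ℕ.m+n≡0⇒n≡0 (r⟨ i ⟩ r * Vec.lookup α t) eq))

  weights-rot : ∀ {k} i (ps : List (ℕ × Vec ℕ k)) →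
    ∃ λ A → p ^ i * weights (λ r → r) ps ≡ weights r⟨ i ⟩ ps + Q′ * A
  weights-rot i []             = 0 , ≡.trans (ℕ.*-zeroʳ (p ^ i)) (≡.sym (ℕ.*-zeroʳ Q′))
  weights-rot i ((r , α) ∷ ps) with r-spec i r | weights-rot i ps
  ... | A , eq | B , eq′ = A + B , (begin
    p ^ i * (r + weights (λ r → r) ps)                    ≡⟨ ℕ.*-distribˡ-+ (p ^ i) r _ ⟩
    p ^ i * r + p ^ i * weights (λ r → r) ps              ≡⟨ cong₂ _+_ eq eq′ ⟩
    r⟨ i ⟩ r + Q′ * A + (weights r⟨ i ⟩ ps + Q′ * B)      ≡⟨ lem (r⟨ i ⟩ r) Q′ A _ B ⟩
    r⟨ i ⟩ r + weights r⟨ i ⟩ ps + Q′ * (A + B)           ∎)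
    where
    open ≡.≡-Reasoning
    lem : ∀ r x A c B → r + x * A + (c + x * B) ≡ r + c + x * (A + B)
    lem = solve-∀

  sum-weights-rot : ∀ {k} (ps : List (ℕ × Vec ℕ k)) → sumTo (λ i → weights r⟨ i ⟩ ps) n ≡ weights s ps * T
  sum-weights-rot []             = ≡.trans (sumTo-const 0 n) (ℕ.*-zeroʳ n)
  sum-weights-rot ((r , α) ∷ ps) = begin
    sumTo (λ i → r⟨ i ⟩ r + weights r⟨ i ⟩ ps) n
      ≡⟨ sumTo-+ (λ i → r⟨ i ⟩ r) (λ i → weights r⟨ i ⟩ ps) n ⟩
    sumTo (λ i → r⟨ i ⟩ r) n + sumTo (λ i → weights r⟨ i ⟩ ps) n
      ≡⟨ cong₂ _+_ (≡.trans (sumTo-cong n λ i _ → cong (λ x → r⟨ x ⟩ r) (≡.sym (ℕ.+-identityʳ i))) (sum-r r 0))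
           (sum-weights-rot ps) ⟩
    s r * T + weights s ps * T  ≡⟨ ℕ.*-distribʳ-+ T (s r) _ ⟨
    (s r + weights s ps) * T    ∎
    where open ≡.≡-Reasoning

  -- D stands for (q ^ m - 1) / (q - 1).
  module _ {k d D q′ g : ℕ} .{{_ : NonZero d}} (q′D : q′ * D ≡ Q′)
           (∣*g : ∀ R → D ∣ R * d → D ∣ R * g) where
    private
      instance
        q′≢0 : NonZero q′
        q′≢0 = ≢-nonZero λ q′≡0 → ≢-nonZero⁻¹ Q′ {{Q′≢0}} (≡.trans (≡.sym q′D) (cong (_* D) q′≡0))
      K = ⌈ g * k / d ⌉

    -- With R = R′ q′, dividing d R = Q′ B by q′ leaves d R′ = D B, so D divides R′ d and therefore
    -- R′ g. This is how the divisibility of R by q′ brings in D in place of Q′.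
    gcd-factor : ∀ {R B} → q′ ∣ R → d * R ≡ Q′ * B → ∃ λ U → g * R ≡ Q′ * U × d * U ≡ g * B
    gcd-factor {R} {B} (divides R′ R≡) dR≡ with ∣*g R′ D∣R′d
      where
      dR′≡DB : d * R′ ≡ D * B
      dR′≡DB = ℕ.*-cancelˡ-≡ _ _ q′ {{q′≢0}} (begin
        q′ * (d * R′)   ≡⟨ lem q′ d R′ ⟩
        d * (R′ * q′)   ≡⟨ cong (d *_) R≡ ⟨
        d * R           ≡⟨ dR≡ ⟩
        Q′ * B          ≡⟨ cong (_* B) q′D ⟨
        q′ * D * B      ≡⟨ ℕ.*-assoc q′ D B ⟩
        q′ * (D * B)    ∎)
        where
        open ≡.≡-Reasoning
        lem : ∀ a b c → a * (b * c) ≡ b * (c * a)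
        lem = solve-∀
      D∣R′d : D ∣ R′ * d
      D∣R′d = divides B (≡.trans (ℕ.*-comm R′ d) (≡.trans dR′≡DB (ℕ.*-comm D B)))
    ... | divides U R′g≡UD = U , gR≡
        , ℕ.*-cancelˡ-≡ _ _ Q′ {{Q′≢0}} (begin
          Q′ * (d * U)    ≡⟨ lem₃ Q′ d U ⟩
          d * (Q′ * U)    ≡⟨ cong (d *_) gR≡ ⟨
          d * (g * R)     ≡⟨ lem₃ d g R ⟩
          g * (d * R)     ≡⟨ cong (g *_) dR≡ ⟩
          g * (Q′ * B)    ≡⟨ lem₃ g Q′ B ⟩
          Q′ * (g * B)    ∎)
      where
      open ≡.≡-Reasoning
      lem₁ : ∀ a b c → a * b * c ≡ a * (c * b)
      lem₁ = solve-∀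
      lem₂ : ∀ a b c → a * (b * c) ≡ c * (b * a)
      lem₂ = solve-∀
      lem₃ : ∀ a b c → a * (b * c) ≡ b * (a * c)
      lem₃ = solve-∀
      gR≡ : g * R ≡ Q′ * U
      gR≡ = ≡.sym (begin
        Q′ * U          ≡⟨ cong (_* U) q′D ⟨
        q′ * D * U      ≡⟨ lem₁ q′ D U ⟩
        q′ * (U * D)    ≡⟨ cong (q′ *_) R′g≡UD ⟨
        q′ * (R′ * g)   ≡⟨ lem₂ q′ R′ g ⟩
        g * (R′ * q′)   ≡⟨ cong (g *_) R≡ ⟨
        g * R           ∎)

    -- U is an integer with d U = g B, so that d (U + g z′) ≥ g (B + z′) ≥ g k can be rounded up:
    -- here the inner ceiling of the theorem arises.
    ceiling-bound : ∀ {R B z z′} → q′ ∣ R → d * R ≡ Q′ * B → k ≤ B + z → z ≤ z′ →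
                    Q′ * K ≤ g * R + Q′ * (g * z′)
    ceiling-bound {R} {B} {z} {z′} q′∣R dR≡ k≤ z≤z′ = let U , gR≡ , dU≡ = gcd-factor q′∣R dR≡ in begin
      Q′ * K                      ≤⟨ ℕ.*-monoʳ-≤ Q′ (⌈/⌉-least {a = g * k} {b = d} (gk≤ dU≡)) ⟩
      Q′ * (U + g * z′)           ≡⟨ ℕ.*-distribˡ-+ Q′ U (g * z′) ⟩
      Q′ * U + Q′ * (g * z′)      ≡⟨ cong (_+ Q′ * (g * z′)) gR≡ ⟨
      g * R + Q′ * (g * z′)       ∎
      where
      open ℕ.≤-Reasoning
      gk≤ : ∀ {U} → d * U ≡ g * B → g * k ≤ d * (U + g * z′)
      gk≤ {U} dU≡ = begin
        g * k                     ≤⟨ ℕ.*-monoʳ-≤ g (ℕ.≤-trans k≤ (ℕ.+-monoʳ-≤ B z≤z′)) ⟩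
        g * (B + z′)              ≡⟨ ℕ.*-distribˡ-+ g B z′ ⟩
        g * B + g * z′            ≤⟨ ℕ.+-monoʳ-≤ (g * B) (ℕ.m≤n*m (g * z′) d) ⟩
        g * B + d * (g * z′)      ≡⟨ cong (_+ d * (g * z′)) dU≡ ⟨
        d * U + d * (g * z′)      ≡⟨ ℕ.*-distribˡ-+ d U (g * z′) ⟨
        d * (U + g * z′)          ∎

    -- Multiplying all multiplicities by p ^ i keeps the divisibility hypotheses, and reducing them
    -- afterwards creates no new zero coordinate, so `ceiling-bound` applies to every rotation.
    rotation-bound : ∀ {ps : List (ℕ × Vec ℕ k)} → AllDegree d ps →
      (∀ t → Q′ ∣ coordinate t (λ r → r) ps) → q′ ∣ weights (λ r → r) ps →
      ∀ i → Q′ * K ≤ g * weights r⟨ i ⟩ ps + Q′ * (g * zeros (combination ps))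
    rotation-bound {ps} degs Q′∣ q′∣ i =
      ceiling-bound {z = zeros (weighted r⟨ i ⟩ ps)} q′∣R
        (≡.trans (≡.sym (sum-weighted r⟨ i ⟩ degs)) (proj₁ (proj₂ B-spec))) (proj₂ (proj₂ B-spec)) zeros≤
      where
      div : ∀ t → Q′ ∣ Vec.lookup (weighted r⟨ i ⟩ ps) t
      div t = let A , eq = coordinate-rot i t ps in subst (Q′ ∣_) (≡.sym (lookup-weighted t r⟨ i ⟩ ps))
        (∣m+n∣m⇒∣n (subst (Q′ ∣_) (≡.trans eq (ℕ.+-comm _ (Q′ * A))) (∣n⇒∣m*n (p ^ i) (Q′∣ t))) (m∣m*n A))
      B-spec = multiples Q′ (weighted r⟨ i ⟩ ps) div
      q′∣R : q′ ∣ weights r⟨ i ⟩ ps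
      q′∣R = let A , eq = weights-rot i ps in
        ∣m+n∣m⇒∣n (subst (q′ ∣_) (≡.trans eq (ℕ.+-comm _ (Q′ * A))) (∣n⇒∣m*n (p ^ i) q′∣))
          (∣-trans (divides D (≡.trans (≡.sym q′D) (ℕ.*-comm q′ D))) (m∣m*n A))
      zeros≤ : zeros (weighted r⟨ i ⟩ ps) ≤ zeros (combination ps)
      zeros≤ = zeros-antitone (weighted r⟨ i ⟩ ps) (combination ps) λ t eq →
        ≡.trans (lookup-weighted t (λ r → r) ps)
          (coordinate-rot≡0 i t ps (≡.trans (≡.sym (lookup-weighted t r⟨ i ⟩ ps)) eq))

    -- Summing `rotation-bound` over a period turns the rotated multiplicities into digit sums times
    -- T, and p′ T = Q′ lets T be cancelled.
    degree-bound : ∀ {ps : List (ℕ × Vec ℕ k)} → AllDegree d ps →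
      (∀ t → Q′ ∣ coordinate t (λ r → r) ps) → q′ ∣ weights (λ r → r) ps →
      p′ * (n * K) ≤ g * (weights s ps + p′ * (n * zeros (combination ps)))
    degree-bound {ps} degs Q′∣ q′∣ = ℕ.*-cancelʳ-≤ _ _ T {{T≢0}} (begin
      p′ * (n * K) * T              ≡⟨ lem₁ p′ n K T ⟩
      n * (p′ * T * K)              ≡⟨ cong (λ x → n * (x * K)) p′*T ⟩
      n * (Q′ * K)                  ≡⟨ sumTo-const (Q′ * K) n ⟨
      sumTo (λ _ → Q′ * K) n        ≤⟨ sumTo-mono n (rotation-bound degs Q′∣ q′∣) ⟩
      sumTo (λ i → g * weights r⟨ i ⟩ ps + Q′ * (g * z)) n
        ≡⟨ sumTo-+ (λ i → g * weights r⟨ i ⟩ ps) (λ _ → Q′ * (g * z)) n ⟩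
      sumTo (λ i → g * weights r⟨ i ⟩ ps) n + sumTo (λ _ → Q′ * (g * z)) n
        ≡⟨ cong₂ _+_ (≡.trans (sumTo-* g (λ i → weights r⟨ i ⟩ ps) n) (cong (g *_) (sum-weights-rot ps)))
             (sumTo-const (Q′ * (g * z)) n) ⟩
      g * (weights s ps * T) + n * (Q′ * (g * z))
        ≡⟨ cong (λ x → g * (weights s ps * T) + n * (x * (g * z))) p′*T ⟨
      g * (weights s ps * T) + n * (p′ * T * (g * z))
        ≡⟨ lem₂ g (weights s ps) T n p′ z ⟩
      g * (weights s ps + p′ * (n * z)) * T ∎)
      where
      open ℕ.≤-Reasoning
      z = zeros (combination ps)
      lem₁ : ∀ a b c t → a * (b * c) * t ≡ b * (a * t * c)
      lem₁ = solve-∀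
      lem₂ : ∀ g s t n p z → g * (s * t) + n * (p * t * (g * z)) ≡ g * (s + p * (n * z)) * t
      lem₂ = solve-∀

-- Binomial expansion of p-th powers.

module PrimeBinomial (p′ : ℕ) (pr : Prime (suc p′)) where
  open Arithmetic
  open import Data.Nat.Base

  ∤-! : ∀ m → m < suc p′ → ¬ suc p′ ∣ m !
  ∤-! zero    _   = ∤-1 pr
  ∤-! (suc m) m<p = ∤-* pr (λ p∣ → ℕ.<⇒≱ m<p (∣⇒≤ p∣)) (∤-! m (ℕ.<-trans (ℕ.n<1+n m) m<p))

  p∣pCi : ∀ i → i < p′ → suc p′ ∣ (suc p′ C suc i)
  p∣pCi i i<p′ = ∣-trans (m∣m*n 1) (^∣-cancelʳ pr (∤-* pr (∤-! (suc i) (s≤s i<p′)) (∤-! j j<p)) 1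
    (subst (suc p′ * 1 ∣_) (≡.sym (subst (λ x → (x C suc i) * (suc i ! * j !) ≡ x !) i+j≡p
       (Digits.C-factorials p′ pr (suc i) j)))
     (subst (_∣ suc p′ !) (≡.sym (ℕ.*-identityʳ (suc p′))) (m∣m*n (p′ !)))))
    where
    j = p′ ∸ i
    j<p : j < suc p′
    j<p = s≤s (ℕ.m∸n≤m p′ i)
    i+j≡p : suc i + j ≡ suc p′
    i+j≡p = cong suc (ℕ.m+[n∸m]≡n (ℕ.<⇒≤ i<p′))

module Frobenius {c ℓ} (R : CommutativeRing c ℓ) (p′ : ℕ) (pr : Prime (suc p′)) where
  open CommutativeRing R hiding (zero)
  open Exp commutativeSemiring
  open Mult semiring using () renaming (_×_ to _·_; ×-congʳ to ·-congʳ;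
    ×-assocˡ to ·-assocˡ; ×-comm-* to ·-comm-*)
  open Sum semiring using (sum; sum-init-last)
  open Binomial commutativeSemiring using (theorem)
  open CMult +-commutativeMonoid using () renaming (×-distrib-+ to ·-distrib-+)
  open SetoidReasoning setoid

  private
    p = suc p′

  sum-multiple : ∀ x {n} (t : Vector Carrier n) → (∀ j → ∃ λ c → t j ≈ p · (x * c)) →
                 ∃ λ c → sum t ≈ p · (x * c)
  sum-multiple x {zero}  t h = 0# , sym (trans (·-congʳ p (zeroʳ x)) (·-zero p))
    where
    ·-zero : ∀ n → n · 0# ≈ 0#
    ·-zero zero    = refl
    ·-zero (suc n) = trans (+-identityˡ _) (·-zero n)
  sum-multiple x {suc n} t h = let c₁ , eq₁ = h zero; c₂ , eq₂ = sum-multiple x (t ∘ suc) (h ∘ suc) in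
    c₁ + c₂ , (begin
      t zero + sum (t ∘ suc)          ≈⟨ +-cong eq₁ eq₂ ⟩
      p · (x * c₁) + p · (x * c₂)     ≈⟨ ·-distrib-+ (x * c₁) (x * c₂) p ⟨
      p · (x * c₁ + x * c₂)           ≈⟨ ·-congʳ p (distribˡ x c₁ c₂) ⟨
      p · (x * (c₁ + c₂))             ∎)

  -- The middle terms are divisible by p and by x. Keeping the factor x visible places the error p ·
  -- (x * c) one step deeper than x in the filtration by powers of I.
  freshman : ∀ x y → ∃ λ c → (x + y) ^ p ≈ x ^ p + y ^ p + p · (x * c)
  freshman x y = let c , eq = sum-multiple x middle middle-multiple in c , (begin
    (x + y) ^ p                       ≈⟨ theorem p x y ⟩
    term zero + sum (tail term)       ≈⟨ +-cong first (sum-init-last (tail term)) ⟩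
    y ^ p + (sum middle + last (tail term)) ≈⟨ +-congˡ (+-cong eq final) ⟩
    y ^ p + (p · (x * c) + x ^ p)     ≈⟨ +-congˡ (+-comm _ _) ⟩
    y ^ p + (x ^ p + p · (x * c))     ≈⟨ +-assoc _ _ _ ⟨
    y ^ p + x ^ p + p · (x * c)       ≈⟨ +-congʳ (+-comm _ _) ⟩
    x ^ p + y ^ p + p · (x * c)       ∎)
    where
    term : Vector Carrier (suc p)
    term i = (p C toℕ i) · (x ^ toℕ i * y ^ (p ℕ.∸ toℕ i))
    middle : Vector Carrier p′
    middle = init (tail term)
    first : term zero ≈ y ^ p
    first = trans (+-identityʳ _) (*-identityˡ _)
    final : last (tail term) ≈ x ^ p
    final rewrite Fin.toℕ-fromℕ p′ | nCn≡1 p | ℕ.n∸n≡0 p′ =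
      trans (+-identityʳ _) (*-identityʳ _)
    middle-multiple : ∀ j → ∃ λ c → middle j ≈ p · (x * c)
    middle-multiple j = m · (x ^ i * y ^ (p′ ℕ.∸ i)) , (begin
      (p C suc i) · (x ^ suc i * y ^ (p′ ℕ.∸ i))
        ≡⟨ cong (_· (x ^ suc i * y ^ (p′ ℕ.∸ i))) (≡.trans pC≡ (ℕ.*-comm m p)) ⟩
      (p ℕ.* m) · (x ^ suc i * y ^ (p′ ℕ.∸ i))   ≈⟨ ·-assocˡ _ p m ⟨
      p · (m · (x ^ suc i * y ^ (p′ ℕ.∸ i)))     ≈⟨ ·-congʳ p (·-congʳ m (*-assoc x _ _)) ⟩
      p · (m · (x * (x ^ i * y ^ (p′ ℕ.∸ i))))   ≈⟨ ·-congʳ p (·-comm-* m x _) ⟨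
      p · (x * (m · (x ^ i * y ^ (p′ ℕ.∸ i))))   ∎)
      where
      i = toℕ (inject₁ j)
      divisible : p ∣ (p C suc i)
      divisible = PrimeBinomial.p∣pCi p′ pr i (subst (ℕ._< p′) (≡.sym (Fin.toℕ-inject₁ j)) (Fin.toℕ<n j))
      m = quotient divisible
      pC≡ : p C suc i ≡ m ℕ.* p
      pC≡ = _∣_.equality divisible

-- Powers of the kernel of a reduction to characteristic p.

module Filtration {c ℓ c′ ℓ′} (R : CommutativeRing c ℓ) (F : CommutativeRing c′ ℓ′) where
  private
    module R = CommutativeRing R
    module F = CommutativeRing F
    module FM = Mult F.semiring

  module Kernel
    (π : R.Carrier → F.Carrier)
    (π-cong : ∀ {x y} → x R.≈ y → π x F.≈ π y)
    (π-+ : ∀ x y → π (x R.+ y) F.≈ π x F.+ π y)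
    (π-* : ∀ x y → π (x R.* y) F.≈ π x F.* π y)
    (π-0 : π R.0# F.≈ F.0#)
    (π-1 : π R.1# F.≈ F.1#)
    (p′ : ℕ) (pr : Prime (suc p′))
    (p·1≈0 : suc p′ FM.× F.1# F.≈ F.0#)
    (n·1≈0⇒p∣n : ∀ n → n FM.× F.1# F.≈ F.0# → suc p′ ∣ n)
    where

    open R hiding (zero)
    open Exp commutativeSemiring
    open Mult semiring using () renaming (_×_ to _·_; ×-congʳ to ·-congʳ; ×-homo-+ to ·-homo-+; ×-congˡ to ·-congˡ;
      ×-assocˡ to ·-assocˡ; ×-comm-* to ·-comm-*; ×-assoc-* to ·-assoc-*; ×1-homo-* to ·1-homo-*)
    open CMult +-commutativeMonoid using () renaming (×-distrib-+ to ·-distrib-+)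
    open RingProperties ring using (-1*x≈-x)
    open GroupProperties +-group using () renaming (∙-cancelˡ to +-cancelˡ)
    open Sum semiring using (sum)
    open SetoidReasoning setoid

    private
      p = suc p′

    -- I v is the v-th power of the kernel of π.
    data I : ℕ → Carrier → Set (c ⊔ ℓ ⊔ ℓ′) where
      all  : ∀ {x} → I 0 x
      prod : ∀ {v x y} → π x F.≈ F.0# → I v y → I (suc v) (x * y)
      add  : ∀ {v x y} → I v x → I v y → I v (x + y)
      resp : ∀ {v x y} → x ≈ y → I v x → I v y

    I-0 : ∀ v → I v 0#
    I-0 zero    = all
    I-0 (suc v) = resp (zeroˡ 0#) (prod π-0 (I-0 v))

    I-*ˡ : ∀ {v y} x → I v y → I v (x * y)
    I-*ˡ x all        = all
    I-*ˡ x (prod {x = z} {y} πz i) = resp (begin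
      z * (x * y)  ≈⟨ *-assoc z x y ⟨
      z * x * y    ≈⟨ *-congʳ (*-comm z x) ⟩
      x * z * y    ≈⟨ *-assoc x z y ⟩
      x * (z * y)  ∎) (prod πz (I-*ˡ x i))
    I-*ˡ x (add i j)  = resp (sym (distribˡ x _ _)) (add (I-*ˡ x i) (I-*ˡ x j))
    I-*ˡ x (resp e i) = resp (*-congˡ e) (I-*ˡ x i)

    I-*ʳ : ∀ {v x} y → I v x → I v (x * y)
    I-*ʳ y i = resp (*-comm y _) (I-*ˡ y i)

    I-neg : ∀ {v x} → I v x → I v (- x)
    I-neg {x = x} i = resp (-1*x≈-x x) (I-*ˡ (- 1#) i)

    I-pred : ∀ {v x} → I (suc v) x → I v x
    I-pred (prod {x = x} _ i) = I-*ˡ x i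
    I-pred (add i j)  = add (I-pred i) (I-pred j)
    I-pred (resp e i) = resp e (I-pred i)

    I-mono : ∀ {v w x} → w ℕ.≤ v → I v x → I w x
    I-mono {v} {zero}      _ _ = all
    I-mono {suc v} {suc w} h i with w ℕ.≟ v
    ... | yes ≡.refl = i
    ... | no  w≢v    = I-mono (ℕ.≤∧≢⇒< (ℕ.≤-pred h) w≢v) (I-pred i)

    I-prod : ∀ {v w x y} → I v x → I w y → I (v ℕ.+ w) (x * y)
    I-prod {x = x} all j = I-*ˡ x j
    I-prod (prod {x = x} {y} πx i) j = resp (sym (*-assoc x y _)) (prod πx (I-prod i j))
    I-prod (add i i′)  j = resp (sym (distribʳ _ _ _)) (add (I-prod i j) (I-prod i′ j))
    I-prod (resp e i)  j = resp (*-congʳ e) (I-prod i j)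

    I-^ : ∀ {x} → I 1 x → ∀ v → I v (x ^ v)
    I-^ i zero    = all
    I-^ i (suc v) = I-prod i (I-^ i v)

    I-· : ∀ {v x} n → I v x → I v (n · x)
    I-· {v} zero    i = I-0 v
    I-· (suc n) i = add i (I-· n i)

    I-sum : ∀ {v n} (t : Vector Carrier n) → (∀ j → I v (t j)) → I v (sum t)
    I-sum {v} {zero}  t h = I-0 v
    I-sum {v} {suc n} t h = add (h zero) (I-sum (t ∘ suc) (h ∘ suc))

    ker⇒I : ∀ {x} → π x F.≈ F.0# → I 1 x
    ker⇒I πx = resp (*-identityʳ _) (prod {y = 1#} πx all)

    I⇒ker : ∀ {v x} → I (suc v) x → π x F.≈ F.0#
    I⇒ker (prod {x = x} {y} πx _) = F.trans (π-* x y) (F.trans (F.*-congʳ πx) (F.zeroˡ _))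
    I⇒ker (add {x = x} {y} i j)   = F.trans (π-+ x y) (F.trans (F.+-cong (I⇒ker i) (I⇒ker j)) (F.+-identityˡ _))
    I⇒ker (resp e i)              = F.trans (π-cong (sym e)) (I⇒ker i)

    π-· : ∀ n x → π (n · x) F.≈ n FM.× π x
    π-· zero    x = π-0
    π-· (suc n) x = F.trans (π-+ x (n · x)) (F.+-congˡ (π-· n x))

    p∈I : I 1 (p · 1#)
    p∈I = ker⇒I (F.trans (π-· p 1#) (F.trans (FM.×-congʳ p π-1) p·1≈0))

    I-p· : ∀ {v x} → I v x → I (suc v) (p · x)
    I-p· {x = x} i = resp (trans (·-assoc-* p 1# x) (·-congʳ p (*-identityˡ x))) (I-prod p∈I i)

    I-p^· : ∀ {v x} t → I v x → I (t ℕ.+ v) ((p ℕ.^ t) · x)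
    I-p^· {x = x} zero    i = resp (sym (+-identityʳ x)) i
    I-p^· {x = x} (suc t) i = resp (·-assocˡ x p (p ℕ.^ t)) (I-p· (I-p^· t i))

    I-∣· : ∀ {v x t n} → p ℕ.^ t ∣ n → I v x → I (t ℕ.+ v) (n · x)
    I-∣· {x = x} {t} (divides m eq) i = resp
      (trans (·-assocˡ x m (p ℕ.^ t)) (·-congˡ {x} (≡.sym eq))) (I-· m (I-p^· t i))

    2≤p : 2 ℕ.≤ p
    2≤p = ℕ.nonTrivial⇒n>1 p {{prime⇒nonTrivial pr}}

    -- a ^ p lies deeper than a because p ≥ 2, and the mixed terms do because they contain a
    -- together with p, which itself lies in I.
    1+I-^p : ∀ {v a} → I (suc v) a → ∃ λ b → (a + 1#) ^ p ≈ b + 1# × I (suc (suc v)) b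
    1+I-^p {v} {a} i = let c , eq = Frobenius.freshman R p′ pr a 1# in
      a ^ p + p · (a * c)
      , (begin
          (a + 1#) ^ p                      ≈⟨ eq ⟩
          a ^ p + 1# ^ p + p · (a * c)      ≈⟨ +-congʳ (+-congˡ (1^n p)) ⟩
          a ^ p + 1# + p · (a * c)          ≈⟨ +-assoc _ _ _ ⟩
          a ^ p + (1# + p · (a * c))        ≈⟨ +-congˡ (+-comm _ _) ⟩
          a ^ p + (p · (a * c) + 1#)        ≈⟨ +-assoc _ _ _ ⟨
          a ^ p + p · (a * c) + 1#          ∎)
      , add (a^ p 2≤p) (I-p· (I-*ʳ c i))
      where
      1^n : ∀ n → 1# ^ n ≈ 1#
      1^n zero    = refl
      1^n (suc n) = trans (*-identityˡ _) (1^n n)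
      a^ : ∀ m → 2 ℕ.≤ m → I (suc (suc v)) (a ^ m)
      a^ (suc zero) (s≤s ())
      a^ (suc (suc m)) _ = I-mono (s≤s (ℕ.≤-trans (ℕ.≤-reflexive (ℕ.+-comm 1 v)) (ℕ.+-monoʳ-≤ v (s≤s z≤n))))
        (I-prod i (I-*ʳ (a ^ m) i))

    1+I-^p^ : ∀ {x} → π x F.≈ F.1# → ∀ v → ∃ λ b → x ^ (p ℕ.^ v) ≈ b + 1# × I (suc v) b
    1+I-^p^ {x} πx zero    = x - 1# , trans (*-identityʳ x) (sym (trans (+-assoc x (- 1#) 1#)
        (trans (+-congˡ (-‿inverseˡ 1#)) (+-identityʳ x))))
      , ker⇒I (F.trans (π-+ x (- 1#)) (F.trans (F.+-congʳ (F.trans πx (F.sym π-1)))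
          (F.trans (F.sym (π-+ 1# (- 1#))) (F.trans (π-cong (-‿inverseʳ 1#)) π-0))))
    1+I-^p^ {x} πx (suc v) = let b , eq , i = 1+I-^p^ πx v; b′ , eq′ , i′ = 1+I-^p i in b′ , (begin
        x ^ (p ℕ.* p ℕ.^ v)    ≡⟨ cong (x ^_) (ℕ.*-comm p (p ℕ.^ v)) ⟩
        x ^ (p ℕ.^ v ℕ.* p)    ≈⟨ ^-assocʳ x (p ℕ.^ v) p ⟨
        (x ^ (p ℕ.^ v)) ^ p    ≈⟨ ^-congˡ p eq ⟩
        (b + 1#) ^ p           ≈⟨ eq′ ⟩
        b′ + 1#                ∎) , i′

    -- For a torsion-free ring with a lift φ of the Frobenius, the operator
    -- x ↦ (φ x - x ^ p) / p lowers the filtration by one.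
    module Delta
      (φ : Carrier → Carrier)
      (φ-cong : ∀ {x y} → x ≈ y → φ x ≈ φ y)
      (φ-+ : ∀ x y → φ (x + y) ≈ φ x + φ y)
      (φ-* : ∀ x y → φ (x * y) ≈ φ x * φ y)
      (φ-0 : φ 0# ≈ 0#)
      (φ-1 : φ 1# ≈ 1#)
      (δ : ∀ x → ∃ λ d → φ x ≈ x ^ p + p · d)
      (torsion-free : ∀ x y → p · x ≈ p · y → x ≈ y)
      where

      -- Torsion-freeness makes (φ x - x ^ p) / p well defined, so the value found along a
      -- derivation of membership in I can be compared with one computed directly.
      δ-unique : ∀ {x d d′} → φ x ≈ x ^ p + p · d → φ x ≈ x ^ p + p · d′ → d ≈ d′
      δ-unique {x} {d} {d′} eq eq′ = torsion-free d d′ (+-cancelˡ (x ^ p) _ _ (trans (sym eq) eq′))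

      φ-ker : ∀ x → π x F.≈ F.0# → π (φ x) F.≈ F.0#
      φ-ker x πx = let d , eq = δ x in F.trans (π-cong eq) (F.trans (π-+ (x ^ p) (p · d))
        (F.trans (F.+-cong (F.trans (π-* x (x ^ p′)) (F.trans (F.*-congʳ πx) (F.zeroˡ _))) (I⇒ker (I-p· {v = 0} {x = d} all)))
          (F.+-identityˡ _)))

      δ-* : ∀ {x y d d′} → φ x ≈ x ^ p + p · d → φ y ≈ y ^ p + p · d′ →
            φ (x * y) ≈ (x * y) ^ p + p · (φ x * d′ + d * y ^ p)
      δ-* {x} {y} {d} {d′} eq eq′ = begin
        φ (x * y)                                       ≈⟨ φ-* x y ⟩
        φ x * φ y                                       ≈⟨ *-congˡ eq′ ⟩
        φ x * (y ^ p + p · d′)                          ≈⟨ distribˡ _ _ _ ⟩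
        φ x * y ^ p + φ x * (p · d′)                    ≈⟨ +-cong (*-congʳ eq) (·-comm-* p (φ x) d′) ⟩
        (x ^ p + p · d) * y ^ p + p · (φ x * d′)        ≈⟨ +-congʳ (distribʳ _ _ _) ⟩
        x ^ p * y ^ p + p · d * y ^ p + p · (φ x * d′)  ≈⟨ +-assoc _ _ _ ⟩
        x ^ p * y ^ p + (p · d * y ^ p + p · (φ x * d′))
          ≈⟨ +-cong (sym (^-distrib-* x y p)) (trans (+-comm _ _) (+-congˡ (·-assoc-* p d (y ^ p)))) ⟩
        (x * y) ^ p + (p · (φ x * d′) + p · (d * y ^ p)) ≈⟨ +-congˡ (·-distrib-+ _ _ p) ⟨
        (x * y) ^ p + p · (φ x * d′ + d * y ^ p)        ∎

      δ-+ : ∀ {x y d d′} → φ x ≈ x ^ p + p · d → φ y ≈ y ^ p + p · d′ →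
            ∃ λ c → φ (x + y) ≈ (x + y) ^ p + p · (d + d′ + x * c)
      δ-+ {x} {y} {d} {d′} eq eq′ = let c , fr = Frobenius.freshman R p′ pr x y in - c , (begin
        φ (x + y)                                  ≈⟨ φ-+ x y ⟩
        φ x + φ y                                  ≈⟨ +-cong eq eq′ ⟩
        x ^ p + p · d + (y ^ p + p · d′)           ≈⟨ interchange _ _ _ _ ⟩
        x ^ p + y ^ p + (p · d + p · d′)           ≈⟨ +-congˡ (·-distrib-+ d d′ p) ⟨
        x ^ p + y ^ p + p · (d + d′)               ≈⟨ +-congˡ (·-congʳ p (trans (sym (+-identityʳ _)) (+-congˡ
              (sym (trans (sym (distribˡ x c (- c))) (trans (*-congˡ (-‿inverseʳ c)) (zeroʳ x))))))) ⟩
        x ^ p + y ^ p + p · (d + d′ + (x * c + x * - c))  ≈⟨ +-congˡ (·-congʳ p (rearrange _ _ _)) ⟩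
        x ^ p + y ^ p + p · (x * c + (d + d′ + x * - c))  ≈⟨ +-congˡ (·-distrib-+ _ _ p) ⟩
        x ^ p + y ^ p + (p · (x * c) + p · (d + d′ + x * - c)) ≈⟨ +-assoc _ _ _ ⟨
        x ^ p + y ^ p + p · (x * c) + p · (d + d′ + x * - c)   ≈⟨ +-congʳ fr ⟨
        (x + y) ^ p + p · (d + d′ + x * - c)       ∎)
        where
        rearrange : ∀ a b c → a + (b + c) ≈ b + (a + c)
        rearrange a b c = trans (sym (+-assoc a b c)) (trans (+-congʳ (+-comm a b)) (+-assoc b a c))
        interchange : ∀ a b c d → a + b + (c + d) ≈ a + c + (b + d)
        interchange a b c d = trans (+-assoc a b (c + d)) (trans (+-congˡ (rearrange b c d)) (sym (+-assoc a c (b + d))))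

      -- On a product with x in the kernel the value is φ x * d′ + d * y ^ p: the first summand
      -- regains a step because φ x is again in the kernel, the second because y ^ p is as deep as
      -- y. On a sum the correction x * c of `freshman` is as deep as x.
      I-δ : ∀ {v x} → I (suc v) x → ∃ λ d → φ x ≈ x ^ p + p · d × I v d
      I-δ {zero}  {x} i = let d , eq = δ x in d , eq , all
      I-δ {suc v} (prod {x = x} {y} πx i) = let d , eq = δ x; d′ , eq′ , i′ = I-δ i in
        φ x * d′ + d * y ^ p , δ-* eq eq′
        , add (I-prod (ker⇒I (φ-ker x πx)) i′) (I-*ˡ d (I-*ʳ (y ^ p′) i))
      I-δ {suc v} (add {x = x} {y} i j) = let d , eq , i′ = I-δ i; d′ , eq′ , j′ = I-δ j; c , eq″ = δ-+ eq eq′ in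
        d + d′ + x * c , eq″ , add (add i′ j′) (I-*ʳ c (I-pred i))
      I-δ {suc v} (resp e i) = let d , eq , i′ = I-δ i in
        d , trans (φ-cong (sym e)) (trans eq (+-congʳ (^-congˡ p e))) , i′

      φ-·1 : ∀ n → φ (n · 1#) ≈ n · 1#
      φ-·1 zero    = φ-0
      φ-·1 (suc n) = trans (φ-+ 1# (n · 1#)) (+-cong φ-1 (φ-·1 n))

      ·1-^ : ∀ n k → (n · 1#) ^ k ≈ (n ℕ.^ k) · 1#
      ·1-^ n zero    = sym (+-identityʳ 1#)
      ·1-^ n (suc k) = trans (*-congˡ (·1-^ n k)) (sym (·1-homo-* n (n ℕ.^ k)))

      -- φ fixes integers, so for N = p N′ the operator takes the value (N - N ^ p) / p = - N′ (N ^
      -- (p - 1) - 1), which is one step less deep. As p divides N, the factor N ^ (p - 1) - 1 is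
      -- prime to p, and by induction p ^ v divides N′.
      integer∈I : ∀ v n → I v (n · 1#) → p ℕ.^ v ∣ n
      integer∈I zero    n       i = 1∣ n
      integer∈I (suc v) zero    i = (p ℕ.^ suc v) ∣0
      integer∈I (suc v) N@(suc _) i = subst (p ℕ.^ suc v ∣_) (ℕ.*-comm p N′ ∙ ≡.sym N≡) (*-monoʳ-∣ p
        (Arithmetic.^∣-cancelʳ pr p∤ v (integer∈I v (N′ ℕ.* (N ℕ.^ p′ ℕ.∸ 1)) I-N′)))
        where
        infixr 9 _∙_
        _∙_ = ≡.trans
        p∣N : p ∣ N
        p∣N = n·1≈0⇒p∣n N (F.trans (F.sym (F.trans (π-· N 1#) (FM.×-congʳ N π-1))) (I⇒ker i))
        N′ = quotient p∣N
        N≡ : N ≡ N′ ℕ.* p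
        N≡ = _∣_.equality p∣N
        M = N ℕ.^ p′ ℕ.∸ 1
        1+M : suc M ≡ N ℕ.^ p′
        1+M = ℕ.suc-pred (N ℕ.^ p′) {{ℕ.m^n≢0 N p′}}
        p∤ : ¬ p ∣ M
        p∤ p∣M = Arithmetic.∤-1 pr (∣m+n∣m⇒∣n (subst (p ∣_) (≡.sym (ℕ.+-comm M 1 ∙ 1+M)) p∣N^p′) p∣M)
          where
          p∣N^ : ∀ k → 1 ℕ.≤ k → p ∣ N ℕ.^ k
          p∣N^ (suc k) _ = ∣-trans p∣N (m∣m*n (N ℕ.^ k))
          p∣N^p′ = p∣N^ p′ (ℕ.≤-pred 2≤p)
        N^p≡ : N ℕ.^ p ≡ p ℕ.* (N′ ℕ.* suc M)
        N^p≡ = cong (ℕ._* N ℕ.^ p′) (N≡ ∙ ℕ.*-comm N′ p) ∙ ℕ.*-assoc p N′ (N ℕ.^ p′) ∙ cong (λ x → p ℕ.* (N′ ℕ.* x)) (≡.sym 1+M)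
        eq : φ (N · 1#) ≈ (N · 1#) ^ p + p · (- ((N′ ℕ.* M) · 1#))
        eq = begin
          φ (N · 1#)        ≈⟨ φ-·1 N ⟩
          N · 1#            ≡⟨ cong (_· 1#) (N≡ ∙ ℕ.*-comm N′ p) ⟩
          (p ℕ.* N′) · 1#   ≈⟨ ·-assocˡ 1# p N′ ⟨
          p · (N′ · 1#)     ≈⟨ ·-congʳ p (sym (trans (+-congʳ
                (trans (·-congˡ {1#} (ℕ.*-suc N′ M)) (·-homo-+ 1# N′ (N′ ℕ.* M))))
                (trans (+-assoc _ _ _) (trans (+-congˡ (-‿inverseʳ _)) (+-identityʳ _))))) ⟩
          p · ((N′ ℕ.* suc M) · 1# + - ((N′ ℕ.* M) · 1#)) ≈⟨ ·-distrib-+ _ _ p ⟩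
          p · ((N′ ℕ.* suc M) · 1#) + p · (- ((N′ ℕ.* M) · 1#))
            ≈⟨ +-congʳ (trans (·-assocˡ 1# p (N′ ℕ.* suc M)) (trans (·-congˡ {1#} (≡.sym N^p≡)) (sym (·1-^ N p)))) ⟩
          (N · 1#) ^ p + p · (- ((N′ ℕ.* M) · 1#)) ∎
        I-N′ : I v ((N′ ℕ.* M) · 1#)
        I-N′ = let d , eq′ , j = I-δ i in
          resp (trans (-‿cong (δ-unique eq′ eq)) (GroupProperties.⁻¹-involutive +-group _)) (I-neg j)

-- Integer multiples in abelian groups, and the monoid ring.

module Action {c ℓ} (G : AbelianGroup c ℓ) where
  open import Data.Integer.Base using (+_; -[1+_])
  open AbelianGroup G renaming (_∙_ to _+_; ε to 0#; _⁻¹ to -_; ∙-cong to +-cong; ∙-congˡ to +-congˡ;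
    ∙-congʳ to +-congʳ; assoc to +-assoc; comm to +-comm; identityˡ to +-identityˡ; identityʳ to +-identityʳ)
  open CMult commutativeMonoid using () renaming (_×_ to _·_; ×-homo-+ to ·-homo-+)
  open AbelianGroupProperties G
  open CMSum commutativeMonoid using (sum)
  open SetoidReasoning setoid

  infixr 8 _•_
  _•_ : ℤ → Carrier → Carrier
  (+ n)     • g = n · g
  -[1+ n ]  • g = - (suc n · g)

  ⊖-• : ∀ m n g → (m ℤ.⊖ n) • g ≈ m · g + - (n · g)
  ⊖-• m       zero    g = trans (sym (+-identityʳ _)) (+-congˡ (sym ε⁻¹≈ε))
  ⊖-• zero    (suc n) g = sym (+-identityˡ _)
  ⊖-• (suc m) (suc n) g = begin
    (suc m ℤ.⊖ suc n) • g                 ≡⟨ cong (_• g) (ℤ.[1+m]⊖[1+n]≡m⊖n m n) ⟩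
    (m ℤ.⊖ n) • g                         ≈⟨ ⊖-• m n g ⟩
    m · g + - (n · g)                     ≈⟨ +-congʳ (+-identityʳ _) ⟨
    m · g + 0# + - (n · g)                ≈⟨ +-congʳ (+-congˡ (inverseʳ g)) ⟨
    m · g + (g + - g) + - (n · g)         ≈⟨ +-congʳ (+-assoc _ _ _) ⟨
    m · g + g + - g + - (n · g)           ≈⟨ +-assoc _ _ _ ⟩
    m · g + g + (- g + - (n · g))         ≈⟨ +-cong (+-comm _ _) (⁻¹-∙-comm g (n · g)) ⟩
    g + m · g + - (g + n · g)             ∎

  +-• : ∀ i j g → (i ℤ.+ j) • g ≈ i • g + j • g
  +-• (+ m)    (+ n)    g = ·-homo-+ g m n
  +-• (+ m)    -[1+ n ] g = ⊖-• m (suc n) g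
  +-• -[1+ m ] (+ n)    g = trans (⊖-• n (suc m) g) (+-comm _ _)
  +-• -[1+ m ] -[1+ n ] g = begin
    - (suc (suc (m ℕ.+ n)) · g)       ≡⟨ cong (λ x → - (suc x · g)) (ℕ.+-suc m n) ⟨
    - ((suc m ℕ.+ suc n) · g)         ≈⟨ ⁻¹-cong (·-homo-+ g (suc m) (suc n)) ⟩
    - (suc m · g + suc n · g)         ≈⟨ ⁻¹-∙-comm _ _ ⟨
    - (suc m · g) + - (suc n · g)     ∎

  -‿• : ∀ i g → (ℤ.- i) • g ≈ - (i • g)
  -‿• (+ zero)  g = sym ε⁻¹≈ε
  -‿• (+ suc n) g = refl
  -‿• -[1+ n ]  g = sym (⁻¹-involutive _)

  sum-zero : ∀ {n} (h : Fin n → Carrier) → (∀ c → h c ≈ 0#) → sum h ≈ 0#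
  sum-zero {zero}  h h≈0 = refl
  sum-zero {suc n} h h≈0 = trans (+-cong (h≈0 zero) (sum-zero (h ∘ suc) (h≈0 ∘ suc))) (+-identityˡ _)

  sum-single : ∀ {n} (a : Fin n) (h : Fin n → Carrier) → (∀ c → c ≢ a → h c ≈ 0#) → sum h ≈ h a
  sum-single zero    h h≈0 = trans (+-congˡ (sum-zero (h ∘ suc) λ c → h≈0 (suc c) λ ())) (+-identityʳ _)
  sum-single (suc a) h h≈0 = trans (+-cong (h≈0 zero λ ()) (sum-single a (h ∘ suc) λ c c≢a →
    h≈0 (suc c) (c≢a ∘ Fin.suc-injective))) (+-identityˡ _)

  sum-neg : ∀ {n} (h : Fin n → Carrier) → sum (λ c → - h c) ≈ - sum h
  sum-neg {zero}  h = sym ε⁻¹≈ε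
  sum-neg {suc n} h = trans (+-congˡ (sum-neg (h ∘ suc))) (⁻¹-∙-comm _ _)

-- The monoid ring ℤ[A] of a commutative monoid A on Fin n.  An element is
-- identified with the additive functional ψ ↦ ⟨ x , ψ ⟩ that it defines on the
-- functions A → ℤ; this makes the ring laws instances of Fubini.
module MonoidRing {n} (_∙_ : Fin n → Fin n → Fin n) (ε : Fin n)
  (assoc : ∀ a b c → (a ∙ b) ∙ c ≡ a ∙ (b ∙ c)) (comm : ∀ a b → a ∙ b ≡ b ∙ a)
  (identityˡ : ∀ a → ε ∙ a ≡ a)
  where

  open import Data.Integer.Base using (+_)

  A : Set
  A = Fin n

  infixl 6 _⊕_
  infixl 7 _⊗_
  infix  8 ⊖_
  data Formal : Set where
    [_]  : A → Formal
    𝟘    : Formal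
    _⊕_  : Formal → Formal → Formal
    ⊖_   : Formal → Formal

  ⟨_,_⟩ : Formal → (A → ℤ) → ℤ
  ⟨ [ a ] , ψ ⟩ = ψ a
  ⟨ 𝟘     , ψ ⟩ = + 0
  ⟨ x ⊕ y , ψ ⟩ = ⟨ x , ψ ⟩ ℤ.+ ⟨ y , ψ ⟩
  ⟨ ⊖ x   , ψ ⟩ = ℤ.- ⟨ x , ψ ⟩

  infix 4 _≋_
  record _≋_ (x y : Formal) : Set where
    constructor mk
    field at : ∀ ψ → ⟨ x , ψ ⟩ ≡ ⟨ y , ψ ⟩
  open _≋_

  -- Linear extension of a map from A to formal sums; the product and the Frobenius lift are both
  -- obtained from it.
  bind : Formal → (A → Formal) → Formal
  bind [ a ]   f = f a
  bind 𝟘       f = 𝟘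
  bind (x ⊕ y) f = bind x f ⊕ bind y f
  bind (⊖ x)   f = ⊖ bind x f

  _⊗_ : Formal → Formal → Formal
  x ⊗ y = bind x λ a → bind y λ b → [ a ∙ b ]

  𝟙 : Formal
  𝟙 = [ ε ]

  ⟨⟩-cong : ∀ x {ψ χ} → (∀ a → ψ a ≡ χ a) → ⟨ x , ψ ⟩ ≡ ⟨ x , χ ⟩
  ⟨⟩-cong [ a ]   h = h a
  ⟨⟩-cong 𝟘       h = ≡.refl
  ⟨⟩-cong (x ⊕ y) h = cong₂ ℤ._+_ (⟨⟩-cong x h) (⟨⟩-cong y h)
  ⟨⟩-cong (⊖ x)   h = cong ℤ.-_ (⟨⟩-cong x h)

  ⟨bind⟩ : ∀ x f ψ → ⟨ bind x f , ψ ⟩ ≡ ⟨ x , (λ a → ⟨ f a , ψ ⟩) ⟩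
  ⟨bind⟩ [ a ]   f ψ = ≡.refl
  ⟨bind⟩ 𝟘       f ψ = ≡.refl
  ⟨bind⟩ (x ⊕ y) f ψ = cong₂ ℤ._+_ (⟨bind⟩ x f ψ) (⟨bind⟩ y f ψ)
  ⟨bind⟩ (⊖ x)   f ψ = cong ℤ.-_ (⟨bind⟩ x f ψ)

  ⟨⊗⟩ : ∀ x y ψ → ⟨ x ⊗ y , ψ ⟩ ≡ ⟨ x , (λ a → ⟨ y , (λ b → ψ (a ∙ b)) ⟩) ⟩
  ⟨⊗⟩ x y ψ = ≡.trans (⟨bind⟩ x (λ a → bind y λ b → [ a ∙ b ]) ψ)
    (⟨⟩-cong x λ a → ⟨bind⟩ y (λ b → [ a ∙ b ]) ψ)

  ⟨⟩-0 : ∀ x → ⟨ x , (λ _ → + 0) ⟩ ≡ + 0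
  ⟨⟩-0 [ a ]   = ≡.refl
  ⟨⟩-0 𝟘       = ≡.refl
  ⟨⟩-0 (x ⊕ y) = cong₂ ℤ._+_ (⟨⟩-0 x) (⟨⟩-0 y)
  ⟨⟩-0 (⊖ x)   = cong ℤ.-_ (⟨⟩-0 x)

  interchange : ∀ a b c d → (a ℤ.+ b) ℤ.+ (c ℤ.+ d) ≡ (a ℤ.+ c) ℤ.+ (b ℤ.+ d)
  interchange a b c d = ≡.trans (ℤ.+-assoc a b (c ℤ.+ d)) (≡.trans (cong (λ z → a ℤ.+ z)
    (≡.trans (≡.sym (ℤ.+-assoc b c d)) (≡.trans (cong (ℤ._+ d) (ℤ.+-comm b c)) (ℤ.+-assoc c b d))))
    (≡.sym (ℤ.+-assoc a c (b ℤ.+ d))))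

  ⟨⟩-+ : ∀ x ψ χ → ⟨ x , (λ a → ψ a ℤ.+ χ a) ⟩ ≡ ⟨ x , ψ ⟩ ℤ.+ ⟨ x , χ ⟩
  ⟨⟩-+ [ a ]   ψ χ = ≡.refl
  ⟨⟩-+ 𝟘       ψ χ = ≡.refl
  ⟨⟩-+ (x ⊕ y) ψ χ = ≡.trans (cong₂ ℤ._+_ (⟨⟩-+ x ψ χ) (⟨⟩-+ y ψ χ))
    (interchange ⟨ x , ψ ⟩ ⟨ x , χ ⟩ ⟨ y , ψ ⟩ ⟨ y , χ ⟩)
  ⟨⟩-+ (⊖ x)   ψ χ = ≡.trans (cong ℤ.-_ (⟨⟩-+ x ψ χ)) (ℤ.neg-distrib-+ ⟨ x , ψ ⟩ ⟨ x , χ ⟩)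

  ⟨⟩-neg : ∀ x ψ → ⟨ x , (λ a → ℤ.- ψ a) ⟩ ≡ ℤ.- ⟨ x , ψ ⟩
  ⟨⟩-neg [ a ]   ψ = ≡.refl
  ⟨⟩-neg 𝟘       ψ = ≡.refl
  ⟨⟩-neg (x ⊕ y) ψ = ≡.trans (cong₂ ℤ._+_ (⟨⟩-neg x ψ) (⟨⟩-neg y ψ)) (≡.sym (ℤ.neg-distrib-+ ⟨ x , ψ ⟩ ⟨ y , ψ ⟩))
  ⟨⟩-neg (⊖ x)   ψ = cong ℤ.-_ (⟨⟩-neg x ψ)

  fubini : ∀ x y (θ : A → A → ℤ) → ⟨ x , (λ a → ⟨ y , θ a ⟩) ⟩ ≡ ⟨ y , (λ b → ⟨ x , (λ a → θ a b) ⟩) ⟩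
  fubini [ a ]    y θ = ≡.refl
  fubini 𝟘        y θ = ≡.sym (⟨⟩-0 y)
  fubini (x ⊕ x′) y θ = ≡.trans (cong₂ ℤ._+_ (fubini x y θ) (fubini x′ y θ))
    (≡.sym (⟨⟩-+ y (λ b → ⟨ x , (λ a → θ a b) ⟩) (λ b → ⟨ x′ , (λ a → θ a b) ⟩)))
  fubini (⊖ x)    y θ = ≡.trans (cong ℤ.-_ (fubini x y θ)) (≡.sym (⟨⟩-neg y (λ b → ⟨ x , (λ a → θ a b) ⟩)))

  ⊗-cong : ∀ {x x′ y y′} → x ≋ x′ → y ≋ y′ → x ⊗ y ≋ x′ ⊗ y′
  ⊗-cong {x} {x′} {y} {y′} e e′ .at ψ = begin
    ⟨ x ⊗ y , ψ ⟩                              ≡⟨ ⟨⊗⟩ x y ψ ⟩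
    ⟨ x , (λ a → ⟨ y , (λ b → ψ (a ∙ b)) ⟩) ⟩   ≡⟨ at e (λ a → ⟨ y , (λ b → ψ (a ∙ b)) ⟩) ⟩
    ⟨ x′ , (λ a → ⟨ y , (λ b → ψ (a ∙ b)) ⟩) ⟩  ≡⟨ ⟨⟩-cong x′ (λ a → at e′ (λ b → ψ (a ∙ b))) ⟩
    ⟨ x′ , (λ a → ⟨ y′ , (λ b → ψ (a ∙ b)) ⟩) ⟩ ≡⟨ ⟨⊗⟩ x′ y′ ψ ⟨
    ⟨ x′ ⊗ y′ , ψ ⟩                            ∎
    where open ≡.≡-Reasoning

  ⊗-comm : ∀ x y → x ⊗ y ≋ y ⊗ x
  ⊗-comm x y .at ψ = begin
    ⟨ x ⊗ y , ψ ⟩                              ≡⟨ ⟨⊗⟩ x y ψ ⟩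
    ⟨ x , (λ a → ⟨ y , (λ b → ψ (a ∙ b)) ⟩) ⟩   ≡⟨ fubini x y (λ a b → ψ (a ∙ b)) ⟩
    ⟨ y , (λ b → ⟨ x , (λ a → ψ (a ∙ b)) ⟩) ⟩   ≡⟨ ⟨⟩-cong y (λ b → ⟨⟩-cong x λ a → cong ψ (comm a b)) ⟩
    ⟨ y , (λ b → ⟨ x , (λ a → ψ (b ∙ a)) ⟩) ⟩   ≡⟨ ⟨⊗⟩ y x ψ ⟨
    ⟨ y ⊗ x , ψ ⟩                              ∎
    where open ≡.≡-Reasoning

  ⊗-assoc : ∀ x y z → (x ⊗ y) ⊗ z ≋ x ⊗ (y ⊗ z)
  ⊗-assoc x y z .at ψ = begin
    ⟨ (x ⊗ y) ⊗ z , ψ ⟩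
      ≡⟨ ⟨⊗⟩ (x ⊗ y) z ψ ⟩
    ⟨ x ⊗ y , (λ d → ⟨ z , (λ c → ψ (d ∙ c)) ⟩) ⟩
      ≡⟨ ⟨⊗⟩ x y (λ d → ⟨ z , (λ c → ψ (d ∙ c)) ⟩) ⟩
    ⟨ x , (λ a → ⟨ y , (λ b → ⟨ z , (λ c → ψ ((a ∙ b) ∙ c)) ⟩) ⟩) ⟩
      ≡⟨ ⟨⟩-cong x (λ a → ⟨⟩-cong y λ b → ⟨⟩-cong z λ c → cong ψ (assoc a b c)) ⟩
    ⟨ x , (λ a → ⟨ y , (λ b → ⟨ z , (λ c → ψ (a ∙ (b ∙ c))) ⟩) ⟩) ⟩
      ≡⟨ ⟨⟩-cong x (λ a → ⟨⊗⟩ y z (λ d → ψ (a ∙ d))) ⟨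
    ⟨ x , (λ a → ⟨ y ⊗ z , (λ d → ψ (a ∙ d)) ⟩) ⟩
      ≡⟨ ⟨⊗⟩ x (y ⊗ z) ψ ⟨
    ⟨ x ⊗ (y ⊗ z) , ψ ⟩ ∎
    where open ≡.≡-Reasoning

  ⊗-identityˡ : ∀ x → 𝟙 ⊗ x ≋ x
  ⊗-identityˡ x .at ψ = ≡.trans (⟨⊗⟩ 𝟙 x ψ) (⟨⟩-cong x λ a → cong ψ (identityˡ a))

  ⊗-distribˡ : ∀ x y z → x ⊗ (y ⊕ z) ≋ x ⊗ y ⊕ x ⊗ z
  ⊗-distribˡ x y z .at ψ = ≡.trans (⟨⊗⟩ x (y ⊕ z) ψ)
    (≡.trans (⟨⟩-+ x (λ a → ⟨ y , (λ b → ψ (a ∙ b)) ⟩) (λ a → ⟨ z , (λ b → ψ (a ∙ b)) ⟩))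
    (≡.sym (cong₂ ℤ._+_ (⟨⊗⟩ x y ψ) (⟨⊗⟩ x z ψ))))

  ring : CommutativeRing 0ℓ 0ℓ
  ring = record
    { Carrier = Formal ; _≈_ = _≋_ ; _+_ = _⊕_ ; _*_ = _⊗_ ; -_ = ⊖_ ; 0# = 𝟘 ; 1# = 𝟙
    ; isCommutativeRing = record
      { isRing = record
        { +-isAbelianGroup = record
          { isGroup = record
            { isMonoid = record
              { isSemigroup = record
                { isMagma = record
                  { isEquivalence = record
                    { refl = mk λ _ → ≡.refl
                    ; sym = λ e → mk λ ψ → ≡.sym (at e ψ)
                    ; trans = λ e e′ → mk λ ψ → ≡.trans (at e ψ) (at e′ ψ) }
                  ; ∙-cong = λ e e′ → mk λ ψ → cong₂ ℤ._+_ (at e ψ) (at e′ ψ) }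
                ; assoc = λ x y z → mk λ ψ → ℤ.+-assoc ⟨ x , ψ ⟩ ⟨ y , ψ ⟩ ⟨ z , ψ ⟩ }
              ; identity = (λ x → mk λ ψ → ℤ.+-identityˡ ⟨ x , ψ ⟩) , (λ x → mk λ ψ → ℤ.+-identityʳ ⟨ x , ψ ⟩) }
            ; inverse = (λ x → mk λ ψ → ℤ.+-inverseˡ ⟨ x , ψ ⟩) , (λ x → mk λ ψ → ℤ.+-inverseʳ ⟨ x , ψ ⟩)
            ; ⁻¹-cong = λ e → mk λ ψ → cong ℤ.-_ (at e ψ) }
          ; comm = λ x y → mk λ ψ → ℤ.+-comm ⟨ x , ψ ⟩ ⟨ y , ψ ⟩ }
        ; *-cong = ⊗-cong
        ; *-assoc = ⊗-assoc
        ; *-identity = ⊗-identityˡ , λ x → mk λ ψ → ≡.trans (at (⊗-comm x 𝟙) ψ) (at (⊗-identityˡ x) ψ)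
        ; distrib = ⊗-distribˡ , λ x y z → mk λ ψ → ≡.refl }
      ; *-comm = ⊗-comm } }

  open CommutativeRing ring using (semiring; commutativeSemiring; setoid) public
  open Mult semiring using () renaming (_×_ to _·_)
  open Exp commutativeSemiring using (_^_; ^-congˡ)

  ⟨·⟩ : ∀ m x ψ → ⟨ m · x , ψ ⟩ ≡ + m ℤ.* ⟨ x , ψ ⟩
  ⟨·⟩ zero    x ψ = ≡.sym (ℤ.*-zeroˡ ⟨ x , ψ ⟩)
  ⟨·⟩ (suc m) x ψ = ≡.trans (cong (λ z → ⟨ x , ψ ⟩ ℤ.+ z) (⟨·⟩ m x ψ)) (≡.sym (ℤ.suc-* (+ m) ⟨ x , ψ ⟩))

  torsion-free : ∀ m .{{_ : NonZero m}} x y → m · x ≋ m · y → x ≋ y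
  torsion-free m@(suc _) x y e .at ψ = ℤ.*-cancelˡ-≡ (+ m) _ _
    (≡.trans (≡.sym (⟨·⟩ m x ψ)) (≡.trans (at e ψ) (⟨·⟩ m y ψ)))

  module Power (k : ℕ) where
    _^ᴬ_ : A → ℕ → A
    a ^ᴬ zero  = ε
    a ^ᴬ suc m = a ∙ (a ^ᴬ m)

    ^ᴬ-∙ : ∀ a b m → (a ∙ b) ^ᴬ m ≡ (a ^ᴬ m) ∙ (b ^ᴬ m)
    ^ᴬ-∙ a b zero    = ≡.sym (identityˡ ε)
    ^ᴬ-∙ a b (suc m) = ≡.trans (cong ((a ∙ b) ∙_) (^ᴬ-∙ a b m)) (≡.trans (assoc a b _)
      (≡.trans (cong (a ∙_) (≡.trans (≡.sym (assoc b (a ^ᴬ m) _)) (≡.trans (cong (_∙ (b ^ᴬ m)) (comm b _)) (assoc _ b _))))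
        (≡.sym (assoc a (a ^ᴬ m) _))))

    ε^ᴬ : ∀ m → ε ^ᴬ m ≡ ε
    ε^ᴬ zero    = ≡.refl
    ε^ᴬ (suc m) = ≡.trans (identityˡ _) (ε^ᴬ m)

    φ : Formal → Formal
    φ x = bind x λ a → [ a ^ᴬ k ]

    φ-cong : ∀ {x y} → x ≋ y → φ x ≋ φ y
    φ-cong {x} {y} e .at ψ = begin
      ⟨ φ x , ψ ⟩                    ≡⟨ ⟨bind⟩ x _ ψ ⟩
      ⟨ x , (λ a → ψ (a ^ᴬ k)) ⟩     ≡⟨ at e (λ a → ψ (a ^ᴬ k)) ⟩
      ⟨ y , (λ a → ψ (a ^ᴬ k)) ⟩     ≡⟨ ⟨bind⟩ y _ ψ ⟨
      ⟨ φ y , ψ ⟩                    ∎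
      where open ≡.≡-Reasoning

    φ-⊗ : ∀ x y → φ (x ⊗ y) ≋ φ x ⊗ φ y
    φ-⊗ x y .at ψ = begin
      ⟨ φ (x ⊗ y) , ψ ⟩
        ≡⟨ ⟨bind⟩ (x ⊗ y) _ ψ ⟩
      ⟨ x ⊗ y , (λ c → ψ (c ^ᴬ k)) ⟩
        ≡⟨ ⟨⊗⟩ x y (λ c → ψ (c ^ᴬ k)) ⟩
      ⟨ x , (λ a → ⟨ y , (λ b → ψ ((a ∙ b) ^ᴬ k)) ⟩) ⟩
        ≡⟨ ⟨⟩-cong x (λ a → ⟨⟩-cong y λ b → cong ψ (^ᴬ-∙ a b k)) ⟩
      ⟨ x , (λ a → ⟨ y , (λ b → ψ ((a ^ᴬ k) ∙ (b ^ᴬ k))) ⟩) ⟩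
        ≡⟨ ⟨⟩-cong x (λ a → ⟨bind⟩ y (λ b → [ b ^ᴬ k ]) (λ b → ψ ((a ^ᴬ k) ∙ b))) ⟨
      ⟨ x , (λ a → ⟨ φ y , (λ b → ψ ((a ^ᴬ k) ∙ b)) ⟩) ⟩
        ≡⟨ ⟨bind⟩ x (λ a → [ a ^ᴬ k ]) (λ a → ⟨ φ y , (λ b → ψ (a ∙ b)) ⟩) ⟨
      ⟨ φ x , (λ a → ⟨ φ y , (λ b → ψ (a ∙ b)) ⟩) ⟩
        ≡⟨ ⟨⊗⟩ (φ x) (φ y) ψ ⟨
      ⟨ φ x ⊗ φ y , ψ ⟩ ∎
      where open ≡.≡-Reasoning

    φ-𝟙 : φ 𝟙 ≋ 𝟙
    φ-𝟙 .at ψ = cong ψ (ε^ᴬ k)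

    [^] : ∀ a m → [ a ] ^ m ≋ [ a ^ᴬ m ]
    [^] a zero    .at ψ = ≡.refl
    [^] a (suc m) .at ψ = ≡.trans (⟨⊗⟩ [ a ] ([ a ] ^ m) ψ) (at ([^] a m) (λ b → ψ (a ∙ b)))

  module FrobeniusLift (p′ : ℕ) (pr : Prime (suc p′)) where
    open Power (suc p′)
    private
      module R = CommutativeRing ring
      p = suc p′
    open Frobenius ring p′ pr using (freshman)
    open SetoidReasoning R.setoid

    0^p : 𝟘 ^ p ≋ 𝟘
    0^p = R.zeroˡ (𝟘 ^ p′)

    p·𝟘 : p · 𝟘 ≋ 𝟘
    p·𝟘 .at ψ = ≡.trans (⟨·⟩ p 𝟘 ψ) (ℤ.*-zeroʳ (+ p))

    -- φ [ a ] is exactly [ a ] ^ p, so a correction arises only from sums, through `freshman`. For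
    -- negatives `freshman` is applied to x ⊕ ⊖ x, whose p-th power is 𝟘; this treats p = 2 and odd
    -- p alike.
    δ : ∀ x → ∃ λ d → φ x ≋ x ^ p ⊕ p · d
    δ [ a ] = 𝟘 , R.sym (R.trans (R.+-cong ([^] a p) p·𝟘) (R.+-identityʳ _))
    δ 𝟘 = 𝟘 , R.sym (R.trans (R.+-cong 0^p p·𝟘) (R.+-identityʳ _))
    δ (x ⊕ y) = let d , e = δ x ; d′ , e′ = δ y ; c , fr = freshman x y in d ⊕ d′ ⊕ (⊖ (x ⊗ c)) , (begin
      φ x ⊕ φ y                                        ≈⟨ R.+-cong e e′ ⟩
      (x ^ p ⊕ p · d) ⊕ (y ^ p ⊕ p · d′)
        ≈⟨ mk (λ ψ → cong₂ (λ z w → (⟨ x ^ p , ψ ⟩ ℤ.+ z) ℤ.+ (⟨ y ^ p , ψ ⟩ ℤ.+ w)) (⟨·⟩ p d ψ) (⟨·⟩ p d′ ψ)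
             ⟨trans⟩ lem (+ p) ⟨ x ^ p , ψ ⟩ ⟨ y ^ p , ψ ⟩ ⟨ d , ψ ⟩ ⟨ d′ , ψ ⟩ ⟨ x ⊗ c , ψ ⟩
             ⟨trans⟩ ≡.sym (cong₂ (λ z w → ⟨ x ^ p , ψ ⟩ ℤ.+ ⟨ y ^ p , ψ ⟩ ℤ.+ z ℤ.+ w) (⟨·⟩ p (x ⊗ c) ψ) (⟨·⟩ p (d ⊕ d′ ⊕ (⊖ (x ⊗ c))) ψ))) ⟩
      x ^ p ⊕ y ^ p ⊕ p · (x ⊗ c) ⊕ p · (d ⊕ d′ ⊕ (⊖ (x ⊗ c))) ≈⟨ R.+-congʳ fr ⟨
      (x ⊕ y) ^ p ⊕ p · (d ⊕ d′ ⊕ (⊖ (x ⊗ c)))         ∎)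
      where
      infixr 1 _⟨trans⟩_
      _⟨trans⟩_ : ∀ {i j k : ℤ} → i ≡ j → j ≡ k → i ≡ k
      _⟨trans⟩_ = ≡.trans
      lem : ∀ p x y d d′ c → (x ℤ.+ p ℤ.* d) ℤ.+ (y ℤ.+ p ℤ.* d′)
            ≡ x ℤ.+ y ℤ.+ p ℤ.* c ℤ.+ p ℤ.* (d ℤ.+ d′ ℤ.+ ℤ.- c)
      lem = IntSolver.solve-∀
    δ (⊖ x) = let d , e = δ x ; c , fr = freshman x (⊖ x) in (⊖ d) ⊕ x ⊗ c , (begin
      ⊖ φ x                                            ≈⟨ R.-‿cong e ⟩
      ⊖ (x ^ p ⊕ p · d)                                ≈⟨ R.+-identityˡ _ ⟨
      𝟘 ⊕ ⊖ (x ^ p ⊕ p · d)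
        ≈⟨ R.+-congʳ (R.trans (R.sym fr) (R.trans (^-congˡ p (R.-‿inverseʳ x)) 0^p)) ⟨
      x ^ p ⊕ (⊖ x) ^ p ⊕ p · (x ⊗ c) ⊕ ⊖ (x ^ p ⊕ p · d)
        ≈⟨ mk (λ ψ → ≡.trans (cong₂ (λ z w → ⟨ x ^ p , ψ ⟩ ℤ.+ ⟨ (⊖ x) ^ p , ψ ⟩ ℤ.+ z ℤ.+ ℤ.- (⟨ x ^ p , ψ ⟩ ℤ.+ w)) (⟨·⟩ p (x ⊗ c) ψ) (⟨·⟩ p d ψ))
             (≡.trans (lem (+ p) ⟨ x ^ p , ψ ⟩ ⟨ (⊖ x) ^ p , ψ ⟩ ⟨ d , ψ ⟩ ⟨ x ⊗ c , ψ ⟩)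
               (cong (λ z → ⟨ (⊖ x) ^ p , ψ ⟩ ℤ.+ z) (≡.sym (⟨·⟩ p ((⊖ d) ⊕ x ⊗ c) ψ))))) ⟩
      (⊖ x) ^ p ⊕ p · ((⊖ d) ⊕ x ⊗ c)                  ∎)
      where
      lem : ∀ p x y d c → x ℤ.+ y ℤ.+ p ℤ.* c ℤ.+ ℤ.- (x ℤ.+ p ℤ.* d) ≡ y ℤ.+ p ℤ.* (ℤ.- d ℤ.+ c)
      lem = IntSolver.solve-∀

  -- Well-definedness of the pairing with values in a group G: the functional
  -- ⟨ x , _ ⟩ on integer-valued functions already determines the coefficients.
  module Evaluation {c ℓ} (G : AbelianGroup c ℓ) where
    open AbelianGroup G using (Carrier; _≈_; refl; sym; trans; ⁻¹-cong; commutativeMonoid)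
      renaming (_∙_ to _+_; ε to 0#; _⁻¹ to -_; ∙-cong to +-cong; identityʳ to +-identityʳ)
    open Action G
    open CMSum commutativeMonoid using (sum; sum-cong-≋; ∑-distrib-+)

    ev : (A → Carrier) → Formal → Carrier
    ev χ [ a ]   = χ a
    ev χ 𝟘       = 0#
    ev χ (x ⊕ y) = ev χ x + ev χ y
    ev χ (⊖ x)   = - ev χ x

    -- The functional of x evaluated at `δ[ c ]` is the coefficient of c in x.
    δ[_] : A → A → ℤ
    δ[ c ] a = if does (c Fin.≟ a) then + 1 else + 0

    ev-sum : ∀ χ x → ev χ x ≈ sum (λ c → ⟨ x , δ[ c ] ⟩ • χ c)
    ev-sum χ [ a ] = sym (trans (sum-single a (λ c → δ[ c ] a • χ c) λ c c≢a → reflexive (cong (λ b → (if b then + 1 else + 0) • χ c) (dec-false (c Fin.≟ a) c≢a)))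
      (trans (reflexive (cong (λ b → (if b then + 1 else + 0) • χ a) (dec-true (a Fin.≟ a) ≡.refl))) (+-identityʳ _)))
      where reflexive = AbelianGroup.reflexive G
    ev-sum χ 𝟘 = sym (sum-zero (λ c → (+ 0) • χ c) λ c → refl)
    ev-sum χ (x ⊕ y) = trans (+-cong (ev-sum χ x) (ev-sum χ y)) (trans (sym (∑-distrib-+ (λ c → ⟨ x , δ[ c ] ⟩ • χ c) (λ c → ⟨ y , δ[ c ] ⟩ • χ c)))
      (sum-cong-≋ λ c → sym (+-• ⟨ x , δ[ c ] ⟩ ⟨ y , δ[ c ] ⟩ (χ c))))
    ev-sum χ (⊖ x) = trans (⁻¹-cong (ev-sum χ x)) (trans (sym (sum-neg λ c → ⟨ x , δ[ c ] ⟩ • χ c))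
      (sum-cong-≋ λ c → sym (-‿• ⟨ x , δ[ c ] ⟩ (χ c))))

    ev-cong : ∀ χ {x y} → x ≋ y → ev χ x ≈ ev χ y
    ev-cong χ {x} {y} e = trans (ev-sum χ x) (trans
      (sum-cong-≋ λ c → AbelianGroup.reflexive G (cong (_• χ c) (at e δ[ c ])))
      (sym (ev-sum χ y)))

-- Finite fields: sums over all elements, roots, characteristic.

module FieldProperties {c ℓ₁ ℓ₂ Q} (F : FiniteField c ℓ₁ ℓ₂ Q) where
  open FiniteField F hiding (zero)
  open Exp commutativeSemiring
  open HeytingField heytingField using (#⇒invertible; invertible⇒#; #-irrefl; tight)
  open RingProperties (CommutativeRing.ring commutativeRing) using (-‿distribˡ-*; -‿distribʳ-*)
  open GroupProperties +-group using (x∙y⁻¹≈ε⇒x≈y; ε⁻¹≈ε)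
  open Inverse enumeration using (to; from; to-cong; strictlyInverseˡ; strictlyInverseʳ)
  open Mult semiring using () renaming (_×_ to _·_; ×-congʳ to ·-congʳ; ×-homo-+ to ·-homo-+;
    ×-assocˡ to ·-assocˡ; ×-assoc-* to ·-assoc-*; ×1-homo-* to ·1-homo-*)

  from-injective : ∀ {i j} → from i ≈ from j → i ≡ j
  from-injective {i} {j} e = ≡.trans (≡.sym (strictlyInverseˡ i)) (≡.trans (to-cong e) (strictlyInverseˡ j))

  abstract
    zero? : ∀ x → Dec (x ≈ 0#)
    zero? x = x ≟ 0#

  x-0≈x : ∀ x → x - 0# ≈ x
  x-0≈x x = trans (+-congˡ ε⁻¹≈ε) (+-identityʳ x)

  1≉0 : ¬ 1# ≈ 0#
  1≉0 1≈0 = #-irrefl 1≈0 (invertible⇒# (1# , trans (*-identityˡ _) (x-0≈x 1#) , trans (*-identityʳ _) (x-0≈x 1#)))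

  -- Being nonzero does not directly provide an apartness witness. The inverse is therefore searched
  -- for among the finitely many elements; a failed search would refute apartness from 0#, and
  -- tightness would give x ≈ 0#.
  invertible : ∀ x → ¬ x ≈ 0# → ∃ λ y → x * y ≈ 1#
  invertible x x≉0 with Fin.any? (λ i → (x * from i) ≟ 1#)
  ... | yes (i , e) = from i , e
  ... | no  none    = contradiction (proj₁ (tight x 0#) λ x#0 →
        let y , _ , xy≈1 = #⇒invertible x#0 in
        none (to y , trans (*-congˡ (strictlyInverseʳ y)) (trans (*-congʳ (sym (x-0≈x x))) xy≈1))) x≉0

  cancel : ∀ {x y} → ¬ x ≈ 0# → x * y ≈ 0# → y ≈ 0#
  cancel {x} {y} x≉0 xy≈0 = let z , xz≈1 = invertible x x≉0 in begin
    y              ≈⟨ *-identityˡ y ⟨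
    1# * y         ≈⟨ *-congʳ (trans (*-comm z x) xz≈1) ⟨
    z * x * y      ≈⟨ *-assoc z x y ⟩
    z * (x * y)    ≈⟨ *-congˡ xy≈0 ⟩
    z * 0#         ≈⟨ zeroʳ z ⟩
    0#             ∎
    where open SetoidReasoning setoid

  *-≉0 : ∀ {x y} → ¬ x ≈ 0# → ¬ y ≈ 0# → ¬ x * y ≈ 0#
  *-≉0 x≉0 y≉0 xy≈0 = y≉0 (cancel x≉0 xy≈0)

  ^-≉0 : ∀ {x} → ¬ x ≈ 0# → ∀ m → ¬ x ^ m ≈ 0#
  ^-≉0 x≉0 zero    = 1≉0
  ^-≉0 x≉0 (suc m) = *-≉0 x≉0 (^-≉0 x≉0 m)

  *-cancelˡ : ∀ {x y z} → ¬ x ≈ 0# → x * y ≈ x * z → y ≈ z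
  *-cancelˡ {x} {y} {z} x≉0 e = x∙y⁻¹≈ε⇒x≈y y z (cancel x≉0 (trans (distribˡ x y (- z))
    (trans (+-cong e (sym (-‿distribʳ-* x z))) (-‿inverseʳ (x * z)))))

  0^ : ∀ m .{{_ : NonZero m}} → 0# ^ m ≈ 0#
  0^ (suc m) = zeroˡ _

  1^ : ∀ m → 1# ^ m ≈ 1#
  1^ zero    = refl
  1^ (suc m) = trans (*-identityˡ _) (1^ m)

  module Summation {a ℓ} (M : CommutativeMonoid a ℓ) where
    private module M = CommutativeMonoid M
    open M using () renaming (_∙_ to _⊞_; _≈_ to _≈ᴹ_)
    open CMSum M using (sum; sum-cong-≋; sum-remove; sum-permute; sum-replicate; ∑-distrib-+; ∑-comm)
    open CMult M using () renaming (_×_ to _·ᴹ_)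

    Respectful : (Carrier → M.Carrier) → Set _
    Respectful φ = ∀ {x y} → x ≈ y → φ x ≈ᴹ φ y

    Σ : (Carrier → M.Carrier) → M.Carrier
    Σ φ = sum (λ i → φ (from i))

    Σ-cong : ∀ {φ ψ} → (∀ x → φ x ≈ᴹ ψ x) → Σ φ ≈ᴹ Σ ψ
    Σ-cong h = sum-cong-≋ (λ i → h (from i))

    Σ-⊞ : ∀ φ ψ → Σ (λ x → φ x ⊞ ψ x) ≈ᴹ Σ φ ⊞ Σ ψ
    Σ-⊞ φ ψ = ∑-distrib-+ (φ ∘ from) (ψ ∘ from)

    Σ-comm : ∀ (φ : Carrier → Carrier → M.Carrier) → Σ (λ x → Σ (λ y → φ x y)) ≈ᴹ Σ (λ y → Σ (λ x → φ x y))
    Σ-comm φ = ∑-comm (λ i j → φ (from i) (from j))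

    Σ-const : ∀ z → Σ (λ _ → z) ≈ᴹ Q ·ᴹ z
    Σ-const z = sum-replicate Q

    Σ-bijection : ∀ φ → Respectful φ → (f g : Carrier → Carrier) →
      (∀ {x y} → x ≈ y → f x ≈ f y) → (∀ {x y} → x ≈ y → g x ≈ g y) →
      (∀ x → f (g x) ≈ x) → (∀ x → g (f x) ≈ x) → Σ (λ x → φ (f x)) ≈ᴹ Σ φ
    Σ-bijection φ φ-resp f g f-cong g-cong fg gf = M.sym (M.trans (sum-permute (φ ∘ from) π)
      (sum-cong-≋ λ i → φ-resp (strictlyInverseʳ (f (from i)))))
      where
      π = permutation (λ i → to (f (from i))) (λ i → to (g (from i)))
        (λ i → ≡.trans (to-cong (trans (f-cong (strictlyInverseʳ _)) (fg (from i)))) (strictlyInverseˡ i))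
        (λ i → ≡.trans (to-cong (trans (g-cong (strictlyInverseʳ _)) (gf (from i)))) (strictlyInverseˡ i))

    Σ-translate : ∀ φ → Respectful φ → ∀ a → Σ (λ x → φ (x + a)) ≈ᴹ Σ φ
    Σ-translate φ φ-resp a = Σ-bijection φ φ-resp (_+ a) (_- a) +-congʳ +-congʳ
      (λ x → trans (+-assoc x (- a) a) (trans (+-congˡ (-‿inverseˡ a)) (+-identityʳ x)))
      (λ x → trans (+-assoc x a (- a)) (trans (+-congˡ (-‿inverseʳ a)) (+-identityʳ x)))

    Σ-scale : ∀ φ → Respectful φ → ∀ {a} → ¬ a ≈ 0# → Σ (λ x → φ (a * x)) ≈ᴹ Σ φ
    Σ-scale φ φ-resp {a} a≉0 = let b , ab≈1 = invertible a a≉0 in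
      Σ-bijection φ φ-resp (a *_) (b *_) *-congˡ *-congˡ
      (λ x → trans (sym (*-assoc a b x)) (trans (*-congʳ ab≈1) (*-identityˡ x)))
      (λ x → trans (sym (*-assoc b a x)) (trans (*-congʳ (trans (*-comm b a) ab≈1)) (*-identityˡ x)))

    sum-split : ∀ {n} (i : Fin n) (t : Vector M.Carrier n) z → (∀ j → j ≢ i → t j ≈ᴹ z) →
                sum t ≈ᴹ t i ⊞ (n ℕ.∸ 1) ·ᴹ z
    sum-split {suc n} i t z h = M.trans (sum-remove t) (M.∙-congˡ (M.trans
      (sum-cong-≋ λ j → h (Fin.punchIn i j) (Fin.punchInᵢ≢i i j)) (sum-replicate n)))

    Σ-split : ∀ φ → Respectful φ → ∀ z → (∀ x → ¬ x ≈ 0# → φ x ≈ᴹ z) → Σ φ ≈ᴹ φ 0# ⊞ (Q ℕ.∸ 1) ·ᴹ z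
    Σ-split φ φ-resp z h = M.trans
      (sum-split (to 0#) (φ ∘ from) z λ j j≢ → h (from j) λ e → j≢ (≡.trans (≡.sym (strictlyInverseˡ j)) (to-cong e)))
      (M.∙-congʳ (φ-resp (strictlyInverseʳ 0#)))

    Σ^ : ∀ k → (Vec Carrier k → M.Carrier) → M.Carrier
    Σ^ zero    φ = φ []
    Σ^ (suc k) φ = Σ λ x → Σ^ k λ v → φ (x ∷ v)

    Σ^-cong : ∀ k {φ ψ} → (∀ v → φ v ≈ᴹ ψ v) → Σ^ k φ ≈ᴹ Σ^ k ψ
    Σ^-cong zero    h = h []
    Σ^-cong (suc k) h = Σ-cong λ x → Σ^-cong k λ v → h (x ∷ v)

    Σ^-⊞ : ∀ k φ ψ → Σ^ k (λ v → φ v ⊞ ψ v) ≈ᴹ Σ^ k φ ⊞ Σ^ k ψ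
    Σ^-⊞ zero    φ ψ = M.refl
    Σ^-⊞ (suc k) φ ψ = M.trans (Σ-cong λ x → Σ^-⊞ k (λ v → φ (x ∷ v)) (λ v → ψ (x ∷ v)))
      (Σ-⊞ (λ x → Σ^ k λ v → φ (x ∷ v)) (λ x → Σ^ k λ v → ψ (x ∷ v)))

    Σ-ε : Σ (λ _ → M.ε) ≈ᴹ M.ε
    Σ-ε = CMSum.sum-replicate-zero M Q

    Σ^-ε : ∀ k → Σ^ k (λ _ → M.ε) ≈ᴹ M.ε
    Σ^-ε zero    = M.refl
    Σ^-ε (suc k) = M.trans (Σ-cong λ x → Σ^-ε k) Σ-ε

    Σ^-sum : ∀ k {n} (φ : Vec Carrier k → Fin n → M.Carrier) →
             Σ^ k (λ v → sum (φ v)) ≈ᴹ sum (λ i → Σ^ k (λ v → φ v i))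
    Σ^-sum k {zero}  φ = Σ^-ε k
    Σ^-sum k {suc n} φ = M.trans (Σ^-⊞ k (λ v → φ v zero) (λ v → sum (λ i → φ v (suc i))))
      (M.∙-congˡ (Σ^-sum k (λ v i → φ v (suc i))))

    Σᴸ : ∀ {b} {B : Set b} → (B → M.Carrier) → List B → M.Carrier
    Σᴸ φ []       = M.ε
    Σᴸ φ (x ∷ xs) = φ x ⊞ Σᴸ φ xs

    Σᴸ-++ : ∀ {b} {B : Set b} (φ : B → M.Carrier) xs ys → Σᴸ φ (xs List.++ ys) ≈ᴹ Σᴸ φ xs ⊞ Σᴸ φ ys
    Σᴸ-++ φ []       ys = M.sym (M.identityˡ _)
    Σᴸ-++ φ (x ∷ xs) ys = M.trans (M.∙-congˡ (Σᴸ-++ φ xs ys)) (M.sym (M.assoc _ _ _))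

    Σᴸ-map : ∀ {b b′} {B : Set b} {B′ : Set b′} (φ : B′ → M.Carrier) (f : B → B′) xs →
             Σᴸ φ (List.map f xs) ≈ᴹ Σᴸ (φ ∘ f) xs
    Σᴸ-map φ f []       = M.refl
    Σᴸ-map φ f (x ∷ xs) = M.∙-congˡ (Σᴸ-map φ f xs)

    Σᴸ-product : ∀ {b b′ b″} {B : Set b} {B′ : Set b′} {B″ : Set b″} (φ : B″ → M.Carrier)
                 (f : B → B′ → B″) xs ys →
                 Σᴸ φ (List.cartesianProductWith f xs ys) ≈ᴹ Σᴸ (λ x → Σᴸ (λ y → φ (f x y)) ys) xs
    Σᴸ-product φ f []       ys = M.refl
    Σᴸ-product φ f (x ∷ xs) ys = M.trans (Σᴸ-++ φ (List.map (f x) ys) _)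
      (M.∙-cong (Σᴸ-map φ (f x) ys) (Σᴸ-product φ f xs ys))

    Σᴸ-tabulate : ∀ {b} {B : Set b} (φ : B → M.Carrier) {n} (t : Fin n → B) →
                  Σᴸ φ (List.tabulate t) ≈ᴹ sum (φ ∘ t)
    Σᴸ-tabulate φ {zero}  t = M.refl
    Σᴸ-tabulate φ {suc n} t = M.∙-congˡ (Σᴸ-tabulate φ (t ∘ suc))

    Σᴸ-elements : ∀ φ → Σᴸ φ elements ≈ᴹ Σ φ
    Σᴸ-elements φ = Σᴸ-tabulate φ from

    Σᴸ-points : ∀ k φ → Σᴸ φ (points k) ≈ᴹ Σ^ k φ
    Σᴸ-points zero    φ = M.identityʳ _
    Σᴸ-points (suc k) φ = M.trans (Σᴸ-product φ _∷_ elements (points k))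
      (M.trans (Σᴸ-elements (λ x → Σᴸ (λ v → φ (x ∷ v)) (points k)))
        (Σ-cong λ x → Σᴸ-points k (λ v → φ (x ∷ v))))

    Σᴸ-filter : ∀ {b ℓ′} {B : Set b} {P : B → Set ℓ′} (P? : ∀ x → Dec (P x)) z xs →
                length (List.filter P? xs) ·ᴹ z ≈ᴹ Σᴸ (λ x → if does (P? x) then z else M.ε) xs
    Σᴸ-filter P? z []       = M.refl
    Σᴸ-filter P? z (x ∷ xs) with does (P? x)
    ... | true  = M.∙-congˡ (Σᴸ-filter P? z xs)
    ... | false = M.trans (Σᴸ-filter P? z xs) (M.sym (M.identityˡ _))

    Σᴸ-count : ∀ {ℓ′} k {P : Vec Carrier k × Carrier → Set ℓ′} (P? : ∀ v → Dec (P v)) z →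
      length (List.filter P? (List.cartesianProduct (points k) elements)) ·ᴹ z ≈ᴹ
      Σ^ k (λ v → Σ (λ y → if does (P? (v , y)) then z else M.ε))
    Σᴸ-count k P? z = M.trans (Σᴸ-filter P? z (List.cartesianProduct (points k) elements))
      (M.trans (Σᴸ-product χ _,_ (points k) elements)
      (M.trans (Σᴸ-points k (λ v → Σᴸ (λ y → χ (v , y)) elements))
        (Σ^-cong k λ v → Σᴸ-elements (λ y → χ (v , y)))))
      where χ = λ v → if does (P? v) then z else M.ε

    Σ^-Σ : ∀ k (φ : Vec Carrier k → Carrier → M.Carrier) →
           Σ^ k (λ v → Σ (φ v)) ≈ᴹ Σ (λ x → Σ^ k (λ v → φ v x))
    Σ^-Σ k φ = Σ^-sum k (λ v i → φ v (from i))

  module Products = Summation *-commutativeMonoid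

  -- Multiplication by a permutes the nonzero elements, so their product is unchanged. `h` puts 1#
  -- in place of zero so that products may run over the whole field, and `u` is the factor by which
  -- `h` changes.
  fermat : ∀ {a} → ¬ a ≈ 0# → a ^ (Q ℕ.∸ 1) ≈ 1#
  fermat {a} a≉0 = *-cancelˡ Πh≉0 (begin
    Πh * a ^ (Q ℕ.∸ 1)      ≈⟨ *-congˡ (trans (Σ-split u u-resp a u-≉0) (trans (*-congʳ u-0) (*-identityˡ _))) ⟨
    Πh * Σ u                ≈⟨ Σ-⊞ h u ⟨
    Σ (λ x → h x * u x)     ≈⟨ Σ-cong h*u ⟨
    Σ (λ x → h (a * x))     ≈⟨ Σ-scale h h-resp a≉0 ⟩
    Πh                      ≈⟨ *-identityʳ _ ⟨
    Πh * 1#                 ∎)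
    where
    open Products
    open SetoidReasoning setoid
    h u : Carrier → Carrier
    h x = if does (zero? x) then 1# else x
    u x = if does (zero? x) then 1# else a
    Πh = Σ h
    h-resp : Respectful h
    h-resp {x} {y} e with zero? x | zero? y
    ... | yes _   | yes _   = refl
    ... | yes x≈0 | no  y≉0 = contradiction (trans (sym e) x≈0) y≉0
    ... | no  x≉0 | yes y≈0 = contradiction (trans e y≈0) x≉0
    ... | no  _   | no  _   = e
    u-resp : Respectful u
    u-resp {x} {y} e with zero? x | zero? y
    ... | yes _   | yes _   = refl
    ... | yes x≈0 | no  y≉0 = contradiction (trans (sym e) x≈0) y≉0
    ... | no  x≉0 | yes y≈0 = contradiction (trans e y≈0) x≉0
    ... | no  _   | no  _   = refl
    u-0 : u 0# ≈ 1#
    u-0 with zero? 0#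
    ... | yes _   = refl
    ... | no  0≉0 = contradiction refl 0≉0
    u-≉0 : ∀ x → ¬ x ≈ 0# → u x ≈ a
    u-≉0 x x≉0 with zero? x
    ... | yes x≈0 = contradiction x≈0 x≉0
    ... | no  _   = refl
    h*u : ∀ x → h (a * x) ≈ h x * u x
    h*u x with zero? x | zero? (a * x)
    ... | yes _   | yes _    = sym (*-identityˡ 1#)
    ... | yes x≈0 | no  ax≉0 = contradiction (trans (*-congˡ x≈0) (zeroʳ a)) ax≉0
    ... | no  x≉0 | yes ax≈0 = contradiction (cancel a≉0 ax≈0) x≉0
    ... | no  _   | no  _    = *-comm a x
    h≉0 : ∀ x → ¬ h x ≈ 0#
    h≉0 x with zero? x
    ... | yes _   = 1≉0
    ... | no  x≉0 = x≉0
    product≉0 : ∀ {n} (t : Vector Carrier n) → (∀ i → ¬ t i ≈ 0#) → ¬ CMSum.sum *-commutativeMonoid t ≈ 0#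
    product≉0 {zero}  t t≉0 = 1≉0
    product≉0 {suc n} t t≉0 = *-≉0 (t≉0 zero) (product≉0 (t ∘ suc) (t≉0 ∘ suc))
    Πh≉0 : ¬ Πh ≈ 0#
    Πh≉0 = product≉0 (h ∘ from) (h≉0 ∘ from)

  Q≢0 : NonZero Q
  Q≢0 = ℕ.≢-nonZero λ Q≡0 → ¬Fin0 (subst Fin Q≡0 (to 0#))
    where
    ¬Fin0 : ¬ Fin 0
    ¬Fin0 ()

  fermat-multiple : ∀ {a m} → ¬ a ≈ 0# → Q ℕ.∸ 1 ∣ m → a ^ m ≈ 1#
  fermat-multiple {a} a≉0 (divides k ≡.refl) = trans (^-congʳ a (ℕ.*-comm k (Q ℕ.∸ 1)))
    (trans (sym (^-assocʳ a (Q ℕ.∸ 1) k)) (trans (^-congˡ k (fermat a≉0)) (1^ k)))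

  -- The monic polynomial with lower coefficients cs, in Horner form.
  horner : List Carrier → Carrier → Carrier
  horner []       x = 1#
  horner (c ∷ cs) x = c + x * horner cs x

  -- Synthetic division by x - a: the lower coefficients of the quotient are the values at a of the
  -- successive Horner tails.
  quotient-by : Carrier → List Carrier → List Carrier
  quotient-by a []             = []
  quotient-by a (c ∷ [])       = []
  quotient-by a (c ∷ cs@(_ ∷ _)) = horner cs a ∷ quotient-by a cs

  length-quotient : ∀ a c cs → length (quotient-by a (c ∷ cs)) ≡ length cs
  length-quotient a c []        = ≡.refl
  length-quotient a c (c′ ∷ cs) = cong suc (length-quotient a c′ cs)

  horner-quotient : ∀ a c cs x → horner (c ∷ cs) a ≈ 0# →
                    horner (c ∷ cs) x ≈ (x - a) * horner (quotient-by a (c ∷ cs)) x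
  horner-quotient a c cs x root = trans (sym (trans (+-congˡ (trans (-‿cong root) ε⁻¹≈ε)) (+-identityʳ _))) (difference c cs)
    where
    open SetoidReasoning setoid
    difference : ∀ c cs → horner (c ∷ cs) x - horner (c ∷ cs) a ≈ (x - a) * horner (quotient-by a (c ∷ cs)) x
    difference c cs = trans (strip c (x * horner cs x) (a * horner cs a)) (go cs)
      where
      strip : ∀ c u v → (c + u) - (c + v) ≈ u - v
      strip c u v = begin
        (c + u) - (c + v)        ≈⟨ +-cong (+-comm c u) (sym (⁻¹-∙-comm c v)) ⟩
        (u + c) + (- c + - v)    ≈⟨ +-assoc u c _ ⟩
        u + (c + (- c + - v))    ≈⟨ +-congˡ (+-assoc c (- c) (- v)) ⟨
        u + (c + - c + - v)      ≈⟨ +-congˡ (+-congʳ (-‿inverseʳ c)) ⟩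
        u + (0# + - v)           ≈⟨ +-congˡ (+-identityˡ _) ⟩
        u - v                    ∎
        where open import Algebra.Properties.AbelianGroup +-abelianGroup using (⁻¹-∙-comm)
      go : ∀ cs → x * horner cs x - a * horner cs a ≈ (x - a) * horner (quotient-by a (c ∷ cs)) x
      go []        = sym (trans (distribʳ 1# x (- a)) (+-congˡ (sym (-‿distribˡ-* a 1#))))
      go (c′ ∷ cs) = let u = horner (c′ ∷ cs) x; v = horner (c′ ∷ cs) a; w = horner (quotient-by a (c′ ∷ cs)) x in begin
        x * u - a * v
          ≈⟨ +-congʳ (trans (sym (+-identityʳ _)) (+-congˡ (sym (-‿inverseˡ (x * v))))) ⟩
        x * u + (- (x * v) + x * v) - a * v
          ≈⟨ trans (+-congʳ (sym (+-assoc _ _ _))) (+-assoc _ _ _) ⟩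
        (x * u - x * v) + (x * v - a * v)
          ≈⟨ +-cong (trans (+-congˡ (-‿distribʳ-* x v)) (sym (distribˡ x u (- v))))
               (trans (+-congˡ (-‿distribˡ-* a v)) (sym (distribʳ v x (- a)))) ⟩
        x * (u - v) + (x - a) * v
          ≈⟨ +-congʳ (*-congˡ (difference c′ cs)) ⟩
        x * ((x - a) * w) + (x - a) * v
          ≈⟨ +-congʳ (trans (sym (*-assoc x (x - a) w)) (trans (*-congʳ (*-comm x (x - a))) (*-assoc (x - a) x w))) ⟩
        (x - a) * (x * w) + (x - a) * v
          ≈⟨ trans (sym (distribˡ (x - a) _ _)) (*-congˡ (+-comm _ _)) ⟩
        (x - a) * (v + x * w) ∎

  -- After division by the linear factor of one root the other roots remain roots, since they are
  -- distinct from it and there are no zero divisors.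
  roots≤degree : ∀ cs {k} (r : Fin k → Carrier) → (∀ {i j} → r i ≈ r j → i ≡ j) →
                 (∀ i → horner cs (r i) ≈ 0#) → k ℕ.≤ length cs
  roots≤degree cs       {zero}  r inj root = z≤n
  roots≤degree []       {suc k} r inj root = contradiction (root zero) 1≉0
  roots≤degree (c ∷ cs) {suc k} r inj root = s≤s (subst (k ℕ.≤_) (length-quotient (r zero) c cs)
    (roots≤degree (quotient-by (r zero) (c ∷ cs)) (r ∘ suc) (Fin.suc-injective ∘ inj) λ i →
      cancel (λ e → 0≢suc (inj (x∙y⁻¹≈ε⇒x≈y (r (suc i)) (r zero) e)))
        (trans (sym (horner-quotient (r zero) c cs (r (suc i)) (root zero))) (root (suc i)))))
    where
    0≢suc : ∀ {i : Fin k} → suc i ≢ zero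
    0≢suc ()

  horner-replicate : ∀ m x → horner (replicate m 0#) x ≈ x ^ m
  horner-replicate zero    x = refl
  horner-replicate (suc m) x = trans (+-identityˡ _) (*-congˡ (horner-replicate m x))

  -- X ^ (b + 1) - X has at most b + 1 roots.
  some-power≉1 : ∀ b → ¬ (Q ℕ.∸ 1) ∣ b → ∃ λ x → ¬ x ≈ 0# × ¬ x ^ b ≈ 1#
  some-power≉1 b Q′∤b with Fin.any? (λ i → ¬? (from i ≟ 0#) ×-dec ¬? ((from i ^ b) ≟ 1#))
  ... | yes (i , h) = from i , h
  ... | no  none    = contradiction ≡.refl λ e → case-Q (Q ℕ.∸ 1) e
    where
    all-1 : ∀ x → ¬ x ≈ 0# → x ^ b ≈ 1#
    all-1 x x≉0 = decidable-stable ((x ^ b) ≟ 1#) λ ≉1 → none (to x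
      , (λ e → x≉0 (trans (sym (strictlyInverseʳ x)) e))
      , λ e → ≉1 (trans (^-congˡ b (sym (strictlyInverseʳ x))) e))
    case-Q : ∀ Q′ → ¬ Q ℕ.∸ 1 ≡ Q′
    case-Q zero Q′≡0 = Q≡1 (ℕ.≤-antisym (ℕ.m∸n≡0⇒m≤n Q′≡0) (ℕ.>-nonZero⁻¹ Q {{Q≢0}}))
      where
      Fin1 : ∀ {n} → n ≡ 1 → (i j : Fin n) → i ≡ j
      Fin1 ≡.refl zero zero = ≡.refl
      Q≡1 : ¬ Q ≡ 1
      Q≡1 e = 1≉0 (trans (sym (strictlyInverseʳ 1#)) (trans (reflexive (cong from (Fin1 e (to 1#) (to 0#)))) (strictlyInverseʳ 0#)))
    case-Q Q′@(suc Q″) e = reduced (b % Q′) ≡.refl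
      where
      all-1′ : ∀ x → ¬ x ≈ 0# → x ^ (b % Q′) ≈ 1#
      all-1′ x x≉0 = begin
        x ^ (b % Q′)                         ≈⟨ *-identityʳ _ ⟨
        x ^ (b % Q′) * 1#                    ≈⟨ *-congˡ (fermat-multiple x≉0 (divides (b / Q′) (cong (b / Q′ ℕ.*_) (≡.sym e)))) ⟨
        x ^ (b % Q′) * x ^ (b / Q′ ℕ.* Q′)   ≈⟨ ^-homo-* x (b % Q′) _ ⟨
        x ^ (b % Q′ ℕ.+ b / Q′ ℕ.* Q′)       ≡⟨ cong (x ^_) (m≡m%n+[m/n]*n b Q′) ⟨
        x ^ b                                ≈⟨ all-1 x x≉0 ⟩
        1#                                   ∎
        where open SetoidReasoning setoid
      reduced : ∀ r → ¬ b % Q′ ≡ r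
      reduced zero    r≡0 = Q′∤b (subst (_∣ b) (≡.sym e) (m%n≡0⇒n∣m b Q′ r≡0))
      reduced (suc r) r≡ = ℕ.<⇒≱ (subst (ℕ._< Q′) r≡ (m%n<n b Q′)) (ℕ.≤-pred (subst₂ ℕ._≤_ Q≡ len
        (roots≤degree poly from from-injective (root ∘ from))))
        where
        subst₂ = ≡.subst₂
        Q≡ : Q ≡ suc Q′
        Q≡ = ≡.trans (≡.sym (ℕ.suc-pred Q {{Q≢0}})) (cong suc e)
        poly = 0# ∷ (- 1#) ∷ replicate r 0#
        len : length poly ≡ suc (suc r)
        len = cong (2 ℕ.+_) (List.length-replicate r)
        root : ∀ x → horner poly x ≈ 0#
        root x with zero? x
        ... | yes x≈0 = trans (+-identityˡ _) (trans (*-congʳ x≈0) (zeroˡ _))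
        ... | no  x≉0 = trans (+-identityˡ _) (trans (*-congˡ (trans (+-congˡ (trans (*-congˡ (horner-replicate r x))
            (trans (^-congʳ x (≡.sym r≡)) (all-1′ x x≉0)))) (-‿inverseˡ 1#))) (zeroʳ x))

  module Sums = Summation +-commutativeMonoid

  -- Translation by 1# permutes the field, so adding 1# to each of the Q elements leaves their sum
  -- unchanged.
  Q·1≈0 : Q · 1# ≈ 0#
  Q·1≈0 = +-cancelˡ (Σ λ x → x) _ _ (begin
    Σ (λ x → x) + Q · 1#          ≈⟨ +-congˡ (Σ-const 1#) ⟨
    Σ (λ x → x) + Σ (λ _ → 1#)    ≈⟨ Σ-⊞ (λ x → x) (λ _ → 1#) ⟨
    Σ (λ x → x + 1#)              ≈⟨ Σ-translate (λ x → x) (λ e → e) 1# ⟩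
    Σ (λ x → x)                   ≈⟨ +-identityʳ _ ⟨
    Σ (λ x → x) + 0#              ∎)
    where
    open Sums
    open SetoidReasoning setoid
    open GroupProperties +-group using () renaming (∙-cancelˡ to +-cancelˡ)

  module Characteristic (p′ n : ℕ) (pr : Prime (suc p′)) (Q≡p^n : Q ≡ suc p′ ℕ.^ n) where
    private p = suc p′

    -- The n-th power of p · 1# is Q · 1# ≈ 0#, and a field has no nonzero nilpotent elements.
    p·1≈0 : p · 1# ≈ 0#
    p·1≈0 = decidable-stable ((p · 1#) ≟ 0#) λ p·1≉0 → ^-≉0 p·1≉0 n (trans (power n)
      (trans (reflexive (cong (_· 1#) (≡.sym Q≡p^n))) Q·1≈0))
      where
      power : ∀ n → (p · 1#) ^ n ≈ (p ℕ.^ n) · 1#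
      power zero    = sym (+-identityʳ 1#)
      power (suc n) = trans (*-congˡ (power n)) (sym (·1-homo-* p (p ℕ.^ n)))

    p·≈0 : ∀ x → p · x ≈ 0#
    p·≈0 x = trans (·-congʳ p (sym (*-identityˡ x))) (trans (sym (·-assoc-* p 1# x)) (trans (*-congʳ p·1≈0) (zeroˡ x)))

    ∣⇒·1≈0 : ∀ k → (k ℕ.* p) · 1# ≈ 0#
    ∣⇒·1≈0 k = trans (sym (·-assocˡ 1# k p)) (trans (·-congʳ k p·1≈0) (zero· k))
      where
      zero· : ∀ k → k · 0# ≈ 0#
      zero· zero    = refl
      zero· (suc k) = trans (+-identityˡ _) (zero· k)

    -- The remainder of m modulo p also annihilates 1#; if it were nonzero, a Bézout relation
    -- between it and p would yield 1# ≈ 0#.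
    ·1≈0⇒∣ : ∀ m → m · 1# ≈ 0# → p ∣ m
    ·1≈0⇒∣ m m·1≈0 = m%n≡0⇒n∣m m p (r≡0 (m % p) ≡.refl)
      where
      r·1≈0 : (m % p) · 1# ≈ 0#
      r·1≈0 = begin
        (m % p) · 1#                              ≈⟨ +-identityʳ _ ⟨
        (m % p) · 1# + 0#                         ≈⟨ +-congˡ (∣⇒·1≈0 (m / p)) ⟨
        (m % p) · 1# + (m / p ℕ.* p) · 1#         ≈⟨ ·-homo-+ 1# (m % p) _ ⟨
        (m % p ℕ.+ m / p ℕ.* p) · 1#              ≡⟨ cong (_· 1#) (m≡m%n+[m/n]*n m p) ⟨
        m · 1#                                    ≈⟨ m·1≈0 ⟩
        0#                                        ∎
        where open SetoidReasoning setoid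
      bezout : ∀ {a b} → b · 1# ≈ 0# → a · 1# ≈ 0# → ¬ 1 ℕ.+ a ≡ b
      bezout {a} b≈0 a≈0 ≡.refl = 1≉0 (trans (sym (+-identityʳ 1#)) (trans (+-congˡ (sym a≈0)) b≈0))
      multiple : ∀ k → (k ℕ.* (m % p)) · 1# ≈ 0#
      multiple k = trans (·1-homo-* k (m % p)) (trans (*-congˡ r·1≈0) (zeroʳ _))
      r≡0 : ∀ r → m % p ≡ r → r ≡ 0
      r≡0 zero    _  = ≡.refl
      r≡0 (suc r) r≡ with coprime-Bézout (prime⇒coprime {n = suc r} pr (subst (ℕ._< p) r≡ (m%n<n m p)))
      ... | Bézout.+- x y e = contradiction e (bezout (∣⇒·1≈0 x) (subst (λ z → (y ℕ.* z) · 1# ≈ 0#) r≡ (multiple y)))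
      ... | Bézout.-+ x y e = contradiction e (bezout (subst (λ z → (y ℕ.* z) · 1# ≈ 0#) r≡ (multiple y)) (∣⇒·1≈0 x))

    ^p-+ : ∀ x y → (x + y) ^ p ≈ x ^ p + y ^ p
    ^p-+ x y = let c , e = Frobenius.freshman commutativeRing p′ pr x y in
      trans e (trans (+-congˡ (p·≈0 (x * c))) (+-identityʳ _))

    ^p^-+ : ∀ e x y → (x + y) ^ (p ℕ.^ e) ≈ x ^ (p ℕ.^ e) + y ^ (p ℕ.^ e)
    ^p^-+ zero    x y = trans (*-identityʳ _) (sym (+-cong (*-identityʳ x) (*-identityʳ y)))
    ^p^-+ (suc e) x y = begin
      (x + y) ^ (p ℕ.* p ℕ.^ e)                     ≈⟨ ^-assocʳ (x + y) p (p ℕ.^ e) ⟨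
      ((x + y) ^ p) ^ (p ℕ.^ e)                     ≈⟨ ^-congˡ (p ℕ.^ e) (^p-+ x y) ⟩
      (x ^ p + y ^ p) ^ (p ℕ.^ e)                   ≈⟨ ^p^-+ e (x ^ p) (y ^ p) ⟩
      (x ^ p) ^ (p ℕ.^ e) + (y ^ p) ^ (p ℕ.^ e)     ≈⟨ +-cong (^-assocʳ x p (p ℕ.^ e)) (^-assocʳ y p (p ℕ.^ e)) ⟩
      x ^ (p ℕ.* p ℕ.^ e) + y ^ (p ℕ.* p ℕ.^ e)     ∎
      where open SetoidReasoning setoid

-- What the estimate of N uses about ℤ[F]: torsion-freeness, a lift φ of Frobenius, the reduction π
-- and its multiplicative section τ. The law τ 0 ≈ 0 is absent because [ 0 ] differs from 0 in ℤ[F].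
record FrobeniusRing {c ℓ₁ ℓ₂ Q} (F : FiniteField c ℓ₁ ℓ₂ Q) (p : ℕ) : Set (lsuc 0ℓ ⊔ c ⊔ ℓ₁) where
  private
    module F = FiniteField F
  field
    R : CommutativeRing 0ℓ 0ℓ
  open CommutativeRing R using (_≈_; _+_; _*_; -_; 0#; 1#; semiring; commutativeSemiring) renaming (Carrier to A)
  open Exp commutativeSemiring using (_^_)
  open Mult semiring using () renaming (_×_ to _·_)
  field
    π       : A → F.Carrier
    π-cong  : ∀ {x y} → x ≈ y → π x F.≈ π y
    π-+     : ∀ x y → π (x + y) F.≈ π x F.+ π y
    π-*     : ∀ x y → π (x * y) F.≈ π x F.* π y
    π-neg   : ∀ x → π (- x) F.≈ F.- π x
    π-0     : π 0# F.≈ F.0#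
    π-1     : π 1# F.≈ F.1#
    τ       : F.Carrier → A
    τ-cong  : ∀ {x y} → x F.≈ y → τ x ≈ τ y
    τ-*     : ∀ x y → τ (x F.* y) ≈ τ x * τ y
    τ-1     : τ F.1# ≈ 1#
    π-τ     : ∀ x → π (τ x) F.≈ x
    φ       : A → A
    φ-cong  : ∀ {x y} → x ≈ y → φ x ≈ φ y
    φ-+     : ∀ x y → φ (x + y) ≈ φ x + φ y
    φ-*     : ∀ x y → φ (x * y) ≈ φ x * φ y
    φ-0     : φ 0# ≈ 0#
    φ-1     : φ 1# ≈ 1#
    δ       : ∀ x → ∃ λ d → φ x ≈ x ^ p + p · d
    torsion-free : ∀ x y → p · x ≈ p · y → x ≈ y

frobeniusRing : ∀ {c ℓ₁ ℓ₂ Q} (F : FiniteField c ℓ₁ ℓ₂ Q) p′ → Prime (suc p′) → FrobeniusRing F (suc p′)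
frobeniusRing F p′ pr = record
  { R = MR.ring
  ; π = π ; π-cong = ev-cong from ; π-+ = λ _ _ → F.refl ; π-* = π-* ; π-neg = λ _ → F.refl
  ; π-0 = F.refl ; π-1 = strictlyInverseʳ F.1#
  ; τ = λ x → [ to x ]
  ; τ-cong = λ e → CommutativeRing.reflexive MR.ring (cong [_] (to-cong e))
  ; τ-* = λ x y → CommutativeRing.reflexive MR.ring (cong [_] (to-cong (F.sym (F.*-cong (strictlyInverseʳ x) (strictlyInverseʳ y)))))
  ; τ-1 = CommutativeRing.refl MR.ring
  ; π-τ = strictlyInverseʳ
  ; φ = Φ.φ ; φ-cong = Φ.φ-cong
  ; φ-+ = λ _ _ → CommutativeRing.refl MR.ring
  ; φ-* = Φ.φ-⊗
  ; φ-0 = CommutativeRing.refl MR.ring ; φ-1 = Φ.φ-𝟙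
  ; δ = MR.FrobeniusLift.δ p′ pr ; torsion-free = MR.torsion-free (suc p′) }
  where
  module F = FiniteField F
  open Inverse F.enumeration using (to; from; to-cong; strictlyInverseˡ; strictlyInverseʳ)
  infixl 7 _∙_
  _∙_ : Fin _ → Fin _ → Fin _
  i ∙ j = to (from i F.* from j)
  ∙-assoc : ∀ i j k → (i ∙ j) ∙ k ≡ i ∙ (j ∙ k)
  ∙-assoc i j k = to-cong (F.trans (F.*-congʳ (strictlyInverseʳ _))
    (F.trans (F.*-assoc _ _ _) (F.*-congˡ (F.sym (strictlyInverseʳ _)))))
  ∙-comm : ∀ i j → i ∙ j ≡ j ∙ i
  ∙-comm i j = to-cong (F.*-comm _ _)
  ∙-identityˡ : ∀ i → to F.1# ∙ i ≡ i
  ∙-identityˡ i = ≡.trans (to-cong (F.trans (F.*-congʳ (strictlyInverseʳ F.1#)) (F.*-identityˡ _))) (strictlyInverseˡ i)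
  module MR = MonoidRing _∙_ (to F.1#) ∙-assoc ∙-comm ∙-identityˡ
  module Φ = MR.Power (suc p′)
  open MR using (Formal; [_]; 𝟘; _⊕_; ⊖_; _⊗_; bind)
  open MR.Evaluation F.+-abelianGroup using (ev; ev-cong)
  open RingProperties (CommutativeRing.ring F.commutativeRing) using (-‿distribˡ-*; -‿distribʳ-*)

  π : Formal → F.Carrier
  π = ev from

  π-* : ∀ x y → π (x ⊗ y) F.≈ π x F.* π y
  π-* [ a ] y = scale y
    where
    scale : ∀ y → π (bind y λ b → [ a ∙ b ]) F.≈ from a F.* π y
    scale [ b ]   = strictlyInverseʳ _
    scale 𝟘       = F.sym (F.zeroʳ _)
    scale (y ⊕ z) = F.trans (F.+-cong (scale y) (scale z)) (F.sym (F.distribˡ _ _ _))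
    scale (⊖ y)   = F.trans (F.-‿cong (scale y)) (-‿distribʳ-* _ _)
  π-* 𝟘       y = F.sym (F.zeroˡ _)
  π-* (x ⊕ z) y = F.trans (F.+-cong (π-* x y) (π-* z y)) (F.sym (F.distribʳ _ _ _))
  π-* (⊖ x)   y = F.trans (F.-‿cong (π-* x y)) (-‿distribˡ-* _ _)

-- Divisibility of N through moments of the lifted equation.

module Lifting {c ℓ₁ ℓ₂ Q} (F : FiniteField c ℓ₁ ℓ₂ Q) (p′ n : ℕ) .{{_ : NonZero n}}
               (pr : Prime (suc p′)) (Q≡p^n : Q ≡ suc p′ ℕ.^ n) (W : FrobeniusRing F (suc p′)) where
  private
    module F where
      open FiniteField F hiding (zero) public
      open Exp commutativeSemiring public
    p = suc p′
  open F using (Carrier)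
  open FieldProperties F
  open Characteristic p′ n pr Q≡p^n
  open Inverse F.enumeration using (from)
  open FrobeniusRing W
  open CommutativeRing R hiding (zero) renaming (Carrier to A)

  open Filtration.Kernel R F.commutativeRing π π-cong π-+ π-* π-0 π-1 p′ pr p·1≈0 ·1≈0⇒∣
  open Delta φ φ-cong φ-+ φ-* φ-0 φ-1 δ torsion-free using (integer∈I)

  open Exp commutativeSemiring
  open Mult semiring using () renaming (_×_ to _·_; ×-congʳ to ·-congʳ;
    ×-assoc-* to ·-assoc-*; ×-comm-* to ·-comm-*)
  open RingProperties (CommutativeRing.ring R) using (-‿distribˡ-*)
  open Sum semiring using (sum; sum-cong-≋; *-distribˡ-sum; *-distribʳ-sum)
  open Summation +-commutativeMonoid

  τ-^ : ∀ x m → τ x ^ m ≈ τ (x F.^ m)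
  τ-^ x zero    = sym τ-1
  τ-^ x (suc m) = trans (*-congˡ (τ-^ x m)) (sym (τ-* x (x F.^ m)))

  π-^ : ∀ x m → π (x ^ m) F.≈ π x F.^ m
  π-^ x zero    = π-1
  π-^ x (suc m) = F.trans (π-* x (x ^ m)) (F.*-congˡ (π-^ x m))

  I-Σ : ∀ {v} φ → (∀ x → I v (φ x)) → I v (Σ φ)
  I-Σ φ h = I-sum (φ ∘ from) (h ∘ from)

  I-Σ^ : ∀ {v} k φ → (∀ x → I v (φ x)) → I v (Σ^ k φ)
  I-Σ^ zero    φ h = h []
  I-Σ^ (suc k) φ h = I-Σ _ λ x → I-Σ^ k _ λ v → h (x ∷ v)

  Σ-*ˡ : ∀ z φ → z * Σ φ ≈ Σ (λ x → z * φ x)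
  Σ-*ˡ z φ = *-distribˡ-sum z (φ ∘ from)

  Σ-*ʳ : ∀ z φ → Σ φ * z ≈ Σ (λ x → φ x * z)
  Σ-*ʳ z φ = *-distribʳ-sum z (φ ∘ from)

  Σ^-*ˡ : ∀ k z φ → z * Σ^ k φ ≈ Σ^ k (λ x → z * φ x)
  Σ^-*ˡ zero    z φ = refl
  Σ^-*ˡ (suc k) z φ = trans (Σ-*ˡ z (λ x → Σ^ k (λ v → φ (x ∷ v)))) (Σ-cong λ x → Σ^-*ˡ k z (λ v → φ (x ∷ v)))

  Σ^-· : ∀ k m φ → m · Σ^ k φ ≈ Σ^ k (λ x → m · φ x)
  Σ^-· k m φ = trans (1· (Σ^ k φ)) (trans (Σ^-*ˡ k (m · 1#) φ) (Σ^-cong k λ v → sym (1· (φ v))))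
    where
    1· : ∀ x → m · x ≈ (m · 1#) * x
    1· x = trans (·-congʳ m (sym (*-identityˡ x))) (sym (·-assoc-* m 1# x))

  powerSum : ℕ → A
  powerSum b = Σ λ x → τ (x F.^ b)

  -- All Q = p ^ n summands are τ 1, and p lies in I. This is the gain that `zeros` records.
  powerSum-0 : I n (powerSum 0)
  powerSum-0 = resp (sym (Σ-const (τ F.1#))) (subst (λ k → I k (Q · τ F.1#)) (ℕ.+-identityʳ n)
    (I-∣· (subst (p ℕ.^ n ∣_) (≡.sym Q≡p^n) ∣-refl) (all {x = τ F.1#})))

  -- Scaling by an x with x ^ b ≠ 1 gives w S ≈ 0#, but w is invertible only modulo I. If u inverts
  -- its image in F, then a = 1 - τ u w lies in I and a S ≈ S, so S lies in every power of I. It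
  -- need not be zero: for three elements and b = 1 it is [ 0 ] + [ 1 ] + [ 2 ].
  powerSum-∤ : ∀ b → ¬ Q ℕ.∸ 1 ∣ b → ∀ v → I v (powerSum b)
  powerSum-∤ b Q′∤b = vanish
    where
    open SetoidReasoning setoid
    S = powerSum b
    x = proj₁ (some-power≉1 b Q′∤b)
    x≉0 = proj₁ (proj₂ (some-power≉1 b Q′∤b))
    x^b≉1 = proj₂ (proj₂ (some-power≉1 b Q′∤b))
    u-inv = invertible (x F.^ b F.- F.1#) (λ e → x^b≉1 (x∙y⁻¹≈ε⇒x≈y _ _ e))
      where open import Algebra.Properties.Group F.+-group using (x∙y⁻¹≈ε⇒x≈y)
    u = proj₁ u-inv
    w = τ (x F.^ b) - 1#
    invariant : τ (x F.^ b) * S ≈ S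
    invariant = trans (Σ-*ˡ (τ (x F.^ b)) (λ y → τ (y F.^ b)))
      (trans (Σ-cong λ y → trans (sym (τ-* (x F.^ b) (y F.^ b))) (τ-cong (F.sym (F.^-distrib-* x y b))))
        (Σ-scale (λ y → τ (y F.^ b)) (λ e → τ-cong (F.^-congˡ b e)) x≉0))
    wS≈0 : w * S ≈ 0#
    wS≈0 = trans (distribʳ S (τ (x F.^ b)) (- 1#)) (trans (+-cong invariant
      (trans (sym (-‿distribˡ-* 1# S)) (-‿cong (*-identityˡ S)))) (-‿inverseʳ S))
    a = 1# - τ u * w
    a∈I : I 1 a
    a∈I = ker⇒I (F.trans (π-+ 1# _) (F.trans (F.+-cong π-1 (F.trans (π-neg _) (F.-‿cong (F.trans (π-* (τ u) w)
      (F.trans (F.*-cong (π-τ u) (F.trans (π-+ _ _) (F.+-cong (π-τ _) (F.trans (π-neg 1#) (F.-‿cong π-1)))))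
        (F.trans (F.*-comm u _) (proj₂ u-inv))))))) (F.-‿inverseʳ F.1#)))
    aS≈S : a * S ≈ S
    aS≈S = begin
      (1# - τ u * w) * S          ≈⟨ distribʳ S 1# (- (τ u * w)) ⟩
      1# * S + - (τ u * w) * S    ≈⟨ +-cong (*-identityˡ S) (trans (sym (-‿distribˡ-* (τ u * w) S))
              (-‿cong (trans (*-assoc (τ u) w S) (trans (*-congˡ {x = τ u} wS≈0) (zeroʳ (τ u)))))) ⟩
      S + - 0#                    ≈⟨ +-congˡ (sym (trans (sym (-‿inverseˡ 0#)) (+-identityʳ (- 0#)))) ⟩
      S + 0#                      ≈⟨ +-identityʳ S ⟩
      S                           ∎
    vanish : ∀ v → I v S
    vanish zero    = all
    vanish (suc v) = resp aS≈S (I-prod a∈I (vanish v))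

  Term : ℕ → Set c
  Term k = Carrier × Vec ℕ k

  mono : ∀ {k} → Vec ℕ k → Vec Carrier k → Carrier
  mono = monomial F

  open Weights
  open Digits p′ pr hiding (p)
  open Rotation n
  open Degrees p′ pr n

  Q′≡ : Q ℕ.∸ 1 ≡ Q′
  Q′≡ = cong (ℕ._∸ 1) Q≡p^n

  monomialSum : ∀ {k} → Vec ℕ k → A
  monomialSum {k} β = Σ^ k λ x → τ (mono β x)

  monomialSum-∷ : ∀ {k} b (β : Vec ℕ k) → monomialSum (b ∷ β) ≈ powerSum b * monomialSum β
  monomialSum-∷ {k} b β = trans (Σ-cong λ y → trans
      (Σ^-cong k λ v → τ-* (y F.^ b) (mono β v)) (sym (Σ^-*ˡ k (τ (y F.^ b)) (λ v → τ (mono β v)))))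
    (sym (Σ-*ʳ (monomialSum β) (λ y → τ (y F.^ b))))

  monomialSum∈I : ∀ {k} (β : Vec ℕ k) → I (n ℕ.* zeros β) (monomialSum β)
  monomialSum∈I []      = subst (λ z → I z (monomialSum [])) (≡.sym (ℕ.*-zeroʳ n)) all
  monomialSum∈I (b ∷ β) = resp (sym (monomialSum-∷ b β)) (coordinate∈I b)
    where
    coordinate∈I : ∀ b → I (n ℕ.* zeros (b ∷ β)) (powerSum b * monomialSum β)
    coordinate∈I zero    = subst (λ z → I z (powerSum 0 * monomialSum β)) (≡.sym (ℕ.*-suc n (zeros β)))
      (I-prod powerSum-0 (monomialSum∈I β))
    coordinate∈I (suc b) = I-*ˡ (powerSum (suc b)) (monomialSum∈I β)

  -- The sum is a product of power sums, one for each variable, so a single exponent not divisible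
  -- by Q′ puts it into every power of I.
  monomialSum-dichotomy : ∀ {k} (β : Vec ℕ k) → (∀ i → Q′ ∣ Vec.lookup β i) ⊎ (∀ v → I v (monomialSum β))
  monomialSum-dichotomy []      = inj₁ λ ()
  monomialSum-dichotomy (b ∷ β) with (Q ℕ.∸ 1) ∣? b | monomialSum-dichotomy β
  ... | no  Q′∤b | _      = inj₂ λ v → resp (sym (monomialSum-∷ b β)) (I-*ʳ (monomialSum β) (powerSum-∤ b Q′∤b v))
  ... | yes _    | inj₂ h = inj₂ λ v → resp (sym (monomialSum-∷ b β)) (I-*ˡ (powerSum b) (h v))
  ... | yes Q′∣b | inj₁ h = inj₁ λ { zero → subst (_∣ b) Q′≡ Q′∣b ; (suc i) → h i }

  lift : ∀ {k} → List (Term k) → Vec Carrier k → A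
  lift []            x = 0#
  lift ((a , α) ∷ L) x = τ (a F.* mono α x) + lift L x

  infixl 6 _⊞_
  infixl 7 _⊛_
  _⊞_ : ∀ {k} → Vec ℕ k → Vec ℕ k → Vec ℕ k
  _⊞_ = Vec.zipWith ℕ._+_

  _⊛_ : ∀ {k} → ℕ → Vec ℕ k → Vec ℕ k
  m ⊛ α = Vec.map (m ℕ.*_) α

  -- p′ * t < p′ * (1 + r) with p′ > 0 says t ≤ r; stating the bound on t in this
  -- form avoids dividing the digit sums by p′.
  Bound : ∀ {k} → List (Term k) → ℕ → Vec ℕ k → ℕ → Set
  Bound {k} L M β t = ∀ (ps : List (ℕ × Vec ℕ k)) → map proj₂ ps ≡ map proj₂ L → weights (λ r → r) ps ≡ M →
    (∀ i → Q′ ∣ Vec.lookup (β ⊞ combination ps) i) →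
    p′ ℕ.* t ℕ.+ s M ℕ.< weights s ps ℕ.+ p′ ℕ.* suc (n ℕ.* zeros (β ⊞ combination ps))

  -- β collects the exponents of terms already split off; with it, the multinomial expansion becomes
  -- an induction over the list L using the binomial theorem alone.
  powerMoment : ∀ {k} → List (Term k) → ℕ → Vec ℕ k → A
  powerMoment {k} L M β = Σ^ k λ x → τ (mono β x) * lift L x ^ M

  mono-⊞ : ∀ {k} i (β α : Vec ℕ k) x → mono β x F.* mono α x F.^ i F.≈ mono (β ⊞ i ⊛ α) x
  mono-⊞ i []      []      []      = F.trans (F.*-identityˡ _) (1^ i)
  mono-⊞ i (b ∷ β) (a ∷ α) (y ∷ x) = begin
    y F.^ b F.* mono β x F.* (y F.^ a F.* mono α x) F.^ i
      ≈⟨ F.*-congˡ (F.^-distrib-* (y F.^ a) (mono α x) i) ⟩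
    y F.^ b F.* mono β x F.* ((y F.^ a) F.^ i F.* mono α x F.^ i)
      ≈⟨ interchange _ _ _ _ ⟩
    y F.^ b F.* (y F.^ a) F.^ i F.* (mono β x F.* mono α x F.^ i)
      ≈⟨ F.*-cong (F.trans (F.*-congˡ (F.trans (F.^-assocʳ y a i) (F.^-congʳ y (ℕ.*-comm a i)))) (F.sym (F.^-homo-* y b (i ℕ.* a))))
           (mono-⊞ i β α x) ⟩
    y F.^ (b ℕ.+ i ℕ.* a) F.* mono (β ⊞ i ⊛ α) x ∎
    where
    open SetoidReasoning F.setoid
    open import Algebra.Properties.CommutativeSemigroup F.*-commutativeSemigroup using (interchange)

  powerMoment-∷ : ∀ {k} a (α : Vec ℕ k) L M β →
    powerMoment ((a , α) ∷ L) M β ≈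
    sum {suc M} (λ i → (M C toℕ i) · (τ (a F.^ toℕ i) * powerMoment L (M ℕ.∸ toℕ i) (β ⊞ toℕ i ⊛ α)))
  powerMoment-∷ {k} a α L M β = begin
    powerMoment ((a , α) ∷ L) M β
      ≈⟨ Σ^-cong k (λ x → trans (*-congˡ {x = τ (mono β x)} (Binomial.theorem commutativeSemiring M (τ (a F.* mono α x)) (lift L x)))
           (trans (*-distribˡ-sum (τ (mono β x)) (terms x)) (sum-cong-≋ (expand x)))) ⟩
    Σ^ k (λ x → sum (terms′ x))
      ≈⟨ Σ^-sum k terms′ ⟩
    sum {suc M} (λ i → Σ^ k λ x → terms′ x i)
      ≈⟨ sum-cong-≋ {suc M} (λ i → trans (sym (Σ^-· k (M C toℕ i) (λ x → τ (a F.^ toℕ i) * (τ (mono (β ⊞ toℕ i ⊛ α) x) * lift L x ^ (M ℕ.∸ toℕ i)))))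
           (·-congʳ (M C toℕ i) (sym (Σ^-*ˡ k (τ (a F.^ toℕ i)) (λ x → τ (mono (β ⊞ toℕ i ⊛ α) x) * lift L x ^ (M ℕ.∸ toℕ i)))))) ⟩
    _ ∎
    where
    open SetoidReasoning setoid
    terms terms′ : Vec Carrier k → Fin (suc M) → A
    terms x i = (M C toℕ i) · (τ (a F.* mono α x) ^ toℕ i * lift L x ^ (M ℕ.∸ toℕ i))
    terms′ x i = (M C toℕ i) · (τ (a F.^ toℕ i) * (τ (mono (β ⊞ toℕ i ⊛ α) x) * lift L x ^ (M ℕ.∸ toℕ i)))
    rearrange : ∀ x i → mono β x F.* (a F.* mono α x) F.^ i F.≈ a F.^ i F.* mono (β ⊞ i ⊛ α) x
    rearrange x i = F.trans (F.*-congˡ (F.^-distrib-* a (mono α x) i)) (F.trans (x∙yz≈y∙xz _ _ _) (F.*-congˡ (mono-⊞ i β α x)))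
      where open import Algebra.Properties.CommutativeSemigroup F.*-commutativeSemigroup using (x∙yz≈y∙xz)
    expand : ∀ x i → τ (mono β x) * terms x i ≈ terms′ x i
    expand x i = trans (·-comm-* (M C toℕ i) (τ (mono β x)) _) (·-congʳ (M C toℕ i) (let Z = lift L x ^ (M ℕ.∸ toℕ i) in begin
      τ (mono β x) * (τ (a F.* mono α x) ^ toℕ i * Z)        ≈⟨ *-assoc (τ (mono β x)) _ Z ⟨
      τ (mono β x) * τ (a F.* mono α x) ^ toℕ i * Z          ≈⟨ *-congʳ {x = Z} (trans (*-congˡ {x = τ (mono β x)} (τ-^ (a F.* mono α x) (toℕ i)))
              (trans (sym (τ-* _ _)) (trans (τ-cong (rearrange x (toℕ i))) (τ-* _ _)))) ⟩
      τ (a F.^ toℕ i) * τ (mono (β ⊞ toℕ i ⊛ α) x) * Z   ≈⟨ *-assoc (τ (a F.^ toℕ i)) _ Z ⟩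
      τ (a F.^ toℕ i) * (τ (mono (β ⊞ toℕ i ⊛ α) x) * Z) ∎))

  -- Splitting off one term with multiplicity i yields a binomial coefficient divisible by p ^ v,
  -- leaving t - v to be found in the tail. The equation of `C-valuation` is exactly what carries
  -- `Bound` over to the tail.
  powerMoment∈I : ∀ {k} (L : List (Term k)) M β t → Bound L M β t → I t (powerMoment L M β)
  powerMoment∈I {k} [] zero β t bound = resp (Σ^-cong k λ x → sym (*-identityʳ (τ (mono β x)))) (base (monomialSum-dichotomy β))
    where
    β⊞0 : β ⊞ origin k ≡ β
    β⊞0 = Vec.zipWith-identityʳ ℕ.+-identityʳ β
    base : _ ⊎ _ → I t (monomialSum β)
    base (inj₂ h) = h t
    -- With no terms left, `Bound` reads p′ t < p′ (1 + n z), that is t ≤ n z, where z counts the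
    -- zero exponents of β.
    base (inj₁ h) = I-mono (ℕ.≤-pred (ℕ.*-cancelˡ-< p′ _ _ (subst (ℕ._< p′ ℕ.* suc (n ℕ.* zeros β)) (ℕ.+-identityʳ (p′ ℕ.* t))
      (subst (λ γ → p′ ℕ.* t ℕ.+ 0 ℕ.< p′ ℕ.* suc (n ℕ.* zeros γ)) β⊞0
        (bound [] ≡.refl ≡.refl (λ i → subst (λ γ → Q′ ∣ Vec.lookup γ i) (≡.sym β⊞0) (h i)))))))
      (monomialSum∈I β)
  powerMoment∈I {k} [] (suc M) β t bound = resp (sym (trans (Σ^-cong k λ x → trans (*-congˡ {x = τ (mono β x)} (zeroˡ (0# ^ M))) (zeroʳ (τ (mono β x)))) (Σ^-ε k))) (I-0 t)
  powerMoment∈I {k} ((a , α) ∷ L) M β t bound = resp (sym (powerMoment-∷ a α L M β)) (I-sum {t} {suc M} _ term)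
    where
    term : ∀ (i : Fin (suc M)) → I t ((M C toℕ i) · (τ (a F.^ toℕ i) * powerMoment L (M ℕ.∸ toℕ i) (β ⊞ toℕ i ⊛ α)))
    term i′ = case-v (ℕ.≤-total v t)
      where
      i = toℕ i′
      j = M ℕ.∸ i
      i+j≡M : i ℕ.+ j ≡ M
      i+j≡M = ℕ.m+[n∸m]≡n (ℕ.≤-pred (Fin.toℕ<n i′))
      v = proj₁ (C-valuation i j)
      p^v∣C : p ℕ.^ v ∣ (M C i)
      p^v∣C = subst (λ m → p ℕ.^ v ∣ (m C i)) i+j≡M (proj₁ (proj₂ (C-valuation i j)))
      v-eq : p′ ℕ.* v ℕ.+ s M ≡ s i ℕ.+ s j
      v-eq = subst (λ m → p′ ℕ.* v ℕ.+ s m ≡ s i ℕ.+ s j) i+j≡M (proj₂ (proj₂ (C-valuation i j)))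
      bound′ : v ℕ.≤ t → Bound L j (β ⊞ i ⊛ α) (t ℕ.∸ v)
      bound′ v≤t ps shape weight div = ℕ.+-cancelˡ-< (s i) _ _ (subst₂ ℕ._<_ lhs (ℕ.+-assoc (s i) _ _) whole)
        where
        subst₂ = ≡.subst₂
        assoc : β ⊞ i ⊛ α ⊞ combination ps ≡ β ⊞ (i ⊛ α ⊞ combination ps)
        assoc = Vec.zipWith-assoc ℕ.+-assoc β (i ⊛ α) (combination ps)
        z = zeros (β ⊞ i ⊛ α ⊞ combination ps)
        whole : p′ ℕ.* t ℕ.+ s M ℕ.< s i ℕ.+ weights s ps ℕ.+ p′ ℕ.* suc (n ℕ.* z)
        whole = subst (λ γ → p′ ℕ.* t ℕ.+ s M ℕ.< s i ℕ.+ weights s ps ℕ.+ p′ ℕ.* suc (n ℕ.* zeros γ)) (≡.sym assoc)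
          (bound ((i , α) ∷ ps) (cong (α ∷_) shape) (≡.trans (cong (i ℕ.+_) weight) i+j≡M)
            (λ t → subst (λ γ → Q′ ∣ Vec.lookup γ t) assoc (div t)))
        lem : ∀ p t v m → p ℕ.* (v ℕ.+ t) ℕ.+ m ≡ p ℕ.* t ℕ.+ (p ℕ.* v ℕ.+ m)
        lem = solve-∀
        lem₂ : ∀ a b c → a ℕ.+ (b ℕ.+ c) ≡ b ℕ.+ (a ℕ.+ c)
        lem₂ = solve-∀
        lhs : p′ ℕ.* t ℕ.+ s M ≡ s i ℕ.+ (p′ ℕ.* (t ℕ.∸ v) ℕ.+ s j)
        lhs = ≡.trans (cong (λ x → p′ ℕ.* x ℕ.+ s M) (≡.sym (ℕ.m+[n∸m]≡n v≤t)))
          (≡.trans (lem p′ (t ℕ.∸ v) v (s M)) (≡.trans (cong (p′ ℕ.* (t ℕ.∸ v) ℕ.+_) v-eq) (lem₂ (p′ ℕ.* (t ℕ.∸ v)) (s i) (s j))))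
      case-v : v ℕ.≤ t ⊎ t ℕ.≤ v → _
      case-v (inj₁ v≤t) = subst (λ m → I m _) (ℕ.m+[n∸m]≡n v≤t)
        (I-∣· p^v∣C (I-*ˡ (τ (a F.^ i)) (powerMoment∈I L j _ (t ℕ.∸ v) (bound′ v≤t))))
      -- Here the binomial coefficient alone is divisible enough.
      case-v (inj₂ t≤v) = I-mono (ℕ.≤-trans t≤v (ℕ.m≤m+n v 0)) (I-∣· p^v∣C all)

  evalTerms : ∀ {k} → List (Term k) → Vec Carrier k → Carrier
  evalTerms = eval F

  π-lift : ∀ {k} (L : List (Term k)) x → π (lift L x) F.≈ evalTerms L x
  π-lift []            x = π-0
  π-lift ((a , α) ∷ L) x = F.trans (π-+ _ _) (F.+-cong (π-τ _) (π-lift L x))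

  indicator : ∀ {ℓ} {P : Set ℓ} → Dec P → A
  indicator P? = if does P? then 1# else 0#

  Exponent : ℕ → ℕ
  Exponent V = Q′ ℕ.* p ℕ.^ V

  V≤Exponent : ∀ V → V ℕ.≤ Exponent V
  V≤Exponent V = ℕ.≤-trans (below V) (ℕ.m≤n*m (p ℕ.^ V) Q′ {{Q′≢0}})
    where
    below : ∀ V → V ℕ.≤ p ℕ.^ V
    below zero    = z≤n
    below (suc V) = ℕ.≤-trans (s≤s (below V)) (ℕ.≤-trans (ℕ.+-monoˡ-≤ (p ℕ.^ V) (ℕ.m^n>0 p V))
      (ℕ.≤-trans (ℕ.≤-reflexive (≡.sym (cong (p ℕ.^ V ℕ.+_) (ℕ.+-identityʳ (p ℕ.^ V))))) (ℕ.*-monoˡ-≤ (p ℕ.^ V) 2≤p)))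

  -- At a zero the lift lies in I and the exponent is at least V. Elsewhere the factor Q′ of the
  -- exponent brings the lift into 1 + I by Fermat, and the factor p ^ V takes it on into 1 + I ^ (V
  -- + 1).
  indicator-lift : ∀ {ℓ k} {P : Set ℓ} (P? : Dec P) V (L : List (Term k)) x →
    (P → evalTerms L x F.≈ F.0#) → (evalTerms L x F.≈ F.0# → P) →
    I V (indicator P? + lift L x ^ Exponent V - 1#)
  indicator-lift (yes pr) V L x zero⇒ ⇒zero = resp (sym (trans (+-congʳ (+-comm 1# _))
      (trans (+-assoc _ 1# (- 1#)) (trans (+-congˡ (-‿inverseʳ 1#)) (+-identityʳ _)))))
    (I-mono (V≤Exponent V) (I-^ (ker⇒I (F.trans (π-lift L x) (zero⇒ pr))) (Exponent V)))
  indicator-lift (no ¬pr) V L x zero⇒ ⇒zero = resp (sym (trans (+-congʳ (trans (+-identityˡ _)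
      (trans (sym (^-assocʳ (lift L x) Q′ (p ℕ.^ V))) (proj₁ (proj₂ near-1)))))
      (trans (+-assoc _ 1# (- 1#)) (trans (+-congˡ (-‿inverseʳ 1#)) (+-identityʳ _)))))
    (I-mono (ℕ.n≤1+n V) (proj₂ (proj₂ near-1)))
    where
    near-1 = 1+I-^p^ {lift L x ^ Q′} (F.trans (π-^ (lift L x) Q′) (F.trans (F.^-congˡ Q′ (π-lift L x))
      (F.trans (F.^-congʳ (evalTerms L x) (≡.sym Q′≡)) (fermat (¬pr ∘ ⇒zero))))) V

  -- Variables (y , x); the terms of f (x) - (y ^ q - y).
  equation : ∀ {k} → ℕ → List (Term k) → List (Term (suc k))
  equation {k} q f = (F.- F.1# , q ∷ origin k) ∷ (F.1# , 1 ∷ origin k) ∷ map (λ (a , α) → a , 0 ∷ α) f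

  mono-0 : ∀ {k} (x : Vec Carrier k) → mono (origin k) x F.≈ F.1#
  mono-0 []      = F.refl
  mono-0 (y ∷ x) = F.trans (F.*-identityˡ _) (mono-0 x)

  evalTerms-∷ : ∀ {k} (f : List (Term k)) y x → evalTerms (map (λ (a , α) → a , 0 ∷ α) f) (y ∷ x) F.≈ evalTerms f x
  evalTerms-∷ []            y x = F.refl
  evalTerms-∷ ((a , α) ∷ f) y x = F.+-cong (F.*-congˡ (F.*-identityˡ _)) (evalTerms-∷ f y x)

  evalTerms-equation : ∀ {k} q (f : List (Term k)) y x →
    evalTerms (equation q f) (y ∷ x) F.≈ evalTerms f x F.- (y F.^ q F.- y)
  evalTerms-equation q f y x = begin
    F.- F.1# F.* (y F.^ q F.* mono (origin _) x) F.+ (F.1# F.* (y F.^ 1 F.* mono (origin _) x) F.+ evalTerms (map _ f) (y ∷ x))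
      ≈⟨ F.+-cong (F.trans (FR.-1*x≈-x _) (F.-‿cong (F.trans (F.*-congˡ (mono-0 x)) (F.*-identityʳ _))))
           (F.+-cong (F.trans (F.*-identityˡ _) (F.trans (F.*-congˡ (mono-0 x)) (F.trans (F.*-identityʳ _) (F.*-identityʳ y)))) (evalTerms-∷ f y x)) ⟩
    F.- (y F.^ q) F.+ (y F.+ evalTerms f x)
      ≈⟨ F.+-assoc _ _ _ ⟨
    F.- (y F.^ q) F.+ y F.+ evalTerms f x
      ≈⟨ F.+-comm _ _ ⟩
    evalTerms f x F.+ (F.- (y F.^ q) F.+ y)
      ≈⟨ F.+-congˡ (F.+-congˡ (FR.-‿involutive y)) ⟨
    evalTerms f x F.+ (F.- (y F.^ q) F.+ F.- (F.- y))
      ≈⟨ F.+-congˡ (FR.-‿+-comm _ _) ⟩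
    evalTerms f x F.- (y F.^ q F.- y) ∎
    where
    open SetoidReasoning F.setoid
    module FR = RingProperties (CommutativeRing.ring F.commutativeRing)

  N-indicator : ∀ {k} q (f : Polynomial F k) →
    N F q f · 1# ≈ Σ^ k λ x → Σ λ y → indicator (evalTerms f x F.≟ (y F.^ q F.- y))
  N-indicator {k} q f = Σᴸ-count k (λ (x , y) → evalTerms f x F.≟ (y F.^ q F.- y)) 1#

  I-cancel : ∀ {v x y} → I v (x + y) → I v y → I v x
  I-cancel {x = x} {y} i j = resp (trans (+-assoc x y (- y)) (trans (+-congˡ (-‿inverseʳ y)) (+-identityʳ x))) (add i (I-neg j))

  Σ^-1∈I : ∀ k → I (n ℕ.* k) (Σ^ k λ _ → 1#)
  Σ^-1∈I k = resp (Σ^-cong k λ x → trans (τ-cong (mono-0 x)) τ-1)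
    (subst (λ z → I (n ℕ.* z) (monomialSum (origin k))) (zeros-origin k) (monomialSum∈I (origin k)))
    where
    zeros-origin : ∀ k → zeros (origin k) ≡ k
    zeros-origin zero    = ≡.refl
    zeros-origin (suc k) = cong suc (zeros-origin k)

  divisibility : ∀ {k} q (f : Polynomial F k) V → V ℕ.≤ n ℕ.* suc k →
    Bound (equation q f) (Exponent V) (origin (suc k)) V → p ℕ.^ V ∣ N F q f
  divisibility {k} q f V V≤ bound = integer∈I V (N F q f) (resp (sym (trans (N-indicator q f) (Σ^-Σ k ind)))
    (I-cancel {y = Z} (I-cancel {y = - total} whole (I-neg (I-mono V≤ (Σ^-1∈I (suc k)))))
      (resp (Σ^-cong (suc k) {ψ = λ v → lift (equation q f) v ^ Exponent V} λ v → trans (*-congʳ (trans (τ-cong (mono-0 v)) τ-1)) (*-identityˡ _))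
        (powerMoment∈I (equation q f) (Exponent V) (origin (suc k)) V bound))))
    where
    ind : Vec Carrier k → Carrier → A
    ind x y = indicator (evalTerms f x F.≟ (y F.^ q F.- y))
    ind′ : Vec Carrier (suc k) → A
    ind′ (y ∷ x) = ind x y
    Z total : A
    Z = Σ^ (suc k) λ v → lift (equation q f) v ^ Exponent V
    total = Σ^ (suc k) λ _ → 1#
    pointwise : ∀ v → I V (ind′ v + lift (equation q f) v ^ Exponent V - 1#)
    pointwise (y ∷ x) = indicator-lift (evalTerms f x F.≟ (y F.^ q F.- y)) V (equation q f) (y ∷ x)
      (λ e → F.trans (evalTerms-equation q f y x) (F.trans (F.+-congʳ e) (F.-‿inverseʳ _)))
      (λ e → x∙y⁻¹≈ε⇒x≈y _ _ (F.trans (F.sym (evalTerms-equation q f y x)) e))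
      where open import Algebra.Properties.Group F.+-group using (x∙y⁻¹≈ε⇒x≈y)
    Σ^-neg : Σ^ (suc k) (λ _ → - 1#) ≈ - total
    Σ^-neg = trans (Σ^-cong (suc k) λ _ → sym (-1*x≈-x 1#)) (trans (sym (Σ^-*ˡ (suc k) (- 1#) (λ _ → 1#))) (-1*x≈-x total))
      where open RingProperties (CommutativeRing.ring R) using (-1*x≈-x)
    whole : I V (Σ^ (suc k) ind′ + Z - total)
    whole = resp (trans (Σ^-⊞ (suc k) (λ v → ind′ v + lift (equation q f) v ^ Exponent V) (λ _ → - 1#))
        (+-cong (Σ^-⊞ (suc k) ind′ (λ v → lift (equation q f) v ^ Exponent V)) Σ^-neg))
      (I-Σ^ (suc k) _ pointwise)

  shape-tail : ∀ {k} (f : List (Term k)) (ps : List (ℕ × Vec ℕ (suc k))) →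
    map proj₂ ps ≡ map proj₂ (map (λ (a , α) → a , 0 ∷ α) f) →
    ∃ λ ps′ → ps ≡ map (λ (r , α) → r , 0 ∷ α) ps′ × map proj₂ ps′ ≡ map proj₂ f
  shape-tail []            []                 _ = [] , ≡.refl , ≡.refl
  shape-tail ((a , α) ∷ f) ((r , β) ∷ ps) e with List.∷-injective e
  ... | ≡.refl , e′ with shape-tail f ps e′
  ... | ps′ , ≡.refl , e″ = (r , α) ∷ ps′ , ≡.refl , cong (α ∷_) e″

  weighted-0∷ : ∀ {k} w (ps : List (ℕ × Vec ℕ k)) →
    weighted w (map (λ (r , α) → r , 0 ∷ α) ps) ≡ 0 ∷ weighted w ps
  weighted-0∷ w []             = ≡.refl
  weighted-0∷ w ((r , α) ∷ ps) = ≡.trans (cong (Vec.zipWith ℕ._+_ (w r ℕ.* 0 ∷ w r ⊛ α)) (weighted-0∷ w ps))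
    (cong (λ x → x ℕ.+ 0 ∷ Vec.zipWith ℕ._+_ (w r ⊛ α) (weighted w ps)) (ℕ.*-zeroʳ (w r)))

  weights-0∷ : ∀ {k} w (ps : List (ℕ × Vec ℕ k)) →
    weights w (map (λ (r , α) → r , 0 ∷ α) ps) ≡ weights w ps
  weights-0∷ w []             = ≡.refl
  weights-0∷ w ((r , α) ∷ ps) = cong (w r ℕ.+_) (weights-0∷ w ps)

  allDegree-shape : ∀ {k d} (f : List (Term k)) (ps : List (ℕ × Vec ℕ k)) → map proj₂ ps ≡ map proj₂ f →
    AllDegree d f → AllDegree d ps
  allDegree-shape []      []       _ []           = []
  allDegree-shape (_ ∷ f) (_ ∷ ps) e (deg ∷ degs) with List.∷-injective e
  ... | e₁ , e₂ = ≡.trans (cong Vec.sum e₁) deg ∷ allDegree-shape f ps e₂ degs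

  module _ {k d D q′ g : ℕ} .{{_ : NonZero d}} .{{_ : NonZero g}} (e : ℕ) (q′D : q′ ℕ.* D ≡ Q′) (q≡ : p ℕ.^ e ≡ suc q′)
           (∣*g : ∀ R → D ∣ R ℕ.* d → D ∣ R ℕ.* g) where
    private
      q = p ℕ.^ e
      K = ⌈ g ℕ.* k / d ⌉
      V = ⌈ n ℕ.* K / g ⌉

    V≤n*k : V ℕ.≤ n ℕ.* k
    V≤n*k = Arithmetic.⌈/⌉-least {a = n ℕ.* K} {b = g} (ℕ.≤-trans (ℕ.*-monoʳ-≤ n
        (Arithmetic.⌈/⌉-least {a = g ℕ.* k} {b = d} (ℕ.m≤n*m (g ℕ.* k) d)))
      (ℕ.≤-reflexive (lem n g k)))
      where
      lem : ∀ a b c → a ℕ.* (b ℕ.* c) ≡ b ℕ.* (a ℕ.* c)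
      lem = solve-∀

    -- The outer ceiling costs nothing: g (V - 1) < n K gives p′ (V - 1) < X strictly, and the
    -- remaining p′ is the slack built into `Bound`. The case V = 0 is separate, as V - 1 is then no
    -- natural number.
    V-bound : ∀ {σ z} → p′ ℕ.* (n ℕ.* K) ℕ.≤ g ℕ.* (σ ℕ.+ p′ ℕ.* (n ℕ.* z)) →
              p′ ℕ.* V ℕ.< σ ℕ.+ p′ ℕ.* (n ℕ.* z) ℕ.+ p′
    V-bound {σ} {z} h = helper V ≡.refl
      where
      open ℕ.≤-Reasoning
      X = σ ℕ.+ p′ ℕ.* (n ℕ.* z)
      lem : ∀ a b c → a ℕ.* (b ℕ.* c) ≡ b ℕ.* (a ℕ.* c)
      lem = solve-∀
      helper : ∀ v → V ≡ v → p′ ℕ.* v ℕ.< X ℕ.+ p′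
      helper zero    _  = subst (ℕ._< X ℕ.+ p′) (≡.sym (ℕ.*-zeroʳ p′)) (ℕ.<-≤-trans 0<p′ (ℕ.m≤n+m p′ X))
      helper (suc v) V≡ = begin-strict
        p′ ℕ.* suc v        ≡⟨ ℕ.*-suc p′ v ⟩
        p′ ℕ.+ p′ ℕ.* v     ≡⟨ ℕ.+-comm p′ _ ⟩
        p′ ℕ.* v ℕ.+ p′     <⟨ ℕ.+-monoˡ-< p′ (ℕ.*-cancelˡ-< g _ _ (begin-strict
          g ℕ.* (p′ ℕ.* v)      ≡⟨ lem g p′ v ⟩
          p′ ℕ.* (g ℕ.* v)      <⟨ ℕ.*-monoʳ-< p′ (Arithmetic.⌈/⌉-pred {a = n ℕ.* K} {b = g} V≡) ⟩
          p′ ℕ.* (n ℕ.* K)      ≤⟨ h ⟩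
          g ℕ.* X               ∎)) ⟩
        X ℕ.+ p′            ∎

    -- The variable y yields n p′ in either case: by `pair-bound` through the digit sums of u and w,
    -- or, if q u + w = 0, through one more zero exponent.
    pair-part : ∀ u w → Q′ ∣ q ℕ.* u ℕ.+ w → ∀ (β : Vec ℕ k) →
      n ℕ.* p′ ℕ.+ p′ ℕ.* (n ℕ.* zeros β) ℕ.≤ s u ℕ.+ s w ℕ.+ p′ ℕ.* (n ℕ.* zeros (q ℕ.* u ℕ.+ w ∷ β))
    pair-part u w Q′∣ β = helper (q ℕ.* u ℕ.+ w) ≡.refl
      where
      lem : ∀ n p z → n ℕ.* p ℕ.+ p ℕ.* (n ℕ.* z) ≡ p ℕ.* (n ℕ.* suc z)
      lem = solve-∀
      helper : ∀ h → q ℕ.* u ℕ.+ w ≡ h →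
        n ℕ.* p′ ℕ.+ p′ ℕ.* (n ℕ.* zeros β) ℕ.≤ s u ℕ.+ s w ℕ.+ p′ ℕ.* (n ℕ.* zeros (h ∷ β))
      helper zero    _ = ℕ.≤-trans (ℕ.≤-reflexive (lem n p′ (zeros β))) (ℕ.m≤n+m _ (s u ℕ.+ s w))
      helper (suc h) e₀ = ℕ.+-monoˡ-≤ _ (pair-bound e u w Q′∣ λ e₁ → ℕ.1+n≢0 (≡.trans (≡.sym e₀) e₁))

    -- Modulo q′ one has q u + w ≡ u + w, while u + w + R is the whole exponent, a multiple of Q′
    -- and so of q′.
    q′∣remainder : ∀ {u w R} → Q′ ∣ q ℕ.* u ℕ.+ w → u ℕ.+ (w ℕ.+ R) ≡ Exponent V → q′ ∣ R
    q′∣remainder {u} {w} {R} Q′∣ e₀ = ∣m+n∣m⇒∣n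
      (subst (q′ ∣_) eq (∣m∣n⇒∣m+n (∣-trans q′∣Q′ (m∣m*n (p ℕ.^ V))) (m∣m*n u))) (∣-trans q′∣Q′ Q′∣)
      where
      q′∣Q′ : q′ ∣ Q′
      q′∣Q′ = divides D (≡.trans (≡.sym q′D) (ℕ.*-comm q′ D))
      lem : ∀ u w R x → u ℕ.+ (w ℕ.+ R) ℕ.+ x ℕ.* u ≡ suc x ℕ.* u ℕ.+ w ℕ.+ R
      lem = solve-∀
      eq : Exponent V ℕ.+ q′ ℕ.* u ≡ q ℕ.* u ℕ.+ w ℕ.+ R
      eq = ≡.trans (cong (ℕ._+ q′ ℕ.* u) (≡.sym e₀)) (≡.trans (lem u w R q′) (cong (λ x → x ℕ.* u ℕ.+ w ℕ.+ R) (≡.sym q≡)))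

    -- The two terms in y pay for the digit sum n p′ of the exponent by `pair-part`, and the terms
    -- of f pay for V by `degree-bound`.
    equation-bound : ∀ f → AllDegree d f → Bound (equation q f) (Exponent V) (origin (suc k)) V
    equation-bound f degs []            () weight div
    equation-bound f degs (_ ∷ [])      () weight div
    equation-bound f degs ((u , α) ∷ (w , β) ∷ ps) shape weight div with List.∷-injective shape
    ... | ≡.refl , shape₁ with List.∷-injective shape₁
    ... | ≡.refl , shape₂ with shape-tail f ps shape₂
    ... | ps′ , ≡.refl , shape₃ = ≡.subst₂ ℕ._<_
      (cong (p′ ℕ.* V ℕ.+_) (≡.sym (s-[p^n∸1]p^V n V)))
      (cong₂ (λ x γ → s u ℕ.+ (s w ℕ.+ x) ℕ.+ p′ ℕ.* suc (n ℕ.* zeros γ)) (≡.sym (weights-0∷ s ps′)) (≡.sym total≡))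
      (begin-strict
        p′ ℕ.* V ℕ.+ n ℕ.* p′
          <⟨ ℕ.+-monoˡ-< (n ℕ.* p′) (V-bound {σ} {z} (degree-bound q′D ∣*g (allDegree-shape f ps′ shape₃ degs) div-tail
               (q′∣remainder {u} {w} div-head (≡.trans (cong (λ x → u ℕ.+ (w ℕ.+ x)) (≡.sym (weights-0∷ (λ r → r) ps′))) weight)))) ⟩
        σ ℕ.+ p′ ℕ.* (n ℕ.* z) ℕ.+ p′ ℕ.+ n ℕ.* p′
          ≡⟨ lem₁ σ (p′ ℕ.* (n ℕ.* z)) p′ (n ℕ.* p′) ⟩
        σ ℕ.+ p′ ℕ.+ (n ℕ.* p′ ℕ.+ p′ ℕ.* (n ℕ.* z))
          ≤⟨ ℕ.+-monoʳ-≤ (σ ℕ.+ p′) (pair-part u w div-head (combination ps′)) ⟩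
        σ ℕ.+ p′ ℕ.+ (s u ℕ.+ s w ℕ.+ p′ ℕ.* (n ℕ.* zeros (h ∷ combination ps′)))
          ≡⟨ lem₂ σ p′ (s u) (s w) (n ℕ.* zeros (h ∷ combination ps′)) ⟩
        s u ℕ.+ (s w ℕ.+ σ) ℕ.+ p′ ℕ.* suc (n ℕ.* zeros (h ∷ combination ps′)) ∎)
      where
      open ℕ.≤-Reasoning
      σ = weights s ps′
      z = zeros (combination ps′)
      h = q ℕ.* u ℕ.+ w
      ps″ = (u , q ∷ origin k) ∷ (w , 1 ∷ origin k) ∷ map (λ (r , α) → r , 0 ∷ α) ps′
      lem₁ : ∀ a b c d → a ℕ.+ b ℕ.+ c ℕ.+ d ≡ a ℕ.+ c ℕ.+ (d ℕ.+ b)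
      lem₁ = solve-∀
      lem₂ : ∀ a p u w m → a ℕ.+ p ℕ.+ (u ℕ.+ w ℕ.+ p ℕ.* m) ≡ u ℕ.+ (w ℕ.+ a) ℕ.+ p ℕ.* suc m
      lem₂ = solve-∀
      lem₃ : ∀ u q w → u ℕ.* q ℕ.+ (w ℕ.* 1 ℕ.+ 0) ≡ q ℕ.* u ℕ.+ w
      lem₃ = solve-∀
      map-origin : ∀ k r → Vec.map (r ℕ.*_) (origin k) ≡ origin k
      map-origin zero    r = ≡.refl
      map-origin (suc k) r = cong₂ _∷_ (ℕ.*-zeroʳ r) (map-origin k r)
      origin-⊞ : ∀ {k} (v : Vec ℕ k) → origin k ⊞ v ≡ v
      origin-⊞ = Vec.zipWith-identityˡ ℕ.+-identityˡ
      total≡ : origin (suc k) ⊞ combination ps″ ≡ h ∷ combination ps′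
      total≡ = ≡.trans (origin-⊞ (combination ps″))
        (≡.trans (cong (λ v → Vec.map (u ℕ.*_) (q ∷ origin k) ⊞ (Vec.map (w ℕ.*_) (1 ∷ origin k) ⊞ v)) (weighted-0∷ (λ r → r) ps′))
          (cong₂ _∷_ (lem₃ u q w)
            (≡.trans (cong₂ (λ x y → x ⊞ (y ⊞ combination ps′)) (map-origin k u) (map-origin k w))
              (≡.trans (origin-⊞ _) (origin-⊞ _)))))
      div-head : Q′ ∣ h
      div-head = subst (λ γ → Q′ ∣ Vec.lookup γ zero) total≡ (div zero)
      div-tail : ∀ t → Q′ ∣ coordinate t (λ r → r) ps′
      div-tail t = subst (Q′ ∣_) (lookup-weighted t (λ r → r) ps′)
        (subst (λ γ → Q′ ∣ Vec.lookup γ (suc t)) total≡ (div (suc t)))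

    p^V∣N : ∀ f → AllDegree d f → p ℕ.^ V ∣ N F q f
    p^V∣N f degs = divisibility q f V (ℕ.≤-trans V≤n*k (ℕ.*-monoʳ-≤ n (ℕ.n≤1+n k))) (equation-bound f degs)

-- From divisibility to the valuation.

module Valuation {p} (pr : Prime p) where
  open import Data.Nat.Base

  1<p : 1 < p
  1<p = nonTrivial⇒n>1 p {{prime⇒nonTrivial pr}}

  t<p^t : ∀ t → t < p ^ t
  t<p^t zero    = s≤s z≤n
  t<p^t (suc t) = ℕ.<-≤-trans (s≤s (t<p^t t)) (ℕ.^-monoʳ-< p 1<p (ℕ.n<1+n t))

  maxExponent≤-lower : ∀ b n t → t ≤ b → p ^ t ∣ n → t ≤ maxExponent≤ b p n
  maxExponent≤-lower zero    n t t≤b _ = t≤b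
  maxExponent≤-lower (suc b) n t t≤b p^t∣n with p ^ suc b ∣? n | t ℕ.≟ suc b
  ... | yes _ | _        = t≤b
  ... | no  h | yes ≡.refl = contradiction p^t∣n h
  ... | no  _ | no  t≢b  = maxExponent≤-lower b n t (ℕ.≤-pred (ℕ.≤∧≢⇒< t≤b t≢b)) p^t∣n

  maxExponent≤-∣ : ∀ b n → p ^ maxExponent≤ b p n ∣ n
  maxExponent≤-∣ zero    n = 1∣ n
  maxExponent≤-∣ (suc b) n with p ^ suc b ∣? n
  ... | yes h = h
  ... | no  _ = maxExponent≤-∣ b n

  p^-∣ : ∀ {a b} → a ≤ b → p ^ a ∣ p ^ b
  p^-∣ {a} {b} a≤b = subst (p ^ a ∣_) (≡.trans (≡.sym (ℕ.^-distribˡ-+-* p a (b ∸ a))) (cong (p ^_) (ℕ.m+[n∸m]≡n a≤b)))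
    (m∣m*n (p ^ (b ∸ a)))

  ∣⇒≥ν : ∀ n t → p ^ t ∣ n → ν p n ≥ν t
  ∣⇒≥ν zero      t _     = Sup.[ t ] NonStrict.≤⊤⁺
  ∣⇒≥ν n@(suc _) t p^t∣n = NonStrict.[ maxExponent≤-lower n n t (ℕ.≤-trans (ℕ.<⇒≤ (t<p^t t)) (∣⇒≤ p^t∣n)) p^t∣n ]

  ν-exact : ∀ {n} t x → n ≡ p ^ t * x → ¬ p ∣ x → ν p n ≡ Sup.[ t ]
  ν-exact {zero}    t x n≡ p∤x = contradiction (subst (p ∣_) (≡.sym x≡0) (p ∣0)) p∤x
    where
    instance _ = ℕ.m^n≢0 p t {{>-nonZero (ℕ.<-trans (s≤s z≤n) 1<p)}}
    x≡0 : x ≡ 0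
    x≡0 = ℕ.m*n≡0⇒m≡0 x (p ^ t) (≡.trans (ℕ.*-comm x (p ^ t)) (≡.sym n≡))
  ν-exact {n@(suc _)} t x n≡ p∤x = cong Sup.[_] (ℕ.≤-antisym
    (ℕ.≮⇒≥ λ t<v → p∤x (*-cancelˡ-∣ (p ^ t) (subst (_∣ p ^ t * x) (ℕ.*-comm p (p ^ t))
      (∣-trans (p^-∣ t<v) (subst (p ^ maxExponent≤ n p n ∣_) n≡ (maxExponent≤-∣ n n))))))
    (maxExponent≤-lower n n t (ℕ.≤-trans (ℕ.<⇒≤ (t<p^t t)) (∣⇒≤ p^t∣n)) p^t∣n))
    where
    instance _ = ℕ.m^n≢0 p t {{>-nonZero (ℕ.<-trans (s≤s z≤n) 1<p)}}
    p^t∣n : p ^ t ∣ n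
    p^t∣n = subst (p ^ t ∣_) (≡.sym n≡) (m∣m*n x)

-- Removal of cancelling terms of the wrong degree.

module HomogeneousPart {c ℓ₁ ℓ₂ Q} (F : FiniteField c ℓ₁ ℓ₂ Q) {k : ℕ} where
  open Weights
  open FiniteField F hiding (zero)
  open Exp commutativeSemiring

  private
    Poly = Polynomial F k
    Exponents = Vec ℕ k
    infix 4 _≟ⱽ_
    _≟ⱽ_ : (α β : Exponents) → Dec (α ≡ β)
    _≟ⱽ_ = Vec.≡-dec ℕ._≟_

  coeff-∷-≡ : ∀ a α f → coeff F ((a , α) ∷ f) α ≡ a + coeff F f α
  coeff-∷-≡ a α f = cong (List.foldr _+_ 0# ∘ map proj₁)
    (List.filter-accept (λ t → proj₂ t ≟ⱽ α) {x = a , α} {xs = f} ≡.refl)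

  coeff-∷-≢ : ∀ a {α β} f → α ≢ β → coeff F ((a , α) ∷ f) β ≡ coeff F f β
  coeff-∷-≢ a {α} {β} f α≢β = cong (List.foldr _+_ 0# ∘ map proj₁)
    (List.filter-reject (λ t → proj₂ t ≟ⱽ β) {x = a , α} {xs = f} α≢β)

  coeff-∷-cong : ∀ a α {f g β} → coeff F f β ≡ coeff F g β → coeff F ((a , α) ∷ f) β ≡ coeff F ((a , α) ∷ g) β
  coeff-∷-cong a α {f} {g} {β} e = [ (λ { ≡.refl → ≡.trans (coeff-∷-≡ a α f) (≡.trans (cong (a +_) e) (≡.sym (coeff-∷-≡ a α g))) })
    , (λ α≢β → ≡.trans (coeff-∷-≢ a f α≢β) (≡.trans e (≡.sym (coeff-∷-≢ a g α≢β)))) ]′ (toSum (α ≟ⱽ β))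

  module _ {ℓ} {P : Exponents → Set ℓ} (P? : ∀ α → Dec (P α)) where
    part copart : Poly → Poly
    part   = filter (P? ∘ proj₂)
    copart = filter (¬? ∘ P? ∘ proj₂)

    eval-part : ∀ f x → eval F f x ≈ eval F (part f) x + eval F (copart f) x
    eval-part []            x = sym (+-identityˡ 0#)
    eval-part ((a , α) ∷ f) x with does (P? α)
    ... | true  = trans (+-congˡ (eval-part f x)) (sym (+-assoc _ _ _))
    ... | false = trans (+-congˡ (eval-part f x)) (trans (sym (+-assoc _ _ _))
      (trans (+-congʳ (+-comm _ _)) (+-assoc _ _ _)))

    coeff-part : ∀ f {β} → P β → coeff F (part f) β ≡ coeff F f β
    coeff-part []            Pβ = ≡.refl
    coeff-part ((a , α) ∷ f) {β} Pβ with P? α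
    ... | yes _  = coeff-∷-cong a α (coeff-part f Pβ)
    ... | no ¬Pα = ≡.trans (coeff-part f Pβ) (≡.sym (coeff-∷-≢ a {α} f λ { ≡.refl → ¬Pα Pβ }))

    coeff-part-∉ : ∀ f {β} → ¬ P β → coeff F (part f) β ≡ 0#
    coeff-part-∉ []            ¬Pβ = ≡.refl
    coeff-part-∉ ((a , α) ∷ f) {β} ¬Pβ with P? α
    ... | no _   = coeff-part-∉ f ¬Pβ
    ... | yes Pα = ≡.trans (coeff-∷-≢ a {α} (part f) λ { ≡.refl → ¬Pβ Pα }) (coeff-part-∉ f ¬Pβ)

    part-All : ∀ f → All (P ∘ proj₂) (part f)
    part-All []            = []
    part-All ((a , α) ∷ f) with P? α
    ... | yes Pα = Pα ∷ part-All f
    ... | no _   = part-All f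

  eval-single : ∀ f α x → eval F (part (_≟ⱽ α) f) x ≈ coeff F f α * monomial F α x
  eval-single []            α x = sym (zeroˡ _)
  eval-single ((a , β) ∷ f) α x = [ (λ { ≡.refl → trans (reflexive (cong (λ g → eval F g x) (List.filter-accept ((_≟ⱽ β) ∘ proj₂) {x = a , β} {xs = f} ≡.refl)))
    (trans (+-congˡ (eval-single f β x)) (trans (sym (distribʳ _ _ _)) (*-congʳ (reflexive (≡.sym (coeff-∷-≡ a β f)))))) })
    , (λ β≢α → trans (reflexive (cong (λ g → eval F g x) (List.filter-reject ((_≟ⱽ α) ∘ proj₂) {x = a , β} {xs = f} β≢α)))
    (trans (eval-single f α x) (*-congʳ (reflexive (≡.sym (coeff-∷-≢ a f β≢α)))))) ]′ (toSum (β ≟ⱽ α))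

  -- All terms sharing the exponent of the first are removed at once, since only their coefficients
  -- together add up to zero. The remaining list is no structural part of f, so the induction is on
  -- a bound for its length.
  eval-zero : ∀ m f → length f ℕ.≤ m → (∀ α → coeff F f α ≈ 0#) → ∀ x → eval F f x ≈ 0#
  eval-zero m       []                _   coeff≈0 x = refl
  eval-zero (suc m) f@((a , α) ∷ f′) len coeff≈0 x = begin
    eval F f x                                                  ≈⟨ eval-part (_≟ⱽ α) f x ⟩
    eval F (part (_≟ⱽ α) f) x + eval F (copart (_≟ⱽ α) f) x     ≈⟨ +-cong (eval-single f α x)
              (eval-zero m (copart (_≟ⱽ α) f) shorter coeff≈0′ x) ⟩
    coeff F f α * monomial F α x + 0#                           ≈⟨ +-identityʳ _ ⟩
    coeff F f α * monomial F α x                                ≈⟨ *-congʳ (coeff≈0 α) ⟩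
    0# * monomial F α x                                         ≈⟨ zeroˡ _ ⟩
    0#                                                          ∎
    where
    open SetoidReasoning setoid
    shorter : length (copart (_≟ⱽ α) f) ℕ.≤ m
    shorter = subst (λ g → length g ℕ.≤ m) (≡.sym (List.filter-reject (¬? ∘ (_≟ⱽ α) ∘ proj₂) {x = a , α} {xs = f′} (λ h → h ≡.refl)))
      (ℕ.≤-trans (List.length-filter (¬? ∘ (_≟ⱽ α) ∘ proj₂) f′) (ℕ.≤-pred len))
    coeff≈0′ : ∀ β → coeff F (copart (_≟ⱽ α) f) β ≈ 0#
    coeff≈0′ β = [ (λ β≡α → reflexive (coeff-part-∉ (¬? ∘ (_≟ⱽ α)) f (λ h → h β≡α)))
      , (λ β≢α → trans (reflexive (coeff-part (¬? ∘ (_≟ⱽ α)) f β≢α)) (coeff≈0 β)) ]′ (toSum (β ≟ⱽ α))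

  N-cong : ∀ q (f g : Poly) → (∀ x → eval F f x ≈ eval F g x) → N F q f ≡ N F q g
  N-cong q f g e = cong length (List.filter-≐
    (λ (x , y) → eval F f x ≟ (y ^ q) - y) (λ (x , y) → eval F g x ≟ (y ^ q) - y)
    ((λ {(x , y)} h → trans (sym (e x)) h) , (λ {(x , y)} h → trans (e x) h))
    (List.cartesianProduct (points k) elements))

  -- A homogeneous f may still list terms of other degrees that cancel. They form a polynomial with
  -- all coefficients zero, so dropping them changes no value.
  homogeneous-part : ∀ d q f → Homogeneous F d f →
    ∃ λ g → AllDegree d g × N F q f ≡ N F q g
  homogeneous-part d q f hom = part deg? f , part-All deg? f , N-cong q f (part deg? f) λ x →
    trans (eval-part deg? f x) (trans (+-congˡ (eval-zero (length (copart deg? f)) (copart deg? f) ℕ.≤-refl vanishing x)) (+-identityʳ _))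
    where
    deg? : ∀ α → Dec (Vec.sum α ≡ d)
    deg? α = Vec.sum α ℕ.≟ d
    vanishing : ∀ α → coeff F (copart deg? f) α ≈ 0#
    vanishing α = [ (λ deg → reflexive (coeff-part-∉ (¬? ∘ deg?) f (λ h → h deg)))
      , (λ ¬deg → trans (reflexive (coeff-part (¬? ∘ deg?) f ¬deg))
          (decidable-stable (coeff F f α ≟ 0#) λ ≉0 → ¬deg (hom α ≉0))) ]′ (toSum (deg? α))

  allDegree⇒homogeneous : ∀ {d} (f : Poly) → AllDegree d f → Homogeneous F d f
  allDegree⇒homogeneous []            []           α ≉0 = contradiction refl ≉0
  allDegree⇒homogeneous ((a , β) ∷ f) (deg ∷ degs) α ≉0 = [ (λ { ≡.refl → deg })
    , (λ β≢α → allDegree⇒homogeneous f degs α (≉0 ∘ trans (reflexive (coeff-∷-≢ a f β≢α)))) ]′ (toSum (β ≟ⱽ α))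

-- Counting through the fibres of y ↦ y ^ q - y.

module Counting {c ℓ₁ ℓ₂ Q} (F : FiniteField c ℓ₁ ℓ₂ Q) (p′ n e : ℕ) .{{_ : NonZero n}}
                (pr : Prime (suc p′)) (Q≡p^n : Q ≡ suc p′ ℕ.^ n) where
  open FiniteField F hiding (zero)
  open Exp commutativeSemiring using (_^_; ^-congˡ; ^-distrib-*)
  open FieldProperties F
  open Weights
  open Characteristic p′ n pr Q≡p^n
  open Summation ℕ.+-0-commutativeMonoid
  open RingProperties (CommutativeRing.ring commutativeRing) using (-‿distribʳ-*; -‿+-comm)
  private
    module FSum = Summation +-commutativeMonoid
    module ℕMult = CMult ℕ.+-0-commutativeMonoid
    p q : ℕ
    p = suc p′
    q = p ℕ.^ e

  ×≡* : ∀ m x → m ℕMult.× x ≡ m ℕ.* x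
  ×≡* zero    x = ≡.refl
  ×≡* (suc m) x = cong (x ℕ.+_) (×≡* m x)

  χ : ∀ {ℓ} {P : Set ℓ} → Dec P → ℕ
  χ P? = if does P? then 1 else 0

  χ-⇔ : ∀ {ℓ ℓ′} {P : Set ℓ} {P′ : Set ℓ′} (P? : Dec P) (P′? : Dec P′) → (P → P′) → (P′ → P) → χ P? ≡ χ P′?
  χ-⇔ P? P′? f g = cong (λ b → if b then 1 else 0) (does-⇔ (mk⇔ f g) P? P′?)

  χ-true : ∀ {ℓ} {P : Set ℓ} (P? : Dec P) → P → χ P? ≡ 1
  χ-true P? pf = cong (λ b → if b then 1 else 0) (dec-true P? pf)

  χ-false : ∀ {ℓ} {P : Set ℓ} (P? : Dec P) → ¬ P → χ P? ≡ 0
  χ-false P? ¬pf = cong (λ b → if b then 1 else 0) (dec-false P? ¬pf)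

  ℘ : Carrier → Carrier
  ℘ y = (y ^ q) - y

  ℘-cong : ∀ {x y} → x ≈ y → ℘ x ≈ ℘ y
  ℘-cong e = +-cong (^-congˡ q e) (-‿cong e)

  W : Carrier → ℕ
  W z = Σ λ y → χ (z ≟ ℘ y)

  W-cong : ∀ {z z′} → z ≈ z′ → W z ≡ W z′
  W-cong {z} {z′} h = Σ-cong λ y → χ-⇔ (z ≟ ℘ y) (z′ ≟ ℘ y) (trans (sym h)) (trans h)

  N≡ΣW : ∀ {k} (f : Polynomial F k) → N F q f ≡ Σ^ k λ x → W (eval F f x)
  N≡ΣW {k} f = ≡.trans (≡.sym (≡.trans (×≡* (N F q f) 1) (ℕ.*-identityʳ _)))
    (Σᴸ-count k (λ (x , y) → eval F f x ≟ (y ^ q) - y) 1)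

  ΣΣ-const : ∀ x → Σ (λ _ → x) ≡ Q ℕ.* x
  ΣΣ-const x = ≡.trans (Σ-const x) (×≡* Q x)

  Σ^-const : ∀ k x → Σ^ k (λ _ → x) ≡ Q ℕ.^ k ℕ.* x
  Σ^-const zero    x = ≡.sym (ℕ.*-identityˡ x)
  Σ^-const (suc k) x = ≡.trans (Σ-cong λ _ → Σ^-const k x)
    (≡.trans (ΣΣ-const (Q ℕ.^ k ℕ.* x)) (≡.sym (ℕ.*-assoc Q (Q ℕ.^ k) x)))

  Σ-*ˡ : ∀ m φ → m ℕ.* Σ φ ≡ Σ (λ x → m ℕ.* φ x)
  Σ-*ˡ zero    φ = ≡.sym Σ-ε
  Σ-*ˡ (suc m) φ = ≡.trans (cong (Σ φ ℕ.+_) (Σ-*ˡ m φ)) (≡.sym (Σ-⊞ φ (λ x → m ℕ.* φ x)))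

  Σ^-*ˡ : ∀ k m φ → m ℕ.* Σ^ k φ ≡ Σ^ k (λ x → m ℕ.* φ x)
  Σ^-*ˡ zero    m φ = ≡.refl
  Σ^-*ˡ (suc k) m φ = ≡.trans (Σ-*ˡ m (λ x → Σ^ k λ v → φ (x ∷ v))) (Σ-cong λ x → Σ^-*ˡ k m (λ v → φ (x ∷ v)))

  Σ-nonzero : ∀ φ → Respectful φ → ∀ z → (∀ x → ¬ x ≈ 0# → φ x ≡ z) → Σ φ ≡ φ 0# ℕ.+ (Q ℕ.∸ 1) ℕ.* z
  Σ-nonzero φ φ-resp z h = ≡.trans (Σ-split φ φ-resp z h) (cong (φ 0# ℕ.+_) (×≡* (Q ℕ.∸ 1) z))

  ΣW : Σ W ≡ Q
  ΣW = ≡.trans (Σ-comm (λ z y → χ (z ≟ ℘ y))) (≡.trans (Σ-cong fibre) (≡.trans (ΣΣ-const 1) (ℕ.*-identityʳ Q)))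
    where
    fibre : ∀ y → Σ (λ z → χ (z ≟ ℘ y)) ≡ 1
    fibre y = ≡.trans (≡.sym (Σ-translate (λ z → χ (z ≟ ℘ y))
        (λ {x} {x′} h → χ-⇔ (x ≟ ℘ y) (x′ ≟ ℘ y) (trans (sym h)) (trans h)) (℘ y)))
      (≡.trans (Σ-cong λ z → χ-⇔ ((z + ℘ y) ≟ ℘ y) (z ≟ 0#)
          (λ h → +-cancelʳ (℘ y) z 0# (trans h (sym (+-identityˡ _)))) (λ h → trans (+-congʳ h) (+-identityˡ _)))
        (≡.trans (Σ-nonzero (λ z → χ (z ≟ 0#)) (λ {x} {x′} h → χ-⇔ (x ≟ 0#) (x′ ≟ 0#) (trans (sym h)) (trans h)) 0
            (λ x x≉0 → χ-false (x ≟ 0#) x≉0))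
          (cong₂ ℕ._+_ (χ-true (0# ≟ 0#) refl) (ℕ.*-zeroʳ (Q ℕ.∸ 1)))))
      where open GroupProperties +-group using () renaming (∙-cancelʳ to +-cancelʳ)

  -- For a fixed by the q-th power, y ↦ a y commutes with `℘` and hence maps the fibre over z
  -- bijectively to the fibre over a z.
  W-scale : ∀ {a} → a ^ q ≈ a → ¬ a ≈ 0# → ∀ z → W (a * z) ≡ W z
  W-scale {a} a^q≈a a≉0 z = ≡.trans (≡.sym (Σ-scale (λ y → χ ((a * z) ≟ ℘ y))
      (λ {y} {y′} h → χ-⇔ ((a * z) ≟ ℘ y) ((a * z) ≟ ℘ y′) (λ g → trans g (℘-cong h)) (λ g → trans g (sym (℘-cong h)))) a≉0))
    (Σ-cong λ y → χ-⇔ ((a * z) ≟ ℘ (a * y)) (z ≟ ℘ y)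
      (λ h → *-cancelˡ a≉0 (trans h (℘-scale y))) (λ h → trans (*-congˡ h) (sym (℘-scale y))))
    where
    ℘-scale : ∀ y → ℘ (a * y) ≈ a * ℘ y
    ℘-scale y = trans (+-cong (trans (^-distrib-* a y q) (*-congʳ a^q≈a)) (-‿distribʳ-* a y)) (sym (distribˡ a _ _))

  ΣW-linear : ∀ {a} → ¬ a ≈ 0# → ∀ b → Σ (λ x → W (a * x + b)) ≡ Q
  ΣW-linear {a} a≉0 b = ≡.trans (Σ-scale (λ x → W (x + b)) (λ {x} {y} h → W-cong {x + b} {y + b} (+-congʳ h)) a≉0)
    (≡.trans (Σ-translate W W-cong b) ΣW)

  -- y ↦ y + 1 permutes the zeros of y ^ q - y, so comparing the sum of the zeros
  -- before and after gives W 0 · 1 = 0 in F.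
  p∣W0 : p ∣ W 0#
  p∣W0 = ·1≈0⇒∣ (W 0#) (trans (count (λ y → does (0# ≟ ℘ y))) Σκ≈0)
    where
    open Mult semiring using () renaming (_×_ to _·_; ×-homo-+ to ·-homo-+)
    open SetoidReasoning setoid
    open GroupProperties +-group using () renaming (∙-cancelˡ to +-cancelˡ)
    κ : Carrier → Carrier
    κ y = if does (0# ≟ ℘ y) then 1# else 0#
    sum-homo : ∀ {m} (t : Fin m → Bool) →
      CMSum.sum ℕ.+-0-commutativeMonoid (λ i → if t i then 1 else 0) · 1# ≈
      CMSum.sum +-commutativeMonoid (λ i → if t i then 1# else 0#)
    sum-homo {zero}  t = refl
    sum-homo {suc m} t = trans (·-homo-+ 1# (if t zero then 1 else 0) _) (+-cong (bit (t zero)) (sum-homo (t ∘ suc)))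
      where
      bit : ∀ b → (if b then 1 else 0) · 1# ≈ (if b then 1# else 0#)
      bit true  = +-identityʳ 1#
      bit false = refl
    count : ∀ (t : Carrier → Bool) → Σ (λ y → if t y then 1 else 0) · 1# ≈ FSum.Σ (λ y → if t y then 1# else 0#)
    count t = sum-homo (λ i → t (Inverse.from enumeration i))
    κ-resp : ∀ {x y} → x ≈ y → κ x ≈ κ y
    κ-resp {x} {y} h = reflexive (cong (λ b → if b then 1# else 0#)
      (does-⇔ (mk⇔ (λ g → trans g (℘-cong h)) (λ g → trans g (sym (℘-cong h)))) (0# ≟ ℘ x) (0# ≟ ℘ y)))
    ℘-shift : ∀ y → ℘ (y + 1#) ≈ ℘ y
    ℘-shift y = begin
      ((y + 1#) ^ q) - (y + 1#)             ≈⟨ +-cong (trans (^p^-+ e y 1#) (+-congˡ (1^ q))) (-‿cong (+-comm y 1#)) ⟩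
      ((y ^ q) + 1#) - (1# + y)             ≈⟨ +-assoc _ _ _ ⟩
      (y ^ q) + (1# + - (1# + y))           ≈⟨ +-congˡ (+-congˡ (-‿+-comm 1# y)) ⟨
      (y ^ q) + (1# + (- 1# + - y))         ≈⟨ +-congˡ (+-assoc _ _ _) ⟨
      (y ^ q) + (1# + - 1# + - y)           ≈⟨ +-congˡ (trans (+-congʳ (-‿inverseʳ 1#)) (+-identityˡ _)) ⟩
      (y ^ q) - y                           ∎
    κ-shift : ∀ y → κ (y + 1#) ≈ κ y
    κ-shift y = reflexive (cong (λ b → if b then 1# else 0#)
      (does-⇔ (mk⇔ (λ g → trans g (℘-shift y)) (λ g → trans g (sym (℘-shift y)))) (0# ≟ ℘ (y + 1#)) (0# ≟ ℘ y)))
    Σκ≈0 : FSum.Σ κ ≈ 0#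
    Σκ≈0 = +-cancelˡ (FSum.Σ λ y → κ y * y) _ _ (begin
      FSum.Σ (λ y → κ y * y) + FSum.Σ κ        ≈⟨ FSum.Σ-⊞ (λ y → κ y * y) κ ⟨
      FSum.Σ (λ y → κ y * y + κ y)             ≈⟨ FSum.Σ-cong (λ y → trans (+-congˡ (sym (*-identityʳ (κ y)))) (sym (distribˡ (κ y) y 1#))) ⟩
      FSum.Σ (λ y → κ y * (y + 1#))            ≈⟨ FSum.Σ-cong (λ y → *-congʳ {y + 1#} (sym (κ-shift y))) ⟩
      FSum.Σ (λ y → κ (y + 1#) * (y + 1#))     ≈⟨ FSum.Σ-translate (λ y → κ y * y) (λ h → *-cong (κ-resp h) h) 1# ⟩
      FSum.Σ (λ y → κ y * y)                   ≈⟨ +-identityʳ _ ⟨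
      FSum.Σ (λ y → κ y * y) + 0#              ∎)

  p∣Q : p ∣ Q
  p∣Q = subst (p ∣_) (≡.sym Q≡p^n) (p∣p^ n)
    where
    p∣p^ : ∀ n .{{_ : NonZero n}} → p ∣ p ℕ.^ n
    p∣p^ (suc n) = m∣m*n (p ℕ.^ n)

  1+Q∸1 : suc (Q ℕ.∸ 1) ≡ Q
  1+Q∸1 = ℕ.suc-pred Q {{Q≢0}}

  p∤Q∸1 : ¬ p ∣ Q ℕ.∸ 1
  p∤Q∸1 h = Arithmetic.∤-1 pr (∣m+n∣m⇒∣n (subst (p ∣_) (≡.trans (≡.sym 1+Q∸1) (ℕ.+-comm 1 _)) p∣Q) h)

  Σ^-++ : ∀ b j (φ : Vec Carrier (b ℕ.+ j) → ℕ) → Σ^ (b ℕ.+ j) φ ≡ Σ^ b λ x → Σ^ j λ v → φ (x ++ v)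
  Σ^-++ zero    j φ = ≡.refl
  Σ^-++ (suc b) j φ = Σ-cong λ x → Σ^-++ b j (λ v → φ (x ∷ v))

  monomial-++-origin : ∀ {b j} (α : Vec ℕ b) (x : Vec Carrier b) (v : Vec Carrier j) →
                       monomial F (α ++ origin j) (x ++ v) ≈ monomial F α x
  monomial-++-origin []      []      []      = refl
  monomial-++-origin []      []      (y ∷ v) = trans (*-identityˡ _) (monomial-++-origin [] [] v)
  monomial-++-origin (a ∷ α) (y ∷ x) v       = *-congˡ (monomial-++-origin α x v)

  monomial-origin-++ : ∀ {b j} (α : Vec ℕ j) (x : Vec Carrier b) (v : Vec Carrier j) →
                       monomial F (origin b ++ α) (x ++ v) ≈ monomial F α v
  monomial-origin-++ α []      v = refl
  monomial-origin-++ α (y ∷ x) v = trans (*-identityˡ _) (monomial-origin-++ α x v)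

  module _ {b j : ℕ} (β : Vec ℕ b) (rest : Polynomial F j) where
    -- A block of `suc b` new variables is put in front of those of `rest` and carries a single
    -- monomial, linear in the first variable; this linearity is what `N-extend` exploits.
    extend : Polynomial F (suc b ℕ.+ j)
    extend = (1# , (1 ∷ β) ++ origin j) ∷ map (λ (a , α) → a , origin (suc b) ++ α) rest

    eval-extend : ∀ y (x : Vec Carrier b) v → eval F extend ((y ∷ x) ++ v) ≈ monomial F β x * y + eval F rest v
    eval-extend y x v = +-cong (trans (*-identityˡ _) (trans (monomial-++-origin (1 ∷ β) (y ∷ x) v)
        (trans (*-congʳ (*-identityʳ y)) (*-comm _ _)))) (shifted rest)
      where
      shifted : ∀ g → eval F (map (λ (a , α) → a , origin (suc b) ++ α) g) ((y ∷ x) ++ v) ≈ eval F g v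
      shifted []            = refl
      shifted ((a , α) ∷ g) = +-cong (*-congˡ (monomial-origin-++ α (y ∷ x) v)) (shifted g)

    private
      nz z : Vec Carrier b → ℕ
      nz x = χ (¬? (monomial F β x ≟ 0#))
      z x = χ (monomial F β x ≟ 0#)

    nonvanishing vanishing : ℕ
    nonvanishing = Σ^ b nz
    vanishing    = Σ^ b z

    -- Summing over the variable in which the first term is linear gives Q
    -- wherever its cofactor does not vanish.
    N-extend : N F q extend ≡ Q ℕ.* (nonvanishing ℕ.* Q ℕ.^ j ℕ.+ vanishing ℕ.* N F q rest)
    N-extend = begin
      N F q extend
        ≡⟨ N≡ΣW extend ⟩
      Σ^ (suc b ℕ.+ j) (λ w → W (eval F extend w))
        ≡⟨ Σ^-++ (suc b) j (λ w → W (eval F extend w)) ⟩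
      Σ (λ y → Σ^ b λ x → Σ^ j λ v → W (eval F extend ((y ∷ x) ++ v)))
        ≡⟨ Σ-cong (λ y → Σ^-cong b λ x → Σ^-cong j λ v → W-cong (eval-extend y x v)) ⟩
      Σ (λ y → Σ^ b λ x → Σ^ j λ v → W (monomial F β x * y + eval F rest v))
        ≡⟨ Σ^-Σ b (λ x y → Σ^ j λ v → W (monomial F β x * y + eval F rest v)) ⟨
      Σ^ b (λ x → Σ λ y → Σ^ j λ v → W (monomial F β x * y + eval F rest v))
        ≡⟨ Σ^-cong b (λ x → ≡.trans (≡.sym (Σ^-Σ j (λ v y → W (monomial F β x * y + eval F rest v)))) (inner x)) ⟩
      Σ^ b (λ x → nz x ℕ.* (Q ℕ.* Q ℕ.^ j) ℕ.+ z x ℕ.* (Q ℕ.* N F q rest))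
        ≡⟨ Σ^-⊞ b (λ x → nz x ℕ.* (Q ℕ.* Q ℕ.^ j)) (λ x → z x ℕ.* (Q ℕ.* N F q rest)) ⟩
      Σ^ b (λ x → nz x ℕ.* (Q ℕ.* Q ℕ.^ j)) ℕ.+ Σ^ b (λ x → z x ℕ.* (Q ℕ.* N F q rest))
        ≡⟨ cong₂ ℕ._+_ (factor (Q ℕ.* Q ℕ.^ j) nz) (factor (Q ℕ.* N F q rest) z) ⟩
      nonvanishing ℕ.* (Q ℕ.* Q ℕ.^ j) ℕ.+ vanishing ℕ.* (Q ℕ.* N F q rest)
        ≡⟨ lem nonvanishing Q (Q ℕ.^ j) vanishing (N F q rest) ⟩
      Q ℕ.* (nonvanishing ℕ.* Q ℕ.^ j ℕ.+ vanishing ℕ.* N F q rest) ∎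
      where
      open ≡.≡-Reasoning
      lem : ∀ u q x z n → u ℕ.* (q ℕ.* x) ℕ.+ z ℕ.* (q ℕ.* n) ≡ q ℕ.* (u ℕ.* x ℕ.+ z ℕ.* n)
      lem = solve-∀
      factor : ∀ m φ → Σ^ b (λ x → φ x ℕ.* m) ≡ Σ^ b φ ℕ.* m
      factor m φ = ≡.trans (Σ^-cong b λ x → ℕ.*-comm (φ x) m) (≡.trans (≡.sym (Σ^-*ˡ b m φ)) (ℕ.*-comm m _))
      inner : ∀ x → Σ^ j (λ v → Σ λ y → W (monomial F β x * y + eval F rest v)) ≡
        nz x ℕ.* (Q ℕ.* Q ℕ.^ j) ℕ.+ z x ℕ.* (Q ℕ.* N F q rest)
      inner x = cases (monomial F β x ≟ 0#)
        where
        cases : Dec (monomial F β x ≈ 0#) → Σ^ j (λ v → Σ λ y → W (monomial F β x * y + eval F rest v)) ≡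
          nz x ℕ.* (Q ℕ.* Q ℕ.^ j) ℕ.+ z x ℕ.* (Q ℕ.* N F q rest)
        cases (yes m≈0) = begin
          Σ^ j (λ v → Σ λ y → W (monomial F β x * y + eval F rest v))
            ≡⟨ Σ^-cong j (λ v → ≡.trans (Σ-cong λ y → W-cong {monomial F β x * y + eval F rest v} {eval F rest v}
                   (trans (+-congʳ (trans (*-congʳ m≈0) (zeroˡ y))) (+-identityˡ _)))
                 (ΣΣ-const (W (eval F rest v)))) ⟩
          Σ^ j (λ v → Q ℕ.* W (eval F rest v))
            ≡⟨ Σ^-*ˡ j Q (λ v → W (eval F rest v)) ⟨
          Q ℕ.* Σ^ j (λ v → W (eval F rest v))
            ≡⟨ cong (Q ℕ.*_) (N≡ΣW rest) ⟨
          Q ℕ.* N F q rest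
            ≡⟨ ℕ.+-identityʳ (Q ℕ.* N F q rest) ⟨
          0 ℕ.+ 1 ℕ.* (Q ℕ.* N F q rest)
            ≡⟨ cong₂ (λ a b → a ℕ.* (Q ℕ.* Q ℕ.^ j) ℕ.+ b ℕ.* (Q ℕ.* N F q rest))
                 (χ-false (¬? (monomial F β x ≟ 0#)) (λ h → h m≈0)) (χ-true (monomial F β x ≟ 0#) m≈0) ⟨
          _ ∎
        cases (no m≉0) = begin
          Σ^ j (λ v → Σ λ y → W (monomial F β x * y + eval F rest v))
            ≡⟨ Σ^-cong j (λ v → ΣW-linear m≉0 (eval F rest v)) ⟩
          Σ^ j (λ v → Q)
            ≡⟨ ≡.trans (Σ^-const j Q) (ℕ.*-comm (Q ℕ.^ j) Q) ⟩
          Q ℕ.* Q ℕ.^ j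
            ≡⟨ ≡.trans (ℕ.+-identityʳ _) (ℕ.+-identityʳ _) ⟨
          1 ℕ.* (Q ℕ.* Q ℕ.^ j) ℕ.+ 0
            ≡⟨ cong₂ (λ a b → a ℕ.* (Q ℕ.* Q ℕ.^ j) ℕ.+ b ℕ.* (Q ℕ.* N F q rest))
                 (χ-true (¬? (monomial F β x ≟ 0#)) m≉0) (χ-false (monomial F β x ≟ 0#) m≉0) ⟨
          _ ∎

    nonvanishing+vanishing : nonvanishing ℕ.+ vanishing ≡ Q ℕ.^ b
    nonvanishing+vanishing = ≡.trans (≡.sym (Σ^-⊞ b nz z))
      (≡.trans (Σ^-cong b λ x → complement (monomial F β x ≟ 0#)) (≡.trans (Σ^-const b 1) (ℕ.*-identityʳ _)))
      where
      complement : ∀ {ℓ} {P : Set ℓ} (P? : Dec P) → χ (¬? P?) ℕ.+ χ P? ≡ 1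
      complement (yes _) = ≡.refl
      complement (no _)  = ≡.refl

  -- When all exponents are positive, a monomial is nonzero exactly at the points whose coordinates
  -- are all nonzero.
  Σ^-nonvanishing : ∀ {b} (β : Vec ℕ b) → AllV.All (1 ℕ.≤_) β →
    Σ^ b (λ x → χ (¬? (monomial F β x ≟ 0#))) ≡ (Q ℕ.∸ 1) ℕ.^ b
  Σ^-nonvanishing []              _             = χ-true (¬? (1# ≟ 0#)) 1≉0
  Σ^-nonvanishing {suc b} (suc a ∷ β) (_ AllV.∷ ps) = ≡.trans
    (Σ-nonzero φ φ-resp ((Q ℕ.∸ 1) ℕ.^ b) (λ y y≉0 → ≡.trans
      (Σ^-cong b λ x → χ-⇔ (¬? ((y ^ suc a) * monomial F β x ≟ 0#)) (¬? (monomial F β x ≟ 0#))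
        (λ h m≈0 → h (trans (*-congˡ m≈0) (zeroʳ _))) (λ h → *-≉0 (^-≉0 y≉0 (suc a)) h))
      (Σ^-nonvanishing β ps)))
    (cong (ℕ._+ (Q ℕ.∸ 1) ℕ.* (Q ℕ.∸ 1) ℕ.^ b) (≡.trans
      (Σ^-cong b λ x → χ-false (¬? ((0# ^ suc a) * monomial F β x ≟ 0#))
        (λ h → h (trans (*-congʳ (0^ (suc a))) (zeroˡ _)))) (Σ^-ε b)))
    where
    φ : Carrier → ℕ
    φ y = Σ^ b λ x → χ (¬? ((y ^ suc a) * monomial F β x ≟ 0#))
    φ-resp : Respectful φ
    φ-resp {y} {y′} h = Σ^-cong b λ x → χ-⇔ (¬? ((y ^ suc a) * monomial F β x ≟ 0#)) (¬? ((y′ ^ suc a) * monomial F β x ≟ 0#))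
      (λ g m≈0 → g (trans (*-congʳ (^-congˡ (suc a) h)) m≈0)) (λ g m≈0 → g (trans (*-congʳ (^-congˡ (suc a) (sym h))) m≈0))

-- Polynomials attaining equality.

module Example {c ℓ₁ ℓ₂ Q} (F : FiniteField c ℓ₁ ℓ₂ Q) (p′ n e : ℕ) .{{_ : NonZero n}}
               (pr : Prime (suc p′)) (Q≡p^n : Q ≡ suc p′ ℕ.^ n) (d : ℕ) .{{_ : NonZero d}} where
  open FiniteField F hiding (zero)
  open Exp commutativeSemiring using (_^_; ^-congˡ; ^-congʳ; ^-assocʳ; ^-distrib-*)
  open FieldProperties F
  open Counting F p′ n e pr Q≡p^n
  open Summation ℕ.+-0-commutativeMonoid
  open Arithmetic
  open Weights
  private
    p q : ℕ
    p = suc p′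
    q = p ℕ.^ e

  sum-++ : ∀ {b j} (α : Vec ℕ b) (β : Vec ℕ j) → Vec.sum (α ++ β) ≡ Vec.sum α ℕ.+ Vec.sum β
  sum-++ []      β = ≡.refl
  sum-++ (a ∷ α) β = ≡.trans (cong (a ℕ.+_) (sum-++ α β)) (≡.sym (ℕ.+-assoc a _ _))

  extend-degree : ∀ {b j} (β : Vec ℕ b) (rest : Polynomial F j) → suc (Vec.sum β) ≡ d →
                  AllDegree d rest → AllDegree d (extend β rest)
  extend-degree {b} {j} β rest deg degs =
    ≡.trans (sum-++ (1 ∷ β) (origin j)) (≡.trans (cong (suc (Vec.sum β) ℕ.+_) (sum-origin j)) (≡.trans (ℕ.+-identityʳ _) deg))
    ∷ shifted rest degs
    where
    shifted : ∀ g → AllDegree d g → AllDegree d (map (λ (a , α) → a , origin (suc b) ++ α) g)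
    shifted []            []             = []
    shifted ((a , α) ∷ g) (deg′ ∷ degs′) =
      ≡.trans (sum-++ (origin (suc b)) α) (≡.trans (cong (ℕ._+ Vec.sum α) (sum-origin (suc b))) deg′) ∷ shifted g degs′

  -- The aim is `large`. For k ≤ 1 the construction starts from the zero polynomial, whose factor W
  -- 0# is divisible by p, and the first block added to it relies on that divisibility; hence both
  -- cases belong to the induction hypothesis.
  record Extremal (k : ℕ) : Set c where
    field
      poly      : Polynomial F k
      degrees   : AllDegree d poly
      factor    : ℕ
      count     : N F q poly ≡ Q ℕ.^ ⌈ k / d ⌉ ℕ.* factor
      small     : k ℕ.≤ 1 → p ∣ factor
      large     : 2 ℕ.≤ k → ¬ p ∣ factor

  ⌈/⌉-unique : ∀ {a x} → d ℕ.* x ℕ.< a → a ℕ.≤ d ℕ.* suc x → ⌈ a / d ⌉ ≡ suc x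
  ⌈/⌉-unique {a} {x} lo hi = ℕ.≤-antisym (⌈/⌉-least {a = a} {b = d} hi)
    (ℕ.*-cancelˡ-< d x ⌈ a / d ⌉ (ℕ.<-≤-trans lo (≤-*⌈/⌉ a d)))

  ⌈0/⌉ : ⌈ 0 / d ⌉ ≡ 0
  ⌈0/⌉ = ℕ.n≤0⇒n≡0 (⌈/⌉-least {a = 0} {b = d} z≤n)

  ⌈1/⌉ : ⌈ 1 / d ⌉ ≡ 1
  ⌈1/⌉ = ⌈/⌉-unique (subst (ℕ._< 1) (≡.sym (ℕ.*-zeroʳ d)) (s≤s z≤n)) (ℕ.≤-trans (ℕ.>-nonZero⁻¹ d) (ℕ.m≤m*n d 1))

  ⌈/⌉≤ : ∀ j → ⌈ j / d ⌉ ℕ.≤ j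
  ⌈/⌉≤ j = ⌈/⌉-least {a = j} {b = d} (ℕ.m≤n*m j d)

  d*⌈/⌉< : ∀ j → d ℕ.* ⌈ j / d ⌉ ℕ.< d ℕ.+ j
  d*⌈/⌉< j = helper ⌈ j / d ⌉ ≡.refl
    where
    helper : ∀ x → ⌈ j / d ⌉ ≡ x → d ℕ.* x ℕ.< d ℕ.+ j
    helper zero    _ = subst (ℕ._< d ℕ.+ j) (≡.sym (ℕ.*-zeroʳ d)) (ℕ.<-≤-trans (ℕ.>-nonZero⁻¹ d) (ℕ.m≤m+n d j))
    helper (suc x) h = subst (ℕ._< d ℕ.+ j) (≡.sym (ℕ.*-suc d x)) (ℕ.+-monoʳ-< d (⌈/⌉-pred {a = j} {b = d} h))

  N-[] : ∀ k → N F {k} q [] ≡ Q ℕ.^ k ℕ.* W 0#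
  N-[] k = ≡.trans (N≡ΣW {k} []) (Σ^-const k (W 0#))

  base : ∀ k → k ℕ.≤ 1 → ⌈ k / d ⌉ ≡ k → Extremal k
  base k k≤1 ⌈k⌉≡k = record
    { poly = [] ; degrees = [] ; factor = W 0#
    ; count = ≡.trans (N-[] k) (cong (λ x → Q ℕ.^ x ℕ.* W 0#) (≡.sym ⌈k⌉≡k))
    ; small = λ _ → p∣W0 ; large = λ 2≤k → contradiction k≤1 (ℕ.<⇒≱ 2≤k) }

  p∣Q^ : ∀ {a} → 1 ℕ.≤ a → p ∣ Q ℕ.^ a
  p∣Q^ {suc a} _ = ∣-trans p∣Q (m∣m*n (Q ℕ.^ a))

  step : ∀ {b j} → suc (suc b) ℕ.≤ d → (j ≡ 0 ⊎ suc (suc b) ≡ d) → Extremal j → Extremal (suc (suc b) ℕ.+ j)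
  step {b} {j} b+2≤d shape E = record
    { poly = extend β poly ; degrees = extend-degree β poly β-degree degrees
    ; factor = X
    ; count = ≡.trans (N-extend β poly) (≡.trans (cong (λ x → Q ℕ.* (U ℕ.* Q ℕ.^ j ℕ.+ Z ℕ.* x)) count)
        (≡.trans (cong (λ x → Q ℕ.* (U ℕ.* x ℕ.+ Z ℕ.* (Q ℕ.^ y ℕ.* factor)))
            (≡.trans (cong (Q ℕ.^_) (≡.sym (ℕ.m+[n∸m]≡n (⌈/⌉≤ j)))) (ℕ.^-distribˡ-+-* Q y (j ℕ.∸ y))))
          (≡.trans (lem Q U (Q ℕ.^ y) (Q ℕ.^ (j ℕ.∸ y)) Z factor) (cong (λ x → Q ℕ.^ x ℕ.* X) (≡.sym ceiling)))))
    ; small = λ { (s≤s ()) }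
    ; large = λ _ → p∤X (ℕ.≤-total j 1) }
    where
    open Extremal E
    β : Vec ℕ (suc b)
    -- These are the exponents of the b + 1 variables beside the linear one; the first absorbs the
    -- degree that the others leave.
    β = suc (d ℕ.∸ suc (suc b)) ∷ Vec.replicate b 1
    β-degree : suc (Vec.sum β) ≡ d
    β-degree = ≡.trans (cong (λ x → suc (suc (d ℕ.∸ suc (suc b) ℕ.+ x))) (sum-ones b))
      (≡.trans (cong (2 ℕ.+_) (ℕ.+-comm _ b)) (ℕ.m+[n∸m]≡n b+2≤d))
      where
      sum-ones : ∀ b → Vec.sum (Vec.replicate b 1) ≡ b
      sum-ones zero    = ≡.refl
      sum-ones (suc b) = cong suc (sum-ones b)
    y U Z X : ℕ
    y = ⌈ j / d ⌉
    U = nonvanishing β poly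
    Z = vanishing β poly
    X = U ℕ.* Q ℕ.^ (j ℕ.∸ y) ℕ.+ Z ℕ.* factor
    lem : ∀ q u a b z x → q ℕ.* (u ℕ.* (a ℕ.* b) ℕ.+ z ℕ.* (a ℕ.* x)) ≡ q ℕ.* a ℕ.* (u ℕ.* b ℕ.+ z ℕ.* x)
    lem = solve-∀
    ceiling : ⌈ suc (suc b) ℕ.+ j / d ⌉ ≡ suc y
    ceiling = cases shape
      where
      cases : _ ⊎ _ → ⌈ suc (suc b) ℕ.+ j / d ⌉ ≡ suc y
      cases (inj₁ ≡.refl) = subst (λ x → ⌈ suc (suc b) ℕ.+ 0 / d ⌉ ≡ suc x) (≡.sym ⌈0/⌉)
        (⌈/⌉-unique (subst (ℕ._< suc (suc b) ℕ.+ 0) (≡.sym (ℕ.*-zeroʳ d)) (s≤s z≤n))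
          (ℕ.≤-trans (ℕ.≤-reflexive (ℕ.+-identityʳ _)) (ℕ.≤-trans b+2≤d (ℕ.m≤m*n d 1))))
      cases (inj₂ b+2≡d) = subst (λ x → ⌈ x ℕ.+ j / d ⌉ ≡ suc y) (≡.sym b+2≡d)
        (⌈/⌉-unique (d*⌈/⌉< j) (ℕ.≤-trans (ℕ.+-monoʳ-≤ d (≤-*⌈/⌉ j d)) (ℕ.≤-reflexive (≡.sym (ℕ.*-suc d y)))))
    U≡ : U ≡ (Q ℕ.∸ 1) ℕ.^ suc b
    U≡ = Σ^-nonvanishing β (s≤s z≤n AllV.∷ ones b)
      where
      ones : ∀ b → AllV.All (1 ℕ.≤_) (Vec.replicate b 1)
      ones zero    = AllV.[]
      ones (suc b) = s≤s z≤n AllV.∷ ones b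
    p∤U : ¬ p ∣ U
    p∤U h = ∤-^ pr p∤Q∸1 (suc b) (subst (p ∣_) U≡ h)
    -- U + Z is a positive power of Q, so p dividing Z would also divide U.
    p∤Z : ¬ p ∣ Z
    p∤Z p∣Z = p∤U (∣m+n∣m⇒∣n (subst (p ∣_) (≡.trans (≡.sym (nonvanishing+vanishing β poly)) (ℕ.+-comm U Z)) (p∣Q^ {suc b} (s≤s z≤n))) p∣Z)
    2≤d : 2 ℕ.≤ d
    2≤d = ℕ.≤-trans (s≤s (s≤s z≤n)) b+2≤d
    -- Exactly one summand of X is prime to p. If j ≤ 1 then y = j, the first is U, and p divides
    -- the old factor. If j ≥ 2 then y < j because d ≥ 2, so the first is divisible by p, while Z
    -- and the old factor are prime to p.
    p∤X : j ℕ.≤ 1 ⊎ 1 ℕ.≤ j → ¬ p ∣ X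
    p∤X (inj₁ j≤1) p∣X = p∤U (subst (p ∣_) (≡.trans (cong (λ x → U ℕ.* Q ℕ.^ x) (≡.trans (cong (j ℕ.∸_) y≡j) (ℕ.n∸n≡0 j))) (ℕ.*-identityʳ U))
        (∣m+n∣m⇒∣n (subst (p ∣_) (ℕ.+-comm (U ℕ.* Q ℕ.^ (j ℕ.∸ y)) _) p∣X) (∣n⇒∣m*n Z (small j≤1))))
      where
      y≡j : y ≡ j
      y≡j = small-ceiling j≤1
        where
        small-ceiling : ∀ {j} → j ℕ.≤ 1 → ⌈ j / d ⌉ ≡ j
        small-ceiling z≤n       = ⌈0/⌉
        small-ceiling (s≤s z≤n) = ⌈1/⌉
    p∤X (inj₂ 1≤j) p∣X = at-least (ℕ.m≤n⇒m<n∨m≡n 1≤j)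
      where
      at-least : 1 ℕ.< j ⊎ 1 ≡ j → _
      at-least (inj₂ 1≡j) = p∤X (inj₁ (ℕ.≤-reflexive (≡.sym 1≡j))) p∣X
      at-least (inj₁ 2≤j) = ∤-* pr p∤Z (large 2≤j) (∣m+n∣m⇒∣n p∣X (∣n⇒∣m*n U (p∣Q^ (ℕ.m<n⇒0<n∸m y<j))))
        where
        y<j : y ℕ.< j
        y<j = ℕ.≤-trans (s≤s (⌈/⌉-least {a = j} {b = d} {x = ℕ.pred j} j≤)) (ℕ.≤-reflexive (ℕ.suc-pred j {{ℕ.>-nonZero 1≤j}}))
          where
          half : ∀ j → 2 ℕ.≤ j → j ℕ.≤ 2 ℕ.* ℕ.pred j
          half (suc (suc j)) _ = s≤s (ℕ.≤-trans (ℕ.≤-reflexive (ℕ.+-comm 1 j)) (ℕ.+-monoʳ-≤ j (s≤s z≤n)))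
          half (suc zero) (s≤s ())
          j≤ : j ℕ.≤ d ℕ.* ℕ.pred j
          j≤ = ℕ.≤-trans (half j 2≤j) (ℕ.*-monoˡ-≤ (ℕ.pred j) 2≤d)

  -- Blocks of d variables are split off, and a smaller last block has at least two variables. A
  -- single variable left over forms no block: it is covered by the zero polynomial as base case.
  extremal : 2 ℕ.≤ d → ∀ fuel k → k ℕ.≤ fuel → Extremal k
  extremal 2≤d fuel       zero          _ = base 0 z≤n ⌈0/⌉
  extremal 2≤d fuel       (suc zero)    _ = base 1 (s≤s z≤n) ⌈1/⌉
  extremal 2≤d (suc fuel) (suc (suc k)) (s≤s k<fuel) with ℕ.≤-total (suc (suc k)) d
  ... | inj₁ k≤d = subst Extremal (ℕ.+-identityʳ (suc (suc k))) (step k≤d (inj₁ ≡.refl) (base 0 z≤n ⌈0/⌉))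
  ... | inj₂ d≤k = subst Extremal total (step (ℕ.≤-reflexive b≡) (inj₂ b≡) (extremal 2≤d fuel j j≤fuel))
    where
    j = suc (suc k) ℕ.∸ d
    b≡ : suc (suc (d ℕ.∸ 2)) ≡ d
    b≡ = ℕ.m+[n∸m]≡n 2≤d
    total : suc (suc (d ℕ.∸ 2)) ℕ.+ j ≡ suc (suc k)
    total = ≡.trans (cong (ℕ._+ j) b≡) (ℕ.m+[n∸m]≡n d≤k)
    j≤fuel : j ℕ.≤ fuel
    j≤fuel = ℕ.≤-trans (ℕ.∸-monoʳ-≤ (suc (suc k)) 2≤d) (ℕ.≤-trans (ℕ.n≤1+n k) k<fuel)

  module Power {D q′ : ℕ} (q′D : q′ ℕ.* D ≡ Q ℕ.∸ 1) (q≡ : q ≡ suc q′) (gcd≡1 : gcd d D ≡ 1) where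

    ^D-fixed : ∀ {a} → ¬ a ≈ 0# → (a ^ D) ^ q ≈ a ^ D
    ^D-fixed {a} a≉0 = trans (^-congʳ (a ^ D) q≡) (trans (*-congˡ (trans (^-assocʳ a D q′)
      (trans (^-congʳ a (≡.trans (ℕ.*-comm D q′) q′D)) (fermat a≉0)))) (*-identityʳ _))

    -- A Bézout relation between d and D makes every nonzero a a d-th power up to a
    -- factor of the form x ^ D, which lies in the subfield with q elements.
    decompose : ∀ {a} → ¬ a ≈ 0# → ∃₂ λ x b → ¬ x ≈ 0# × ¬ b ≈ 0# × a ≈ x ^ D * b ^ d
    decompose {a} a≉0 with invertible a a≉0 | coprime-Bézout (gcd≡1⇒coprime gcd≡1)
    ... | a⁻¹ , aa⁻¹≈1 | Bézout.+- s t eq = a⁻¹ ^ t , a ^ s , ^-≉0 a⁻¹≉0 t , ^-≉0 a≉0 s , sym (begin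
        (a⁻¹ ^ t) ^ D * (a ^ s) ^ d              ≈⟨ *-cong (^-assocʳ a⁻¹ t D) (^-assocʳ a s d) ⟩
        a⁻¹ ^ (t ℕ.* D) * a ^ (s ℕ.* d)          ≡⟨ cong (λ x → a⁻¹ ^ (t ℕ.* D) * a ^ x) eq ⟨
        a⁻¹ ^ (t ℕ.* D) * (a * a ^ (t ℕ.* D))    ≈⟨ cancel-inverse (t ℕ.* D) ⟩
        a                                        ∎)
      where
      open SetoidReasoning setoid
      a⁻¹≉0 : ¬ a⁻¹ ≈ 0#
      a⁻¹≉0 h = 1≉0 (trans (sym aa⁻¹≈1) (trans (*-congˡ h) (zeroʳ a)))
      cancel-inverse : ∀ m → a⁻¹ ^ m * (a * a ^ m) ≈ a
      cancel-inverse m = begin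
        a⁻¹ ^ m * (a * a ^ m)      ≈⟨ *-congˡ (*-comm a _) ⟩
        a⁻¹ ^ m * (a ^ m * a)      ≈⟨ *-assoc _ _ _ ⟨
        a⁻¹ ^ m * a ^ m * a        ≈⟨ *-congʳ (trans (sym (^-distrib-* a⁻¹ a m)) (trans (^-congˡ m (trans (*-comm a⁻¹ a) aa⁻¹≈1)) (1^ m))) ⟩
        1# * a                     ≈⟨ *-identityˡ a ⟩
        a                          ∎
    ... | a⁻¹ , aa⁻¹≈1 | Bézout.-+ s t eq = a ^ t , a⁻¹ ^ s , ^-≉0 a≉0 t , ^-≉0 a⁻¹≉0 s , sym (begin
        (a ^ t) ^ D * (a⁻¹ ^ s) ^ d              ≈⟨ *-cong (^-assocʳ a t D) (^-assocʳ a⁻¹ s d) ⟩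
        a ^ (t ℕ.* D) * a⁻¹ ^ (s ℕ.* d)          ≡⟨ cong (λ x → a ^ x * a⁻¹ ^ (s ℕ.* d)) eq ⟨
        a * a ^ (s ℕ.* d) * a⁻¹ ^ (s ℕ.* d)      ≈⟨ *-assoc _ _ _ ⟩
        a * (a ^ (s ℕ.* d) * a⁻¹ ^ (s ℕ.* d))    ≈⟨ *-congˡ (trans (sym (^-distrib-* a a⁻¹ (s ℕ.* d))) (trans (^-congˡ (s ℕ.* d) aa⁻¹≈1) (1^ (s ℕ.* d)))) ⟩
        a * 1#                                   ≈⟨ *-identityʳ a ⟩
        a                                        ∎)
      where
      open SetoidReasoning setoid
      a⁻¹≉0 : ¬ a⁻¹ ≈ 0#
      a⁻¹≉0 h = 1≉0 (trans (sym aa⁻¹≈1) (trans (*-congˡ h) (zeroʳ a)))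

    S : ℕ
    S = Σ λ x → W (x ^ d)

    -- Writing a = x ^ D * b ^ d, the factor b ^ d is absorbed by the substitution y ↦ b y, and x ^
    -- D by `W-scale`.
    ΣW-scaled : ∀ {a} → ¬ a ≈ 0# → Σ (λ x → W (a * x ^ d)) ≡ S
    ΣW-scaled {a} a≉0 = let x , b , x≉0 , b≉0 , a≈ = decompose a≉0 in
      ≡.trans (Σ-cong λ y → ≡.trans
        (W-cong {a * y ^ d} {x ^ D * (b * y) ^ d} (trans (*-congʳ a≈) (trans (*-assoc _ _ _) (*-congˡ (sym (^-distrib-* b y d))))))
        (W-scale (^D-fixed x≉0) (^-≉0 x≉0 D) ((b * y) ^ d)))
      (Σ-scale (λ y → W (y ^ d)) (λ {x} {y} h → W-cong {x ^ d} {y ^ d} (^-congˡ d h)) b≉0)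

    -- Σ over a and x of W (a x ^ d), summed in the two possible orders.
    S≡Q : S ≡ Q
    S≡Q = ℕ.*-cancelˡ-≡ S Q (Q ℕ.∸ 1) {{Q∸1≢0}} (ℕ.+-cancelˡ-≡ (Q ℕ.* W 0#) _ _ (≡.trans (≡.sym by-a)
      (≡.trans (Σ-comm (λ a x → W (a * x ^ d))) by-x)))
      where
      Q∸1≢0 : NonZero (Q ℕ.∸ 1)
      Q∸1≢0 = ℕ.≢-nonZero λ h → p∤Q∸1 (subst (p ∣_) (≡.sym h) (p ∣0))
      by-a : Σ (λ a → Σ λ x → W (a * x ^ d)) ≡ Q ℕ.* W 0# ℕ.+ (Q ℕ.∸ 1) ℕ.* S
      by-a = ≡.trans (Σ-nonzero (λ a → Σ λ x → W (a * x ^ d))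
          (λ {a} {a′} h → Σ-cong λ x → W-cong {a * x ^ d} {a′ * x ^ d} (*-congʳ h)) S (λ a a≉0 → ΣW-scaled a≉0))
        (cong (ℕ._+ (Q ℕ.∸ 1) ℕ.* S) (≡.trans (Σ-cong λ x → W-cong {0# * x ^ d} {0#} (zeroˡ _)) (ΣΣ-const (W 0#))))
      by-x : Σ (λ x → Σ λ a → W (a * x ^ d)) ≡ Q ℕ.* W 0# ℕ.+ (Q ℕ.∸ 1) ℕ.* Q
      by-x = ≡.trans (Σ-nonzero (λ x → Σ λ a → W (a * x ^ d))
          (λ {x} {x′} h → Σ-cong λ a → W-cong {a * x ^ d} {a * x′ ^ d} (*-congˡ (^-congˡ d h))) Q
          (λ x x≉0 → ≡.trans (Σ-cong λ a → W-cong {a * x ^ d} {x ^ d * a + 0#} (trans (*-comm a _) (sym (+-identityʳ _))))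
            (ΣW-linear (^-≉0 x≉0 d) 0#)))
        (cong (ℕ._+ (Q ℕ.∸ 1) ℕ.* Q) (≡.trans (Σ-cong λ a → W-cong {a * 0# ^ d} {0#} (trans (*-congˡ (0^ d)) (zeroʳ a))) (ΣΣ-const (W 0#))))

    power : ∀ k → Polynomial F (suc k)
    power k = (1# , d ∷ origin k) ∷ []

    power-degree : ∀ k → AllDegree d (power k)
    power-degree k = ≡.trans (cong (d ℕ.+_) (sum-origin k)) (ℕ.+-identityʳ d) ∷ []

    N-power : ∀ k → N F q (power k) ≡ Q ℕ.^ suc k
    N-power k = ≡.trans (N≡ΣW (power k)) (≡.trans
      (Σ-cong λ x → ≡.trans (Σ^-cong k λ v → W-cong {eval F (power k) (x ∷ v)} {x ^ d} (eval-power x v)) (Σ^-const k (W (x ^ d))))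
      (≡.trans (≡.sym (Σ-*ˡ (Q ℕ.^ k) (λ x → W (x ^ d)))) (≡.trans (cong (Q ℕ.^ k ℕ.*_) S≡Q) (ℕ.*-comm _ Q))))
      where
      eval-power : ∀ x v → eval F (power k) (x ∷ v) ≈ x ^ d
      eval-power x v = trans (+-identityʳ _) (trans (*-identityˡ _) (trans (*-congˡ (monomial-++-origin [] [] v)) (*-identityʳ _)))

    -- `extremal` needs d ≥ 2 and gives a factor prime to p for k ≥ 2. If k = 1 or d = 1, the
    -- ceiling equals k, and N = Q ^ k for the power of one variable is exactly what is wanted.
    extremal-valuation : ∀ k .{{_ : NonZero k}} →
      Σ[ f ∈ Polynomial F k ] Homogeneous F d f × ν p (N F q f) ≡ Sup.[ n ℕ.* ⌈ k / d ⌉ ]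
    extremal-valuation (suc zero) = power 0 , HomogeneousPart.allDegree⇒homogeneous F (power 0) (power-degree 0)
      , Valuation.ν-exact pr (n ℕ.* ⌈ 1 / d ⌉) 1
          (≡.trans (N-power 0) (≡.trans (cong (Q ℕ.^_) (≡.sym ⌈1/⌉)) (Q^≡ ⌈ 1 / d ⌉))) (∤-1 pr)
      where
      Q^≡ : ∀ x → Q ℕ.^ x ≡ p ℕ.^ (n ℕ.* x) ℕ.* 1
      Q^≡ x = ≡.trans (cong (ℕ._^ x) Q≡p^n) (≡.trans (ℕ.^-*-assoc p n x) (≡.sym (ℕ.*-identityʳ _)))
    extremal-valuation (suc (suc k)) = cases (ℕ.m≤n⇒m<n∨m≡n (ℕ.>-nonZero⁻¹ d))
      where
      Q^≡ : ∀ x → Q ℕ.^ x ≡ p ℕ.^ (n ℕ.* x)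
      Q^≡ x = ≡.trans (cong (ℕ._^ x) Q≡p^n) (ℕ.^-*-assoc p n x)
      cases : 1 ℕ.< d ⊎ 1 ≡ d → _
      cases (inj₁ 2≤d) = poly , HomogeneousPart.allDegree⇒homogeneous F poly degrees
        , Valuation.ν-exact pr (n ℕ.* ⌈ suc (suc k) / d ⌉) factor
            (≡.trans count (cong (ℕ._* factor) (Q^≡ ⌈ suc (suc k) / d ⌉))) (large (s≤s (s≤s z≤n)))
        where open Extremal (extremal 2≤d (suc (suc k)) (suc (suc k)) ℕ.≤-refl)
      cases (inj₂ 1≡d) = power (suc k) , HomogeneousPart.allDegree⇒homogeneous F (power (suc k)) (power-degree (suc k))
        , Valuation.ν-exact pr (n ℕ.* ⌈ suc (suc k) / d ⌉) 1
            (≡.trans (N-power (suc k)) (≡.trans (cong (Q ℕ.^_) (≡.sym ceiling))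
              (≡.trans (Q^≡ ⌈ suc (suc k) / d ⌉) (≡.sym (ℕ.*-identityʳ _))))) (∤-1 pr)
        where
        ceiling : ⌈ suc (suc k) / d ⌉ ≡ suc (suc k)
        ceiling = ⌈/⌉-unique (ℕ.≤-reflexive (cong suc (1* (suc k)))) (ℕ.≤-reflexive (≡.sym (1* (suc (suc k)))))
          where
          1* : ∀ x → d ℕ.* x ≡ x
          1* x = ≡.trans (cong (ℕ._* x) (≡.sym 1≡d)) (ℕ.*-identityˡ x)

open import Data.Nat.Base using (_*_; _∸_; _^_)
open import Relation.Nullary.Construct.Add.Supremum using ([_])

theorem5p3 :
  ∀ {c ℓ₁ ℓ₂} (p e m k d : ℕ) (p-prime : Prime p)
    .{{_ : NonZero e}} .{{_ : NonZero m}} .{{_ : NonZero k}} .{{_ : NonZero d}} →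
    let q = p ^ e
        instance q∸1≢0 = primePower∸1≢0 p-prime e
        g = gcd d ((q ^ m ∸ 1) / (q ∸ 1))
        instance g≢0 = gcd≢0 d ((q ^ m ∸ 1) / (q ∸ 1))
    in (F : FiniteField c ℓ₁ ℓ₂ (q ^ m)) →
       ((f : Polynomial F k) → Homogeneous F d f →
          ν p (N F q f) ≥ν ⌈ e * m * ⌈ g * k / d ⌉ / g ⌉)
       ×
       (g ≡ 1 →
          ((f : Polynomial F k) → Homogeneous F d f →
             ν p (N F q f) ≥ν e * m * ⌈ k / d ⌉)
          ×
          (Σ[ f ∈ Polynomial F k ] Homogeneous F d f × ν p (N F q f) ≡ [ e * m * ⌈ k / d ⌉ ]))
theorem5p3 zero e m k d p-prime F = contradiction p-prime ¬prime[0]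
theorem5p3 p@(suc p′) e m k d p-prime F = bound g gcd-spec , λ g≡1 →
    (λ f hom → NonStrict.≤⁺-trans ℕ.≤-trans (NonStrict.[ ceiling-1 ])
      (bound 1 (λ R h → subst (λ x → D ∣ R * x) g≡1 (gcd-spec R h)) f hom))
  , Example.Power.extremal-valuation F p′ n e p-prime Q≡ d
      (≡.trans q′D (cong (_∸ 1) (≡.sym Q≡))) q≡ g≡1 k
  where
  q = p ^ e
  q′ = q ∸ 1
  instance
    q∸1≢0 : NonZero (q ∸ 1)
    q∸1≢0 = primePower∸1≢0 p-prime e
  D = (q ^ m ∸ 1) / (q ∸ 1)
  g = gcd d D
  instance
    g≢0 : NonZero g
    g≢0 = gcd≢0 d D
    n≢0 : NonZero (e * m)
    n≢0 = ℕ.m*n≢0 e m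
  n = e * m
  Q≡ : q ^ m ≡ p ^ n
  Q≡ = ℕ.^-*-assoc p e m
  q≡ : q ≡ suc q′
  q≡ = ≡.sym (ℕ.suc-pred q {{ℕ.m^n≢0 p e}})
  q′D : q′ * D ≡ p ^ n ∸ 1
  q′D = ≡.trans (ℕ.*-comm q′ D) (≡.trans (m/n*n≡m (Arithmetic.q∸1∣ q m)) (cong (_∸ 1) Q≡))
  gcd-spec : ∀ R → D ∣ R * d → D ∣ R * g
  gcd-spec = Arithmetic.∣*gcd d D
  -- Stated for every g with the divisibility property, because rewriting the actual gcd to 1 inside
  -- the ceilings would also have to transport their nonzero instances; using it at 1 avoids this.
  bound : ∀ g .{{_ : NonZero g}} → (∀ R → D ∣ R * d → D ∣ R * g) → (f : Polynomial F k) → Homogeneous F d f →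
          ν p (N F q f) ≥ν ⌈ n * ⌈ g * k / d ⌉ / g ⌉
  bound g spec f hom = let h , degs , N≡ = HomogeneousPart.homogeneous-part F d q f hom in
    subst (λ x → ν p x ≥ν ⌈ n * ⌈ g * k / d ⌉ / g ⌉) (≡.sym N≡)
      (Valuation.∣⇒≥ν p-prime (N F q h) ⌈ n * ⌈ g * k / d ⌉ / g ⌉
        (Lifting.p^V∣N F p′ n p-prime Q≡ (frobeniusRing F p′ p-prime) e q′D q≡ spec h degs))
  ceiling-1 : n * ⌈ k / d ⌉ ℕ.≤ ⌈ n * ⌈ 1 * k / d ⌉ / 1 ⌉
  ceiling-1 = subst (λ x → n * ⌈ x / d ⌉ ℕ.≤ ⌈ n * ⌈ 1 * k / d ⌉ / 1 ⌉) (ℕ.*-identityˡ k)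
    (ℕ.≤-trans (Arithmetic.≤-*⌈/⌉ (n * ⌈ 1 * k / d ⌉) 1) (ℕ.≤-reflexive (ℕ.*-identityˡ _)))
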